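{- Let $\lambda=(\lambda_1,\dots,\lambda_m)$ be a partition with $m=l(\lambda)$, let $\mu$ be its conjugate partition and $n=l(\mu)=\lambda_1$. For every integer $k\ge\max(l(\lambda),\lambda_1)$, $$D_\lambda(k)=2^{\binom k2-|\lambda|}\,[y_1^{\lambda_1+m-1}y_2^{\lambda_2+m-2}\cdots y_m^{\lambda_m}]\Bigl(\prod_{1\le i<j\le m}(y_i-y_j)(1-y_i-y_j)\prod_{l=1}^m(1-y_l)^{ -k-m}\Bigr),$$ and also $$D_\lambda(k)=2^{\binom k2-|\lambda|}\,[z_1^{\mu_1+n-1}z_2^{\mu_2+n-2}\cdots z_n^{\mu_n}]\Bigl(\prod_{1\le i<j\le n}(z_i-z_j)(1+z_i+z_j)\prod_{l=1}^n(1+2z_l)(1+z_l)^{k-n}\Bigr).$$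
   Context: A partition $\lambda$ is a weakly decreasing sequence of nonnegative integers with finitely many nonzero terms; $l(\lambda)$ is the number of nonzero parts, $|\lambda|=\sum\lambda_i$, and $\lambda_i=0$ for $i>l(\lambda)$. The conjugate partition $\mu=\lambda'$ has $\mu_i=\#\{j:\lambda_j\ge i\}$. For such $\lambda$ and $k\ge\max(l(\lambda),\lambda_1)$ define the $k\times k$ determinant $D_\lambda(k)=\det\bigl(\binom{2k-i-\lambda_{k-i+1}}{2k-2j}\bigr)_{1\le i,j\le k}$ (binomial coefficients $\binom{N}{r}=0$ for $r>N$). For a formal power series $f$ in variables $y$, $[y_1^{u_1}\cdots y_m^{u_m}]f$ denotes the coefficient of $y_1^{u_1}\cdots y_m^{u_m}$ in $f$. -}

module Defs where

open import Data.Nat as ℕ using (ℕ; zero; suc; _≤_; _<ᵇ_; _≤?_)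
open import Data.Nat.Combinatorics using (_C_)
open import Data.Integer as ℤ using (ℤ; +_; -[1+_])
open import Data.Rational as ℚ using (ℚ)
open import Data.Fin as Fin using (Fin; toℕ; punchIn)
open import Data.List as List using (List; []; _∷_; length; map; filter; foldr; concatMap; applyUpTo; allFin)
open import Data.List.Relation.Unary.All using (All)
open import Data.List.Relation.Unary.Linked using (Linked)
open import Data.Vec as Vec using (Vec; []; _∷_; tabulate; replicate; zipWith; _[_]≔_)
open import Data.Vec.Properties using (≡-dec)
open import Data.Bool using (if_then_else_)
open import Relation.Nullary.Decidable using (does)

IsPartition : List ℕ → Set
IsPartition ℓ = All (λ x → 0 ℕ.< x) ℓ × Linked ℕ._≥_ ℓ
  where open import Data.Product using (_×_)

-- λ_i (1-indexed), equal to 0 for i > l(λ) (and for i = 0)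
part : List ℕ → ℕ → ℕ
part []       _             = 0
part (x ∷ xs) zero          = 0
part (x ∷ xs) (suc zero)    = x
part (x ∷ xs) (suc (suc i)) = part xs (suc i)

size : List ℕ → ℕ
size = foldr ℕ._+_ 0

conj : List ℕ → List ℕ
conj ℓ = map (λ i → length (filter (λ x → i ≤? x) ℓ)) (applyUpTo suc (part ℓ 1))

sumℤ : List ℤ → ℤ
sumℤ = foldr ℤ._+_ (+ 0)

sign : ℕ → ℤ
sign zero          = + 1
sign (suc zero)    = -[1+ 0 ]
sign (suc (suc n)) = sign n

det : (k : ℕ) → (Fin k → Fin k → ℤ) → ℤ
det zero    M = + 1
det (suc k) M =
  sumℤ (map (λ j → sign (toℕ j) ℤ.* (M Fin.zero j ℤ.* det k (λ r c → M (Fin.suc r) (punchIn j c))))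
            (allFin (suc k)))

-- D_λ(k) = det( binom(2k - i - λ_{k-i+1}, 2k - 2j) )_{1 ≤ i,j ≤ k}
Dmat : List ℕ → (k : ℕ) → Fin k → Fin k → ℤ
Dmat ℓ k i j =
  + (((2 ℕ.* k) ℕ.∸ suc (toℕ i) ℕ.∸ part ℓ (k ℕ.∸ toℕ i))
      C ((2 ℕ.* k) ℕ.∸ (2 ℕ.* suc (toℕ j))))

D : List ℕ → ℕ → ℤ
D ℓ k = det k (Dmat ℓ k)

-- Formal power series in m variables over ℤ: coefficient functions on
-- exponent vectors, with the Cauchy product.

PS : ℕ → Set
PS m = Vec ℕ m → ℤ

below : ∀ {m} → Vec ℕ m → List (Vec ℕ m)
below []       = [] ∷ []
below (x ∷ u) = concatMap (λ a → map (a ∷_) (below u)) (applyUpTo (λ a → a) (suc x))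

_⊕_ : ∀ {m} → PS m → PS m → PS m
(f ⊕ g) u = f u ℤ.+ g u

_⊗_ : ∀ {m} → PS m → PS m → PS m
(f ⊗ g) u = sumℤ (map (λ v → f v ℤ.* g (zipWith ℕ._∸_ u v)) (below u))

scal : ∀ {m} → ℤ → PS m → PS m
scal c f u = c ℤ.* f u

monomial : ∀ {m} → Vec ℕ m → PS m
monomial e u = if does (≡-dec ℕ._≟_ e u) then + 1 else + 0

one : ∀ {m} → PS m
one = monomial (replicate _ 0)

var : ∀ {m} → Fin m → PS m
var {m} i = monomial (replicate m 0 [ i ]≔ 1)

cst : ∀ {m} → ℤ → PS m
cst c = scal c one

pow : ∀ {m} → PS m → ℕ → PS m
pow f zero    = one
pow f (suc n) = f ⊗ pow f n

prodL : ∀ {m} → List (PS m) → PS m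
prodL = foldr _⊗_ one

prodFin : ∀ {m} → (Fin m → PS m) → PS m
prodFin {m} F = prodL (map F (allFin m))

prodPairs : ∀ {m} → (Fin m → Fin m → PS m) → PS m
prodPairs {m} F =
  prodFin (λ i → prodFin (λ j → if toℕ i <ᵇ toℕ j then F i j else one))

-- (1 - y_l)^{-1} = Σ_{a ≥ 0} y_l^a  (geometric series, the inverse of 1 - y_l)
invOneMinus : ∀ {m} → Fin m → PS m
invOneMinus {m} l u = if does (≡-dec ℕ._≟_ u (replicate m 0 [ l ]≔ Vec.lookup u l)) then + 1 else + 0

neg1 : ℤ
neg1 = -[1+ 0 ]

series1 : (m k : ℕ) → PS m
series1 m k =
  prodPairs (λ i j → (var i ⊕ scal neg1 (var j))
                    ⊗ ((one ⊕ scal neg1 (var i)) ⊕ scal neg1 (var j)))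
  ⊗ prodFin (λ l → pow (invOneMinus l) (k ℕ.+ m))

series2 : (n k : ℕ) → PS n
series2 n k =
  prodPairs (λ i j → (var i ⊕ scal neg1 (var j)) ⊗ ((one ⊕ var i) ⊕ var j))
  ⊗ prodFin (λ l → (one ⊕ scal (+ 2) (var l)) ⊗ pow (one ⊕ var l) (k ℕ.∸ n))

staircase : (ℓ : List ℕ) → Vec ℕ (length ℓ)
staircase ℓ = tabulate (λ i → part ℓ (suc (toℕ i)) ℕ.+ (length ℓ ℕ.∸ suc (toℕ i)))

pow2 : ℤ → ℚ
pow2 (+ n)     = (+ (2 ℕ.^ n)) ℚ./ 1
pow2 -[1+ n ]  = go (suc n)
  where
  go : ℕ → ℚ
  go zero    = ℚ.1ℚ
  go (suc a) = ℚ.½ ℚ.* go a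

toℚ : ℤ → ℚ
toℚ z = z ℚ./ 1

expo : List ℕ → ℕ → ℤ
expo ℓ k = (+ (k C 2)) ℤ.- (+ size ℓ)

{-# OPTIONS --safe #-}
-- Since (yᵢ - yⱼ)(1 - yᵢ - yⱼ) = q(yᵢ) - q(yⱼ) for q(y) = y - y², and similarly for z + z², the
-- products are Vandermonde determinants, so both coefficients are determinants of univariate
-- coefficients.  Put Eᶜ = (1 + 2z)(z + z²)ᶜ.  The second coefficient is the minor of the rows
-- E⁰, …, Eᵏ⁻¹ in the columns k - j + μⱼ, which are complementary in {0, …, 2k-1} to the numbers
-- N_r = k + r - 1 - λ_r.  Stack unit rows at the N_r on top of the rows Eᶜ, and multiply the
-- resulting 2k × 2k matrix by a fixed matrix.
--   * At z = -(1 + t)/2 the series Eᶜ is odd in t, so for a suitably scaled matrix of binomial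
--     coefficients the product is block triangular, with the binomials (N_r choose 2c) in one
--     block: this gives D_λ(k).
--   * The functionals zᴺ ↦ (-1)ᴺ [y^(M-N)] (1 - y)^(-M-1) are, up to sign, dual to the Eᶜ, so the
--     product is block triangular again: this gives the first coefficient.  The constant involved
--     does not depend on λ and is found from the empty partition.
module Submission where

open import Level using (_⊔_; 0ℓ)
open import Algebra.Bundles using (CommutativeMonoid; CommutativeRing)
open import Algebra.Morphism.Structures using (module RingMorphisms)
open import Algebra.Structures using (IsCommutativeRing)
open import Data.Bool using (true; _∧_; if_then_else_)
open import Data.Empty using (⊥-elim)
open import Data.Fin as Fin using (Fin; zero; suc; toℕ; fromℕ; fromℕ<; inject₁; punchIn; punchOut; opposite; _↑ˡ_; _↑ʳ_)
import Data.Fin.Properties as Finₚ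
open import Data.Integer as ℤ using (ℤ; +_)
import Data.Integer.Properties as ℤₚ
open import Data.Integer.Tactic.RingSolver using (solve-∀)
open import Data.List using (List; []; _∷_; length; filter; map; concatMap; applyUpTo; tabulate; _++_)
import Data.List.Properties as Listₚ
open import Data.List.Relation.Unary.Linked as Linked using (Linked; []; [-]; _∷_)
open import Data.Nat as ℕ using (ℕ; zero; suc)
import Data.Nat.Properties as ℕₚ
open import Data.Product using (_×_; _,_; ∃)
open import Data.Rational as ℚ using (ℚ)
import Data.Rational.Properties as ℚₚ
open import Data.Rational.Unnormalised using (mkℚᵘ)
import Data.Rational.Unnormalised.Properties as ℚᵘₚ
open import Data.Sum using (_⊎_; inj₁; inj₂)
open import Data.Unit using (⊤)
open import Data.Vec as Vec using (Vec; []; _∷_; lookup; replicate; zipWith)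
import Data.Vec.Properties as Vecₚ
open import Data.Vec.Functional using (insertAt) renaming (_∷_ to _◂_)
open import Function using (_∘_; id; case_of_)
open import Relation.Binary using (tri<; tri≈; tri>)
open import Relation.Binary.PropositionalEquality as ≡ using (_≡_; _≢_; cong; cong₂)
open import Relation.Nullary using (Dec; yes; no)
open import Relation.Nullary.Decidable using (does; ⌊_⌋)

-- Determinants over a commutative ring

-- Passing from λ to its conjugate is Jacobi's identity for complementary minors, usually stated
-- with an inverse matrix and the sign of a shuffle; stacking avoids both. The 2k boundary steps of
-- the diagram in a k by k box are numbered so that the N_r are the steps in one direction and the
-- columns of the minor are those in the other. Walking back along the boundary, each unit row is
-- expanded in a column that has not moved yet, and the sign (-1)^(N_r) placed in that row cancels
-- its cofactor sign. The power of two comes from denominators. At z = -(1 + t)/2, row l of the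
-- binomial matrix needs the weight 2^(2k-1-l), so row N_r carries 2^(k-r+λ_r): altogether 2 to the
-- power binom(k,2) + |λ|. The full determinant contains 2 to the power 2 binom(k,2), and both sides
-- share a further nonzero factor that is cancelled without being evaluated. The dual functionals
-- come from z = -y: with q = y - y² one has (1 - 2y) dy = dq, and they are residues against powers
-- of q.

punchIn-view : ∀ {n} (j c : Fin (suc n)) → (c ≡ j) ⊎ ∃ λ c′ → c ≡ punchIn j c′
punchIn-view j c with j Fin.≟ c
... | yes j≡c = inj₁ (≡.sym j≡c)
... | no  j≢c = inj₂ (punchOut j≢c , ≡.sym (Finₚ.punchIn-punchOut j≢c))

punchIn-↑ˡ : ∀ {a} b (j : Fin (suc a)) k → punchIn (j ↑ˡ b) (k ↑ˡ b) ≡ punchIn j k ↑ˡ b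
punchIn-↑ˡ b zero    k       = ≡.refl
punchIn-↑ˡ b (suc j) zero    = ≡.refl
punchIn-↑ˡ b (suc j) (suc k) = ≡.cong suc (punchIn-↑ˡ b j k)

punchIn-↑ʳ : ∀ {a} b (j : Fin (suc a)) (k : Fin b) → punchIn (j ↑ˡ b) (a ↑ʳ k) ≡ suc a ↑ʳ k
punchIn-↑ʳ         b zero    k = ≡.refl
punchIn-↑ʳ {suc a} b (suc j) k = ≡.cong suc (punchIn-↑ʳ b j k)

punchIn-fromℕ : ∀ {n} (k : Fin n) → punchIn (fromℕ n) k ≡ inject₁ k
punchIn-fromℕ zero    = ≡.refl
punchIn-fromℕ (suc k) = ≡.cong suc (punchIn-fromℕ k)

-- Reversal keeps adjacent rows adjacent and exchanges their order, which is what alternation in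
-- `det-reverse` requires.
opposite-adjacent : ∀ {n} (i j : Fin n) → toℕ j ≡ suc (toℕ i) →
                    toℕ (opposite i) ≡ suc (toℕ (opposite j))
opposite-adjacent {n} i j eq = begin
  toℕ (opposite i)         ≡⟨ Finₚ.opposite-prop i ⟩
  n ℕ.∸ suc (toℕ i)        ≡⟨ ≡.cong (n ℕ.∸_) eq ⟨
  n ℕ.∸ toℕ j              ≡⟨ ℕₚ.+-∸-assoc 1 (Finₚ.toℕ<n j) ⟩
  suc (n ℕ.∸ suc (toℕ j))  ≡⟨ ≡.cong suc (Finₚ.opposite-prop j) ⟨
  suc (toℕ (opposite j))   ∎
  where open ≡.≡-Reasoning

module Determinant {c ℓ} (R : CommutativeRing c ℓ) where

  open CommutativeRing R hiding (zero)
  open import Algebra.Properties.Semiring.Sum semiring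
  open import Algebra.Properties.CommutativeMonoid.Sum *-commutativeMonoid
    using () renaming (sum to ∏; sum-cong-≋ to ∏-cong)
  open import Algebra.Properties.Semiring.Exp semiring using (_^_)
  open import Algebra.Properties.Ring ring
  open import Algebra.Properties.CommutativeSemigroup *-commutativeSemigroup
    using (x∙yz≈y∙xz; x∙yz≈xy∙z; interchange)
  open import Relation.Binary.Reasoning.Setoid setoid

  sgn : ℕ → Carrier
  sgn zero    = 1#
  sgn (suc n) = - sgn n

  sgn²≈1 : ∀ n → sgn n * sgn n ≈ 1#
  sgn²≈1 zero    = *-identityˡ 1#
  sgn²≈1 (suc n) = begin
    - sgn n * - sgn n     ≈⟨ -‿distribˡ-* _ _ ⟨
    - (sgn n * - sgn n)   ≈⟨ -‿cong (-‿distribʳ-* _ _) ⟨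
    - - (sgn n * sgn n)   ≈⟨ -‿involutive _ ⟩
    sgn n * sgn n         ≈⟨ sgn²≈1 n ⟩
    1#                    ∎

  sgn-cancel : ∀ n {x} → sgn n * x ≈ 0# → x ≈ 0#
  sgn-cancel n {x} eq = begin
    x                   ≈⟨ *-identityˡ x ⟨
    1# * x              ≈⟨ *-congʳ (sgn²≈1 n) ⟨
    sgn n * sgn n * x   ≈⟨ *-assoc _ _ _ ⟩
    sgn n * (sgn n * x) ≈⟨ *-congˡ eq ⟩
    sgn n * 0#          ≈⟨ zeroʳ _ ⟩
    0#                  ∎

  Row : ℕ → Set c
  Row d = Fin d → Carrier

  Mat : ℕ → ℕ → Set c
  Mat n d = Fin n → Row d

  det : ∀ n → Mat n n → Carrier
  det zero    M = 1#
  det (suc n) M =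
    ∑[ j < suc n ] (sgn (toℕ j) * (M zero j * det n (λ r k → M (suc r) (punchIn j k))))

  det-cong : ∀ n {M N : Mat n n} → (∀ i j → M i j ≈ N i j) → det n M ≈ det n N
  det-cong zero    eq = refl
  det-cong (suc n) eq = sum-cong-≋ λ j → *-congˡ {sgn (toℕ j)}
    (*-cong (eq zero j) (det-cong n λ r k → eq (suc r) (punchIn j k)))

  sum-zero : ∀ {n} (f : Row n) → (∀ i → f i ≈ 0#) → sum f ≈ 0#
  sum-zero {n} f eq = trans (sum-cong-≋ eq) (sum-replicate-zero n)

  sum-single : ∀ {n} (f : Row (suc n)) i → (∀ j → f (punchIn i j) ≈ 0#) → sum f ≈ f i
  sum-single f i eq = begin
    sum f                        ≈⟨ sum-remove f ⟩
    f i + sum (f ∘ punchIn i)    ≈⟨ +-congˡ (sum-zero _ eq) ⟩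
    f i + 0#                     ≈⟨ +-identityʳ _ ⟩
    f i                          ∎

  δ : ∀ {n} → Mat n n
  δ zero    zero    = 1#
  δ zero    (suc j) = 0#
  δ (suc i) zero    = 0#
  δ (suc i) (suc j) = δ i j

  δ-refl : ∀ {n} (i : Fin n) → δ i i ≡ 1#
  δ-refl zero    = ≡.refl
  δ-refl (suc i) = δ-refl i

  δ-sym : ∀ {n} (i j : Fin n) → δ i j ≡ δ j i
  δ-sym zero    zero    = ≡.refl
  δ-sym zero    (suc j) = ≡.refl
  δ-sym (suc i) zero    = ≡.refl
  δ-sym (suc i) (suc j) = δ-sym i j

  δ-punchIn : ∀ {n} (j : Fin (suc n)) i k → δ (punchIn j i) (punchIn j k) ≡ δ i k
  δ-punchIn zero    i       k       = ≡.refl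
  δ-punchIn (suc j) zero    zero    = ≡.refl
  δ-punchIn (suc j) zero    (suc k) = ≡.refl
  δ-punchIn (suc j) (suc i) zero    = ≡.refl
  δ-punchIn (suc j) (suc i) (suc k) = δ-punchIn j i k

  δ-punchIn-self : ∀ {n} (j : Fin (suc n)) i → δ (punchIn j i) j ≡ 0#
  δ-punchIn-self zero    i       = ≡.refl
  δ-punchIn-self (suc j) zero    = ≡.refl
  δ-punchIn-self (suc j) (suc i) = δ-punchIn-self j i

  sum-δ : ∀ {n} (f : Row n) k → ∑[ j < n ] (f j * δ j k) ≈ f k
  sum-δ f zero    = begin
    f zero * 1# + sum (λ j → f (suc j) * 0#)
      ≈⟨ +-cong (*-identityʳ _) (sum-zero _ λ j → zeroʳ (f (suc j))) ⟩
    f zero + 0#  ≈⟨ +-identityʳ _ ⟩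
    f zero       ∎
  sum-δ f (suc k) = begin
    f zero * 0# + sum (λ j → f (suc j) * δ j k)
      ≈⟨ +-cong (zeroʳ _) (sum-δ (f ∘ suc) k) ⟩
    0# + f (suc k)  ≈⟨ +-identityˡ _ ⟩
    f (suc k)       ∎

  -- Alternation is only required for adjacent rows: this is what passes to
  -- Laplace expansions without any bookkeeping of signs.
  record IsAlternating {n d} (F : Mat n d → Carrier) : Set (c ⊔ ℓ) where
    field
      resp : ∀ {v w} → (∀ i k → v i k ≈ w i k) → F v ≈ F w
      linear : ∀ {v u w} i a b →
               (∀ j → j ≢ i → ∀ k → v j k ≈ u j k) →
               (∀ j → j ≢ i → ∀ k → v j k ≈ w j k) →
               (∀ k → v i k ≈ a * u i k + b * w i k) →
               F v ≈ a * F u + b * F w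
      alternating : ∀ v i j → toℕ j ≡ suc (toℕ i) → (∀ k → v i k ≈ v j k) → F v ≈ 0#

  open IsAlternating

  ◂-η : ∀ {n d} (v : Mat (suc n) d) i k → (v zero ◂ v ∘ suc) i k ≈ v i k
  ◂-η v zero    k = refl
  ◂-η v (suc i) k = refl

  ◂-cong : ∀ {n d} {x y : Row d} {v w : Mat n d} → (∀ k → x k ≈ y k) →
           (∀ i k → v i k ≈ w i k) → ∀ i k → (x ◂ v) i k ≈ (y ◂ w) i k
  ◂-cong p q zero    k = p k
  ◂-cong p q (suc i) k = q i k

  module _ {n d} {F : Mat (suc n) d → Carrier} (alt : IsAlternating F) where

    fix-head : ∀ x → IsAlternating (λ v → F (x ◂ v))
    fix-head x .resp eq = alt .resp (◂-cong (λ _ → refl) eq)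
    fix-head x .linear i a b p q r = alt .linear (suc i) a b
      (λ { zero _ k → refl ; (suc j) j≢i k → p j (j≢i ∘ ≡.cong suc) k })
      (λ { zero _ k → refl ; (suc j) j≢i k → q j (j≢i ∘ ≡.cong suc) k })
      r
    fix-head x .alternating v i j eq = alt .alternating (x ◂ v) (suc i) (suc j) (≡.cong suc eq)

    head-linear : ∀ {z x y v} a b → (∀ k → z k ≈ a * x k + b * y k) →
                  F (z ◂ v) ≈ a * F (x ◂ v) + b * F (y ◂ v)
    head-linear a b eq = alt .linear zero a b
      (λ { zero j≢0 → ⊥-elim (j≢0 ≡.refl) ; (suc j) _ k → refl })
      (λ { zero j≢0 → ⊥-elim (j≢0 ≡.refl) ; (suc j) _ k → refl })
      eq

    head-+ : ∀ x y v → F ((λ k → x k + y k) ◂ v) ≈ F (x ◂ v) + F (y ◂ v)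
    head-+ x y v = trans
      (head-linear 1# 1# λ k → +-cong (sym (*-identityˡ _)) (sym (*-identityˡ _)))
      (+-cong (*-identityˡ _) (*-identityˡ _))

    head-∑ : ∀ p (a : Row p) (x : Mat p d) v →
             F ((λ k → ∑[ j < p ] (a j * x j k)) ◂ v) ≈ ∑[ j < p ] (a j * F (x j ◂ v))
    head-∑ zero a x v = begin
      F ((λ k → 0#) ◂ v)
        ≈⟨ head-linear 0# 0# (λ k → sym (trans (+-cong (zeroˡ 0#) (zeroˡ 0#)) (+-identityˡ 0#))) ⟩
      0# * _ + 0# * _  ≈⟨ +-cong (zeroˡ _) (zeroˡ _) ⟩
      0# + 0#          ≈⟨ +-identityˡ 0# ⟩
      0#               ∎
    head-∑ (suc p) a x v = trans
      (head-linear (a zero) 1# λ k → +-congˡ (sym (*-identityˡ _)))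
      (+-congˡ (trans (*-identityˡ _) (head-∑ p (a ∘ suc) (x ∘ suc) v)))

  -- Polarisation: `F` vanishes with x + y in both of the first two rows, and of the four terms in
  -- the expansion those with equal rows vanish too.
  swap : ∀ {n d} {F : Mat (suc (suc n)) d → Carrier} → IsAlternating F →
         ∀ x y v → F (x ◂ y ◂ v) ≈ - F (y ◂ x ◂ v)
  swap {F = F} alt x y v = +-inverseˡ-unique _ _ (begin
    F (x ◂ y ◂ v) + F (y ◂ x ◂ v)
      ≈⟨ +-cong (+-identityˡ _) (+-identityʳ _) ⟨
    (0# + F (x ◂ y ◂ v)) + (F (y ◂ x ◂ v) + 0#)
      ≈⟨ +-cong (+-congʳ (sym (equal x))) (+-congˡ (sym (equal y))) ⟩
    (F (x ◂ x ◂ v) + F (x ◂ y ◂ v)) + (F (y ◂ x ◂ v) + F (y ◂ y ◂ v))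
      ≈⟨ +-cong (head-+ (fix-head alt x) x y v) (head-+ (fix-head alt y) x y v) ⟨
    F (x ◂ z ◂ v) + F (y ◂ z ◂ v)  ≈⟨ head-+ alt x y (z ◂ v) ⟨
    F (z ◂ z ◂ v)                  ≈⟨ equal z ⟩
    0#                             ∎)
    where
    z = λ k → x k + y k
    equal : ∀ w → F (w ◂ w ◂ v) ≈ 0#
    equal w = alt .alternating _ zero (suc zero) ≡.refl (λ _ → refl)

  -- Row j reaches the top by j adjacent transpositions, each of which costs a sign by `swap`.
  rotate : ∀ {n d} {F : Mat (suc n) d → Carrier} → IsAlternating F →
           ∀ v j → F (v j ◂ v ∘ punchIn j) ≈ sgn (toℕ j) * F v
  rotate {F = F} alt v zero = trans (alt .resp (◂-η v)) (sym (*-identityˡ _))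
  rotate {suc n} {F = F} alt v (suc j) = begin
    F (v (suc j) ◂ v ∘ punchIn (suc j))
      ≈⟨ alt .resp (◂-cong (λ _ → refl) λ { zero _ → refl ; (suc i) _ → refl }) ⟩
    F (v (suc j) ◂ v zero ◂ v ∘ suc ∘ punchIn j)    ≈⟨ swap alt _ _ _ ⟩
    - F (v zero ◂ v (suc j) ◂ v ∘ suc ∘ punchIn j)
      ≈⟨ -‿cong (rotate (fix-head alt (v zero)) (v ∘ suc) j) ⟩
    - (sgn (toℕ j) * F (v zero ◂ v ∘ suc))          ≈⟨ -‿distribˡ-* _ _ ⟩
    - sgn (toℕ j) * F (v zero ◂ v ∘ suc)            ≈⟨ *-congˡ (alt .resp (◂-η v)) ⟩
    - sgn (toℕ j) * F v                             ∎

  repeated-head : ∀ {n d} {F : Mat (suc n) d → Carrier} → IsAlternating F →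
                  ∀ (x : Row d) v i → (∀ k → v i k ≈ x k) → F (x ◂ v) ≈ 0#
  repeated-head {suc n} {F = F} alt x v i eq = sgn-cancel (toℕ i) (begin
    sgn (toℕ i) * F (x ◂ v)         ≈⟨ rotate (fix-head alt x) v i ⟨
    F (x ◂ v i ◂ v ∘ punchIn i)
      ≈⟨ alt .alternating _ zero (suc zero) ≡.refl (λ k → sym (eq k)) ⟩
    0#                              ∎)

  -- The vector x stands outside the matrix. In `det-unique` it is the fixed head `δ j`, and
  -- subtracting its multiples from the rows below empties column j.
  clear : ∀ {n d} {F : Mat n d → Carrier} → IsAlternating F →
          ∀ (x : Row d) → (∀ v i → (∀ k → v i k ≈ x k) → F v ≈ 0#) →
          ∀ t t′ (a : Row n) → (∀ i k → t i k ≈ t′ i k + a i * x k) → F t ≈ F t′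
  clear {zero}  alt x van t t′ a eq = alt .resp λ ()
  clear {suc n} {F = F} alt x van t t′ a eq = begin
    F t                          ≈⟨ alt .resp (◂-η t) ⟨
    F (t zero ◂ t ∘ suc)
      ≈⟨ head-linear alt 1# (a zero) (λ k → trans (eq zero k) (+-congʳ (sym (*-identityˡ _)))) ⟩
    1# * F (t′ zero ◂ t ∘ suc) + a zero * F (x ◂ t ∘ suc)
      ≈⟨ +-cong (*-identityˡ _) (trans (*-congˡ (van _ zero λ _ → refl)) (zeroʳ _)) ⟩
    F (t′ zero ◂ t ∘ suc) + 0#   ≈⟨ +-identityʳ _ ⟩
    F (t′ zero ◂ t ∘ suc)
      ≈⟨ clear (fix-head alt (t′ zero)) x (λ v i → van _ (suc i)) _ _ (a ∘ suc) (eq ∘ suc) ⟩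
    F (t′ zero ◂ t′ ∘ suc)       ≈⟨ alt .resp (◂-η t′) ⟩
    F t′                         ∎

  insert0 : ∀ {d} → Fin (suc d) → Row d → Row (suc d)
  insert0 j w = insertAt w j 0#

  insert0-self : ∀ {d} (j : Fin (suc d)) w → insert0 j w j ≈ 0#
  insert0-self zero            w = refl
  insert0-self {suc d} (suc j) w = insert0-self j (w ∘ suc)

  insert0-punchIn : ∀ {d} (j : Fin (suc d)) w k → insert0 j w (punchIn j k) ≈ w k
  insert0-punchIn zero    w k       = refl
  insert0-punchIn (suc j) w zero    = refl
  insert0-punchIn (suc j) w (suc k) = insert0-punchIn j (w ∘ suc) k

  insert0-elim : ∀ {d} (j : Fin (suc d)) w (z : Row (suc d)) → z j ≈ 0# →
                 (∀ k → z (punchIn j k) ≈ w k) → ∀ k → z k ≈ insert0 j w k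
  insert0-elim j w z p q k with punchIn-view j k
  ... | inj₁ ≡.refl       = trans p (sym (insert0-self j w))
  ... | inj₂ (l , ≡.refl) = trans (q l) (sym (insert0-punchIn j w l))

  -- Together with `fix-head` this turns an alternating function of size n + 1 into one of size n,
  -- on which `det-unique` recurses.
  insert0-alternating : ∀ {n d} {F : Mat n (suc d) → Carrier} → IsAlternating F →
                        ∀ j → IsAlternating (λ w → F (insert0 j ∘ w))
  insert0-alternating {F = F} alt j = record
    { resp        = λ eq → alt .resp λ i → cong₀ (eq i)
    ; linear      = λ i a b p q r → alt .linear i a b
        (λ l l≢i → cong₀ (p l l≢i)) (λ l l≢i → cong₀ (q l l≢i))
        (λ k → sym (insert0-elim j _ _
          (trans (+-cong (trans (*-congˡ (insert0-self j _)) (zeroʳ a))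
                         (trans (*-congˡ (insert0-self j _)) (zeroʳ b)))
                 (+-identityˡ 0#))
          (λ l → trans (+-cong (*-congˡ (insert0-punchIn j _ l)) (*-congˡ (insert0-punchIn j _ l)))
                       (sym (r l))) k))
    ; alternating = λ v i l eq p → alt .alternating _ i l eq (cong₀ p)
    }
    where
    cong₀ : ∀ {v w : Row _} → (∀ k → v k ≈ w k) → ∀ k → insert0 j v k ≈ insert0 j w k
    cong₀ eq = insert0-elim j _ _ (insert0-self j _) λ k → trans (insert0-punchIn j _ k) (eq k)

  -- Expand the first row in unit vectors, clear column j below `δ j`, and recurse on what is left.
  -- Nothing about alternation of `det` itself is presupposed: that follows afterwards, through
  -- transposition. Transposition, multiplicativity and reversal all come from applying this to a
  -- suitable `F` and comparing values at the identity.
  det-unique : ∀ n {F : Mat n n → Carrier} → IsAlternating F → ∀ v → F v ≈ det n v * F δ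
  det-unique zero        alt v = trans (alt .resp λ ()) (sym (*-identityˡ _))
  det-unique (suc n) {F} alt v = begin
    F v                                                  ≈⟨ alt .resp (◂-η v) ⟨
    F (v zero ◂ v ∘ suc)
      ≈⟨ alt .resp (◂-cong (λ k → sym (sum-δ (v zero) k)) (λ _ _ → refl)) ⟩
    F ((λ k → sum (λ j → v zero j * δ j k)) ◂ v ∘ suc)   ≈⟨ head-∑ alt _ (v zero) δ _ ⟩
    sum (λ j → v zero j * F (δ j ◂ v ∘ suc))             ≈⟨ sum-cong-≋ term ⟩
    sum (λ j → a j * F δ)                                ≈⟨ *-distribʳ-sum (F δ) a ⟨
    det (suc n) v * F δ                                  ∎
    where
    minor : Fin (suc n) → Mat n n
    minor j r k = v (suc r) (punchIn j k)
    a = λ j → sgn (toℕ j) * (v zero j * det n (minor j))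
    eliminate : ∀ j → F (δ j ◂ v ∘ suc) ≈ F (δ j ◂ insert0 j ∘ minor j)
    eliminate j = clear (fix-head alt (δ j)) (δ j) (repeated-head alt (δ j)) _ _
      (λ i → v (suc i) j) λ i k → eq i k
      where
      eq : ∀ i k → v (suc i) k ≈ insert0 j (minor j i) k + v (suc i) j * δ j k
      eq i k with punchIn-view j k
      ... | inj₁ ≡.refl = begin
        v (suc i) j                ≈⟨ *-identityʳ _ ⟨
        v (suc i) j * 1#           ≈⟨ *-congˡ (reflexive (δ-refl j)) ⟨
        v (suc i) j * δ j j        ≈⟨ +-identityˡ _ ⟨
        0# + v (suc i) j * δ j j   ≈⟨ +-congʳ (insert0-self j _) ⟨
        insert0 j (minor j i) j + v (suc i) j * δ j j ∎
      ... | inj₂ (l , ≡.refl) = begin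
        v (suc i) (punchIn j l)        ≈⟨ +-identityʳ _ ⟨
        minor j i l + 0#
          ≈⟨ +-cong (sym (insert0-punchIn j _ l)) (sym (trans (*-congˡ (reflexive
               (≡.trans (δ-sym j (punchIn j l)) (δ-punchIn-self j l)))) (zeroʳ _))) ⟩
        insert0 j (minor j i) (punchIn j l) + v (suc i) j * δ j (punchIn j l) ∎
    term : ∀ j → v zero j * F (δ j ◂ v ∘ suc) ≈ a j * F δ
    term j = begin
      v zero j * F (δ j ◂ v ∘ suc)                    ≈⟨ *-congˡ (eliminate j) ⟩
      v zero j * F (δ j ◂ insert0 j ∘ minor j)
        ≈⟨ *-congˡ (det-unique n (insert0-alternating (fix-head alt (δ j)) j) (minor j)) ⟩
      v zero j * (det n (minor j) * F (δ j ◂ insert0 j ∘ δ))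
        ≈⟨ *-congˡ (*-congˡ (alt .resp (◂-cong (λ _ → refl) λ i k → sym (insert0-elim j (δ i) (δ (punchIn j i))
             (reflexive (δ-punchIn-self j i)) (λ l → reflexive (δ-punchIn j i l)) k)))) ⟩
      v zero j * (det n (minor j) * F (δ j ◂ δ ∘ punchIn j))
        -- Unit row j on top of the other unit rows is a rotated identity matrix; the rotation
        -- supplies the Laplace sign.
        ≈⟨ *-congˡ (*-congˡ (rotate alt δ j)) ⟩
      v zero j * (det n (minor j) * (sgn (toℕ j) * F δ))  ≈⟨ *-assoc _ _ _ ⟨
      v zero j * det n (minor j) * (sgn (toℕ j) * F δ)    ≈⟨ x∙yz≈y∙xz _ _ _ ⟩
      sgn (toℕ j) * (v zero j * det n (minor j) * F δ)    ≈⟨ *-assoc _ _ _ ⟨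
      a j * F δ                                           ∎

  IsAlternating-resp : ∀ {n d} {F G : Mat n d → Carrier} → (∀ v → F v ≈ G v) →
                       IsAlternating F → IsAlternating G
  IsAlternating-resp eq alt = record
    { resp        = λ p → trans (sym (eq _)) (trans (alt .resp p) (eq _))
    ; linear      = λ i a b p q r → trans (sym (eq _)) (trans (alt .linear i a b p q r)
                      (+-cong (*-congˡ (eq _)) (*-congˡ (eq _))))
    ; alternating = λ v i j p q → trans (sym (eq _)) (alt .alternating v i j p q)
    }

  -- Laplace expansion with one coordinate of the n + 1 vectors kept in a and the remaining data in
  -- y. The separation lets the induction in `wedge-vanishes` strip the first vector while f changes
  -- by `fix-head`.
  wedge : ∀ {n d} → (Mat n d → Carrier) → Row (suc n) → Mat (suc n) d → Carrier
  wedge {n} f a y = ∑[ j < suc n ] (sgn (toℕ j) * (a j * f (y ∘ punchIn j)))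

  -- The two terms that omit one of the equal vectors cancel, and every other term still contains
  -- both of them side by side. The recursion strips vectors until the equal pair is in front.
  wedge-vanishes : ∀ {n d} {f : Mat n d → Carrier} → IsAlternating f →
                   ∀ a y i j → toℕ j ≡ suc (toℕ i) → a i ≈ a j → (∀ k → y i k ≈ y j k) →
                   wedge f a y ≈ 0#
  wedge-vanishes {suc n} {f = f} alt a y zero (suc zero) _ p q = begin
    1# * (a zero * f (y ∘ suc)) +
      (- 1# * (a (suc zero) * f (y ∘ punchIn (suc zero))) + rest)
        ≈⟨ +-assoc _ _ _ ⟨
    (1# * (a zero * f (y ∘ suc)) + - 1# * (a (suc zero) * f (y ∘ punchIn (suc zero)))) + rest
        ≈⟨ +-cong (+-cong (*-identityˡ _) (trans (-1*x≈-x _) (-‿cong (*-cong (sym p) (alt .resp same))))) rest≈0 ⟩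
    (a zero * f (y ∘ suc) - a zero * f (y ∘ suc)) + 0#  ≈⟨ +-identityʳ _ ⟩
    a zero * f (y ∘ suc) - a zero * f (y ∘ suc)         ≈⟨ -‿inverseʳ _ ⟩
    0#                                                  ∎
    where
    rest = ∑[ j < n ] (sgn (toℕ (suc (suc j))) * (a (suc (suc j)) * f (y ∘ punchIn (suc (suc j)))))
    same : ∀ i k → y (punchIn (suc zero) i) k ≈ y (suc i) k
    same zero    k = q k
    same (suc i) k = refl
    term : ∀ {n} {f : Mat (suc n) _ → Carrier} → IsAlternating f → ∀ (y : Mat (suc (suc n)) _) →
           (∀ k → y zero k ≈ y (suc zero) k) → ∀ (j : Fin n) → f (y ∘ punchIn (suc (suc j))) ≈ 0#
    term {suc n} alt y q j = alt .alternating _ zero (suc zero) ≡.refl q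
    rest≈0 : rest ≈ 0#
    rest≈0 = sum-zero _ λ j → trans (*-congˡ (trans (*-congˡ (term alt y q j)) (zeroʳ _))) (zeroʳ _)
  wedge-vanishes {suc n} {f = f} alt a y (suc i) (suc j) eq p q = begin
    1# * (a zero * f (y ∘ suc)) + ∑[ l < suc n ] (- sgn (toℕ l) * (a (suc l) * f (y ∘ punchIn (suc l))))
      ≈⟨ +-cong (trans (*-identityˡ _) (trans (*-congˡ (alt .alternating _ i j eq′ q)) (zeroʳ _)))
                (sum-cong-≋ term) ⟩
    0# + ∑[ l < suc n ] (- 1# * (sgn (toℕ l) * (a (suc l) * f (y zero ◂ y ∘ suc ∘ punchIn l))))
      ≈⟨ +-identityˡ _ ⟩
    ∑[ l < suc n ] (- 1# * (sgn (toℕ l) * (a (suc l) * f (y zero ◂ y ∘ suc ∘ punchIn l))))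
      ≈⟨ *-distribˡ-sum {suc n} (- 1#)
           (λ l → sgn (toℕ l) * (a (suc l) * f (y zero ◂ y ∘ suc ∘ punchIn l))) ⟨
    - 1# * wedge (λ w → f (y zero ◂ w)) (a ∘ suc) (y ∘ suc)
      ≈⟨ *-congˡ (wedge-vanishes (fix-head alt (y zero)) (a ∘ suc) (y ∘ suc) i j eq′ p q) ⟩
    - 1# * 0#  ≈⟨ zeroʳ _ ⟩
    0#         ∎
    where
    eq′ = ℕₚ.suc-injective eq
    term : ∀ l → - sgn (toℕ l) * (a (suc l) * f (y ∘ punchIn (suc l))) ≈
                 - 1# * (sgn (toℕ l) * (a (suc l) * f (y zero ◂ y ∘ suc ∘ punchIn l)))
    term l = trans (*-cong (sym (-1*x≈-x _)) (*-congˡ (alt .resp λ { zero _ → refl ; (suc _) _ → refl })))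
                   (*-assoc _ _ _)

  -- Expansion along row 0 is a `wedge` of the columns, so columns are the side on which alternation
  -- can be proved directly.
  det-columns : ∀ n → IsAlternating (λ (v : Mat n n) → det n (λ r k → v k r))
  det-columns zero = record
    { resp = λ _ → refl ; linear = λ () ; alternating = λ _ () }
  det-columns (suc n) = record
    { resp        = λ eq → det-cong (suc n) λ r k → eq k r
    ; linear      = lin
    ; alternating = λ v i j eq p →
        wedge-vanishes (det-columns n) (λ k → v k zero) (λ k → v k ∘ suc) i j eq (p zero) (p ∘ suc)
    }
    where
    F = λ (v : Mat (suc n) (suc n)) → det (suc n) (λ r k → v k r)
    rearr : ∀ s x a y b z {t} → t ≈ a * y + b * z →
            s * (x * t) ≈ a * (s * (x * y)) + b * (s * (x * z))
    rearr s x a y b z {t} eq = begin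
      s * (x * t)                        ≈⟨ *-congˡ (*-congˡ eq) ⟩
      s * (x * (a * y + b * z))          ≈⟨ *-congˡ (distribˡ _ _ _) ⟩
      s * (x * (a * y) + x * (b * z))    ≈⟨ distribˡ _ _ _ ⟩
      s * (x * (a * y)) + s * (x * (b * z))
        ≈⟨ +-cong (*-congˡ (x∙yz≈y∙xz _ _ _)) (*-congˡ (x∙yz≈y∙xz _ _ _)) ⟩
      s * (a * (x * y)) + s * (b * (x * z))
        ≈⟨ +-cong (x∙yz≈y∙xz _ _ _) (x∙yz≈y∙xz _ _ _) ⟩
      a * (s * (x * y)) + b * (s * (x * z)) ∎
    lin : ∀ {v u w} i a b →
          (∀ j → j ≢ i → ∀ k → v j k ≈ u j k) →
          (∀ j → j ≢ i → ∀ k → v j k ≈ w j k) →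
          (∀ k → v i k ≈ a * u i k + b * w i k) → F v ≈ a * F u + b * F w
    lin {v} {u} {w} i a b p q r = begin
      sum (t v)                                     ≈⟨ sum-cong-≋ term ⟩
      sum (λ j → a * t u j + b * t w j)             ≈⟨ ∑-distrib-+ {suc n} (λ j → a * t u j) (λ j → b * t w j) ⟩
      sum (λ j → a * t u j) + sum (λ j → b * t w j)
        ≈⟨ +-cong (*-distribˡ-sum {suc n} a (t u)) (*-distribˡ-sum {suc n} b (t w)) ⟨
      a * sum (t u) + b * sum (t w)                 ∎
      where
      m : Mat (suc n) (suc n) → Fin (suc n) → Carrier
      m v j = det n (λ r k → v (punchIn j k) (suc r))
      t : Mat (suc n) (suc n) → Row (suc n)
      t v j = sgn (toℕ j) * (v j zero * m v j)
      term : ∀ j → t v j ≈ a * t u j + b * t w j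
      term j with punchIn-view j i
      -- The altered column is the one struck out: linearity comes from the entry, and the minors
      -- agree.
      ... | inj₁ ≡.refl = begin
        s * (v j zero * m v j)                          ≈⟨ *-congˡ (*-comm _ _) ⟩
        s * (m v j * v j zero)                          ≈⟨ rearr _ _ _ _ _ _ (r zero) ⟩
        a * (s * (m v j * u j zero)) + b * (s * (m v j * w j zero))
          ≈⟨ +-cong (*-congˡ (*-congˡ (trans (*-comm _ _) (*-congˡ (det-cong n λ r k → p _ (Finₚ.punchInᵢ≢i j k) (suc r))))))
                    (*-congˡ (*-congˡ (trans (*-comm _ _) (*-congˡ (det-cong n λ r k → q _ (Finₚ.punchInᵢ≢i j k) (suc r)))))) ⟩
        a * t u j + b * t w j ∎
        where s = sgn (toℕ j)
      ... | inj₂ (l , ≡.refl) = trans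
        (rearr _ _ _ _ _ _ (det-columns n .linear l a b
          (λ k k≢l x → p _ (k≢l ∘ Finₚ.punchIn-injective j _ _) (suc x))
          (λ k k≢l x → q _ (k≢l ∘ Finₚ.punchIn-injective j _ _) (suc x))
          (λ x → r (suc x))))
        (+-cong (*-congˡ (*-congˡ (*-congʳ (p j (Finₚ.punchInᵢ≢i j l ∘ ≡.sym) zero))))
                (*-congˡ (*-congˡ (*-congʳ (q j (Finₚ.punchInᵢ≢i j l ∘ ≡.sym) zero)))))

  det-expand-single : ∀ n (M : Mat (suc n) (suc n)) j → (∀ k → M zero (punchIn j k) ≈ 0#) →
    det (suc n) M ≈ sgn (toℕ j) * (M zero j * det n (λ r k → M (suc r) (punchIn j k)))
  det-expand-single n M j eq = sum-single
    (λ l → sgn (toℕ l) * (M zero l * det n (λ r k → M (suc r) (punchIn l k)))) j λ k →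
    trans (*-congˡ (trans (*-congʳ (eq k)) (zeroˡ _))) (zeroʳ _)

  det-δ : ∀ n → det n δ ≈ 1#
  det-δ zero    = refl
  det-δ (suc n) = begin
    det (suc n) δ        ≈⟨ det-expand-single n δ zero (λ _ → refl) ⟩
    1# * (1# * det n δ)  ≈⟨ *-identityˡ _ ⟩
    1# * det n δ         ≈⟨ *-identityˡ _ ⟩
    det n δ              ≈⟨ det-δ n ⟩
    1#                   ∎

  det-transpose : ∀ n M → det n (λ i j → M j i) ≈ det n M
  det-transpose n M = begin
    det n (λ i j → M j i)             ≈⟨ det-unique n (det-columns n) M ⟩
    det n M * det n (λ i j → δ j i)   ≈⟨ *-congˡ (det-cong n λ i j → reflexive (δ-sym j i)) ⟩
    det n M * det n δ                 ≈⟨ *-congˡ (det-δ n) ⟩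
    det n M * 1#                      ≈⟨ *-identityʳ _ ⟩
    det n M                           ∎

  det-alternating : ∀ n → IsAlternating (det n)
  det-alternating n = IsAlternating-resp (det-transpose n) (det-columns n)

  det-* : ∀ n (A B : Mat n n) → det n (λ i j → ∑[ l < n ] (A i l * B l j)) ≈ det n A * det n B
  det-* n A B = begin
    det n (A ⊠B)           ≈⟨ det-unique n alt A ⟩
    det n A * det n (δ ⊠B) ≈⟨ *-congˡ (det-cong n δ⊠B) ⟩
    det n A * det n B      ∎
    where
    _⊠B : Mat n n → Mat n n
    (A ⊠B) i j = ∑[ l < n ] (A i l * B l j)
    δ⊠B : ∀ i j → (δ ⊠B) i j ≈ B i j
    δ⊠B i j = trans (sum-cong-≋ λ l → trans (*-comm (δ i l) _) (*-congˡ (reflexive (δ-sym i l))))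
                    (sum-δ (λ l → B l j) i)
    row-cong : ∀ {x y : Row n} → (∀ k → x k ≈ y k) → ∀ j → sum (λ l → x l * B l j) ≈ sum (λ l → y l * B l j)
    row-cong eq j = sum-cong-≋ λ l → *-congʳ (eq l)
    row-linear : ∀ a b (x y : Row n) j → sum (λ l → (a * x l + b * y l) * B l j) ≈
                 a * sum (λ l → x l * B l j) + b * sum (λ l → y l * B l j)
    row-linear a b x y j = begin
      sum (λ l → (a * x l + b * y l) * B l j)
        ≈⟨ sum-cong-≋ {n} (λ l → trans (distribʳ _ _ _) (+-cong (*-assoc a _ _) (*-assoc b _ _))) ⟩
      sum (λ l → a * (x l * B l j) + b * (y l * B l j))
        ≈⟨ ∑-distrib-+ {n} (λ l → a * (x l * B l j)) (λ l → b * (y l * B l j)) ⟩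
      sum (λ l → a * (x l * B l j)) + sum (λ l → b * (y l * B l j))
        ≈⟨ +-cong (*-distribˡ-sum {n} a _) (*-distribˡ-sum {n} b _) ⟨
      a * sum (λ l → x l * B l j) + b * sum (λ l → y l * B l j) ∎
    alt : IsAlternating (λ v → det n (v ⊠B))
    alt = record
      { resp        = λ eq → det-cong n λ i → row-cong (eq i)
      ; linear      = λ i a b p q r → det-alternating n .linear i a b
          (λ j j≢i → row-cong (p j j≢i)) (λ j j≢i → row-cong (q j j≢i))
          (λ k → trans (row-cong r k) (row-linear a b _ _ k))
      ; alternating = λ v i j eq p → det-alternating n .alternating _ i j eq (row-cong p)
      }

  δ-≢ : ∀ {n} {i j : Fin n} → i ≢ j → δ i j ≡ 0#
  δ-≢ {i = zero}  {zero}  i≢j = ⊥-elim (i≢j ≡.refl)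
  δ-≢ {i = zero}  {suc j} i≢j = ≡.refl
  δ-≢ {i = suc i} {zero}  i≢j = ≡.refl
  δ-≢ {i = suc i} {suc j} i≢j = δ-≢ (i≢j ∘ ≡.cong suc)

  opposite-injective : ∀ {n} {i j : Fin n} → opposite i ≡ opposite j → i ≡ j
  opposite-injective {i = i} {j} eq = ≡.trans (≡.sym (Finₚ.opposite-involutive i))
    (≡.trans (≡.cong opposite eq) (Finₚ.opposite-involutive j))

  -- Rows and columns are reversed together, so the two signs cancel. This reconciles the decreasing
  -- order of the stacked unit rows with the increasing order of the parts.
  det-reverse : ∀ n M → det n (λ i j → M (opposite i) (opposite j)) ≈ det n M
  det-reverse n M = begin
    det n (λ i j → M (opposite i) (opposite j))             ≈⟨ det-unique n alt M ⟩
    det n M * det n (λ i j → δ (opposite i) (opposite j))   ≈⟨ *-congˡ (det-cong n λ i j → reflexive (δ-opposite i j)) ⟩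
    det n M * det n δ                                       ≈⟨ *-congˡ (det-δ n) ⟩
    det n M * 1#                                            ≈⟨ *-identityʳ _ ⟩
    det n M                                                 ∎
    where
    δ-opposite : ∀ (i j : Fin n) → δ (opposite i) (opposite j) ≡ δ i j
    δ-opposite i j with i Fin.≟ j
    ... | yes ≡.refl = ≡.trans (δ-refl (opposite i)) (≡.sym (δ-refl i))
    ... | no  i≢j    = ≡.trans (δ-≢ (i≢j ∘ opposite-injective)) (≡.sym (δ-≢ i≢j))
    flip-≢ : ∀ {i j : Fin n} → j ≢ opposite i → opposite j ≢ i
    flip-≢ {i} {j} j≢ eq = j≢ (≡.trans (≡.sym (Finₚ.opposite-involutive j)) (≡.cong opposite eq))
    alt : IsAlternating (λ (v : Mat n n) → det n (λ i j → v (opposite i) (opposite j)))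
    alt = record
      { resp        = λ eq → det-cong n λ i j → eq _ _
      ; linear      = λ {v} {u} {w} i a b p q r → det-alternating n .linear (opposite i) a b
          (λ j j≢ k → p _ (flip-≢ j≢) _) (λ j j≢ k → q _ (flip-≢ j≢) _)
          (λ k → ≡.subst (λ x → v x (opposite k) ≈ a * u x (opposite k) + b * w x (opposite k))
                   (≡.sym (Finₚ.opposite-involutive i)) (r (opposite k)))
      ; alternating = λ v i j eq p → det-alternating n .alternating _ (opposite j) (opposite i)
          (opposite-adjacent i j eq)
          (λ k → ≡.subst₂ (λ x y → v x (opposite k) ≈ v y (opposite k))
                   (≡.sym (Finₚ.opposite-involutive j)) (≡.sym (Finₚ.opposite-involutive i))
                   (sym (p (opposite k))))
      }

  det-scale-rows : ∀ n (a : Row n) M → det n (λ i j → a i * M i j) ≈ ∏ a * det n M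
  det-scale-rows zero    a M = sym (*-identityˡ 1#)
  det-scale-rows (suc n) a M = begin
    sum s                       ≈⟨ sum-cong-≋ {suc n} term ⟩
    sum (λ j → ∏ a * t j)       ≈⟨ *-distribˡ-sum (∏ a) t ⟨
    ∏ a * det (suc n) M ∎
    where
    s t : Row (suc n)
    s j = sgn (toℕ j) * (a zero * M zero j * det n (λ r k → a (suc r) * M (suc r) (punchIn j k)))
    t j = sgn (toℕ j) * (M zero j * det n (λ r k → M (suc r) (punchIn j k)))
    term : ∀ j → s j ≈ ∏ a * t j
    term j = begin
      s j  ≈⟨ *-congˡ (*-congˡ (det-scale-rows n (a ∘ suc) _)) ⟩
      sgn (toℕ j) * (a zero * M zero j * (∏ (a ∘ suc) * _))  ≈⟨ *-congˡ (interchange _ _ _ _) ⟩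
      sgn (toℕ j) * (∏ a * (M zero j * _))                   ≈⟨ x∙yz≈y∙xz _ _ _ ⟩
      ∏ a * t j ∎

  sum-++ : ∀ a {b} (f : Row (a ℕ.+ b)) → sum f ≈ sum (λ i → f (i ↑ˡ b)) + sum (λ i → f (a ↑ʳ i))
  sum-++ zero    f = sym (+-identityˡ _)
  sum-++ (suc a) f = trans (+-congˡ (sum-++ a (f ∘ suc))) (sym (+-assoc _ _ _))

  det-block-lower : ∀ a b (M : Mat (a ℕ.+ b) (a ℕ.+ b)) →
    (∀ i j → M (i ↑ˡ b) (a ↑ʳ j) ≈ 0#) →
    det (a ℕ.+ b) M ≈ det a (λ i j → M (i ↑ˡ b) (j ↑ˡ b)) * det b (λ i j → M (a ↑ʳ i) (a ↑ʳ j))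
  det-block-lower zero    b M eq = sym (*-identityˡ _)
  det-block-lower (suc a) b M eq = begin
    sum t                                                      ≈⟨ sum-++ (suc a) t ⟩
    sum (λ j → t (j ↑ˡ b)) + sum (λ j → t (suc a ↑ʳ j))        ≈⟨ +-congˡ (sum-zero _ right) ⟩
    sum (λ j → t (j ↑ˡ b)) + 0#                                ≈⟨ +-identityʳ _ ⟩
    sum (λ j → t (j ↑ˡ b))                                     ≈⟨ sum-cong-≋ {suc a} left ⟩
    sum (λ j → s j * X)                                        ≈⟨ *-distribʳ-sum X s ⟨
    sum s * X                                                  ∎
    where
    X = det b (λ i j → M (suc a ↑ʳ i) (suc a ↑ʳ j))
    t = λ j → sgn (toℕ j) * (M zero j * det (a ℕ.+ b) (λ r k → M (suc r) (punchIn j k)))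
    s = λ (j : Fin (suc a)) → sgn (toℕ j) * (M zero (j ↑ˡ b) * det a (λ r k → M (suc (r ↑ˡ b)) (punchIn j k ↑ˡ b)))
    right : ∀ j → t (suc a ↑ʳ j) ≈ 0#
    right j = trans (*-congˡ (trans (*-congʳ (eq zero j)) (zeroˡ _))) (zeroʳ _)
    left : ∀ j → t (j ↑ˡ b) ≈ s j * X
    left j = begin
      t (j ↑ˡ b)
        ≈⟨ *-cong (reflexive (≡.cong sgn (Finₚ.toℕ-↑ˡ j b))) (*-congˡ (det-block-lower a b _ λ r k →
             trans (reflexive (≡.cong (M (suc (r ↑ˡ b))) (punchIn-↑ʳ b j k))) (eq (suc r) k))) ⟩
      sgn (toℕ j) * (M zero (j ↑ˡ b) * (_ * _))
        ≈⟨ *-congˡ {sgn (toℕ j)} (*-congˡ {M zero (j ↑ˡ b)} (*-cong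
             (det-cong a λ r k → reflexive (≡.cong (M (suc (r ↑ˡ b))) (punchIn-↑ˡ b j k)))
             (det-cong b λ r k → reflexive (≡.cong (M (suc a ↑ʳ r)) (punchIn-↑ʳ b j k))))) ⟩
      sgn (toℕ j) * (M zero (j ↑ˡ b) * (det a (λ r k → M (suc (r ↑ˡ b)) (punchIn j k ↑ˡ b)) * X))
        ≈⟨ trans (*-congˡ (x∙yz≈xy∙z _ _ _)) (x∙yz≈xy∙z _ _ _) ⟩
      s j * X ∎

  det-block-upper : ∀ a b (M : Mat (a ℕ.+ b) (a ℕ.+ b)) →
    (∀ i j → M (a ↑ʳ i) (j ↑ˡ b) ≈ 0#) →
    det (a ℕ.+ b) M ≈ det a (λ i j → M (i ↑ˡ b) (j ↑ˡ b)) * det b (λ i j → M (a ↑ʳ i) (a ↑ʳ j))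
  det-block-upper a b M eq = begin
    det (a ℕ.+ b) M                  ≈⟨ det-transpose (a ℕ.+ b) M ⟨
    det (a ℕ.+ b) (λ i j → M j i)    ≈⟨ det-block-lower a b _ (λ i j → eq j i) ⟩
    _ * _                            ≈⟨ *-cong (det-transpose a _) (det-transpose b _) ⟩
    det a (λ i j → M (i ↑ˡ b) (j ↑ˡ b)) * det b (λ i j → M (a ↑ʳ i) (a ↑ʳ j)) ∎

  det-lower-triangular : ∀ n (M : Mat n n) → (∀ i j → i Fin.< j → M i j ≈ 0#) →
                         det n M ≈ ∏ (λ i → M i i)
  det-lower-triangular zero    M eq = refl
  det-lower-triangular (suc n) M eq = begin
    det (suc n) M                                        ≈⟨ det-expand-single n M zero (λ k → eq zero (suc k) (ℕ.s≤s ℕ.z≤n)) ⟩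
    1# * (M zero zero * det n (λ r k → M (suc r) (suc k))) ≈⟨ *-identityˡ _ ⟩
    M zero zero * det n (λ r k → M (suc r) (suc k))
      ≈⟨ *-congˡ (det-lower-triangular n _ λ i j i<j → eq (suc i) (suc j) (ℕ.s≤s i<j)) ⟩
    ∏ (λ i → M i i) ∎

  ∏-one : ∀ n (f : Row n) → (∀ i → f i ≈ 1#) → ∏ f ≈ 1#
  ∏-one zero    f eq = refl
  ∏-one (suc n) f eq = trans (*-cong (eq zero) (∏-one n (f ∘ suc) (eq ∘ suc))) (*-identityˡ 1#)

  ∏-neg : ∀ n (f : Row n) → ∏ (λ i → - f i) ≈ sgn n * ∏ f
  ∏-neg zero    f = sym (*-identityˡ 1#)
  ∏-neg (suc n) f = begin
    - f zero * ∏ (λ i → - f (suc i))  ≈⟨ *-congˡ (∏-neg n (f ∘ suc)) ⟩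
    - f zero * (sgn n * ∏ (f ∘ suc))  ≈⟨ x∙yz≈y∙xz _ _ _ ⟩
    sgn n * (- f zero * ∏ (f ∘ suc))  ≈⟨ *-congˡ (-‿distribˡ-* _ _) ⟨
    sgn n * (- ∏ f)                   ≈⟨ -‿distribʳ-* _ _ ⟨
    - (sgn n * ∏ f)                   ≈⟨ -‿distribˡ-* _ _ ⟩
    sgn (suc n) * ∏ f                 ∎

  -- Vandermonde determinants

  differences : ∀ n → Row n → Carrier
  differences zero    x = 1#
  differences (suc n) x = ∏ (λ j → x zero - x (suc j)) * differences n (x ∘ suc)

  private

    -- Multiplying by it on the right subtracts y times the next column from each column, the
    -- elimination behind `vandermonde`.
    bidiagonal : ∀ {n} → Carrier → Mat n n
    bidiagonal y zero          zero    = 1#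
    bidiagonal y zero          (suc j) = 0#
    bidiagonal y (suc zero)    zero    = - y
    bidiagonal y (suc (suc l)) zero    = 0#
    bidiagonal y (suc l)       (suc j) = bidiagonal y l j

    bidiagonal-diag : ∀ {n} y (i : Fin n) → bidiagonal y i i ≡ 1#
    bidiagonal-diag y zero    = ≡.refl
    bidiagonal-diag y (suc zero) = ≡.refl
    bidiagonal-diag y (suc (suc i)) = bidiagonal-diag y (suc i)

    bidiagonal-upper : ∀ {n} y (i j : Fin n) → i Fin.< j → bidiagonal y i j ≡ 0#
    bidiagonal-upper y zero          (suc j) _           = ≡.refl
    bidiagonal-upper y (suc zero)    (suc j) (ℕ.s≤s i<j) = bidiagonal-upper y zero j i<j
    bidiagonal-upper y (suc (suc i)) (suc j) (ℕ.s≤s i<j) = bidiagonal-upper y (suc i) j i<j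

    -- The condition on g n lets the last column, which has no successor, obey the same formula as
    -- the others.
    sum-bidiagonal : ∀ n y (g : ℕ → Carrier) → g n ≈ 0# → ∀ j →
      ∑[ l < n ] (g (toℕ l) * bidiagonal y l j) ≈ g (toℕ j) - y * g (suc (toℕ j))
    sum-bidiagonal (suc zero) y g eq zero = begin
      g 0 * 1# + 0#      ≈⟨ +-cong (*-identityʳ _) (sym (trans (-‿cong (trans (*-congˡ eq) (zeroʳ y))) -0#≈0#)) ⟩
      g 0 - y * g 1      ∎
    sum-bidiagonal (suc (suc n)) y g eq zero = begin
      g 0 * 1# + (g 1 * - y + sum {n} (λ l → g (suc (suc (toℕ l))) * 0#))
        ≈⟨ +-cong (*-identityʳ _) (+-congˡ (sum-zero {n} (λ l → g (suc (suc (toℕ l))) * 0#) λ l → zeroʳ _)) ⟩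
      g 0 + (g 1 * - y + 0#)   ≈⟨ +-congˡ (+-identityʳ _) ⟩
      g 0 + g 1 * - y          ≈⟨ +-congˡ (-‿distribʳ-* _ _) ⟨
      g 0 - g 1 * y            ≈⟨ +-congˡ (-‿cong (*-comm _ _)) ⟩
      g 0 - y * g 1            ∎
    sum-bidiagonal (suc (suc n)) y g eq (suc j) = begin
      g 0 * 0# + sum (λ l → g (suc (toℕ l)) * bidiagonal y (suc l) (suc j))
        ≈⟨ +-cong (zeroʳ _) (sum-cong-≋ {suc n} λ l → *-congˡ {g (suc (toℕ l))} (reflexive (step l))) ⟩
      0# + sum (λ l → g (suc (toℕ l)) * bidiagonal y l j)  ≈⟨ +-identityˡ _ ⟩
      sum (λ l → g (suc (toℕ l)) * bidiagonal y l j)       ≈⟨ sum-bidiagonal (suc n) y (g ∘ suc) eq j ⟩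
      g (suc (toℕ j)) - y * g (suc (suc (toℕ j)))          ∎
      where
      step : ∀ l → bidiagonal y (suc l) (suc j) ≡ bidiagonal y l j
      step zero    = ≡.refl
      step (suc l) = ≡.refl

    -- The powers x ^ (n - e), continued by 0 at e = n + 1, where truncated subtraction would give 1
    -- and break the boundary condition of `sum-bidiagonal`.
    descending : Carrier → ℕ → ℕ → Carrier
    descending x n       zero    = x ^ n
    descending x zero    (suc e) = 0#
    descending x (suc n) (suc e) = descending x n e

    descending-≤ : ∀ x n e → e ℕ.≤ n → descending x n e ≡ x ^ (n ℕ.∸ e)
    descending-≤ x n       zero    _             = ≡.refl
    descending-≤ x (suc n) (suc e) (ℕ.s≤s e≤n) = descending-≤ x n e e≤n

    descending-> : ∀ x n → descending x n (suc n) ≡ 0#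
    descending-> x zero    = ≡.refl
    descending-> x (suc n) = descending-> x n

    descending-step : ∀ x y n e → e ℕ.< n →
      descending x n e - y * descending x n (suc e) ≈ (x - y) * x ^ (n ℕ.∸ suc e)
    descending-step x y (suc n) zero    _ = begin
      x * x ^ n - y * x ^ n           ≈⟨ +-congˡ (-‿distribˡ-* _ _) ⟩
      x * x ^ n + - y * x ^ n         ≈⟨ distribʳ _ _ _ ⟨
      (x - y) * x ^ n                 ∎
    descending-step x y (suc n) (suc e) (ℕ.s≤s e<n) = descending-step x y n e e<n

    descending-last : ∀ x y n → descending x n n - y * descending x n (suc n) ≈ 1#
    descending-last x y zero    = begin
      1# - y * 0#  ≈⟨ +-congˡ (trans (-‿cong (zeroʳ y)) -0#≈0#) ⟩
      1# + 0#      ≈⟨ +-identityʳ 1# ⟩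
      1#           ∎
    descending-last x y (suc n) = descending-last x y n

  -- Elimination with y = x₀ leaves row 0 with a single 1 in its last column and pulls the factor x
  -- i - x₀ out of every other row. The sign of that corner cancels the sign from reversing these n
  -- differences.
  vandermonde : ∀ n (x : Row n) →
    det n (λ i j → x i ^ (n ℕ.∸ suc (toℕ j))) ≈ differences n x
  vandermonde zero    x = refl
  vandermonde (suc n) x = begin
    det (suc n) (λ i j → x i ^ (n ℕ.∸ toℕ j))
      ≈⟨ det-cong (suc n) {N = V} (λ i j → reflexive (≡.sym (descending-≤ (x i) n (toℕ j) (ℕₚ.≤-pred (Finₚ.toℕ<n j))))) ⟩
    det (suc n) V                          ≈⟨ *-identityʳ _ ⟨
    det (suc n) V * 1#                     ≈⟨ *-congˡ det-U ⟨
    det (suc n) V * det (suc n) U          ≈⟨ det-* (suc n) V U ⟨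
    det (suc n) (λ i j → sum (λ l → V i l * U l j))
      ≈⟨ det-cong (suc n) {N = W} (λ i j → sum-bidiagonal (suc n) x₀ (descending (x i) n) (reflexive (descending-> (x i) n)) j) ⟩
    det (suc n) W                          ≈⟨ det-expand-single n W (fromℕ n) first-row ⟩
    sgn (toℕ (fromℕ n)) * (W zero (fromℕ n) * det n (λ r k → W (suc r) (punchIn (fromℕ n) k)))
      ≈⟨ *-cong (reflexive (≡.cong sgn (Finₚ.toℕ-fromℕ n))) (*-cong corner (det-cong n other-rows)) ⟩
    sgn n * (1# * det n (λ r k → (x (suc r) - x₀) * x (suc r) ^ (n ℕ.∸ suc (toℕ k))))
      ≈⟨ *-congˡ (*-identityˡ _) ⟩
    sgn n * det n (λ r k → (x (suc r) - x₀) * x (suc r) ^ (n ℕ.∸ suc (toℕ k)))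
      ≈⟨ *-congˡ (det-scale-rows n (λ r → x (suc r) - x₀) (λ r k → x (suc r) ^ (n ℕ.∸ suc (toℕ k)))) ⟩
    sgn n * (∏ (λ r → x (suc r) - x₀) * det n (λ r k → x (suc r) ^ (n ℕ.∸ suc (toℕ k))))
      ≈⟨ *-congˡ (*-cong flip-sign (vandermonde n (x ∘ suc))) ⟩
    sgn n * (sgn n * ∏ (λ r → x₀ - x (suc r)) * differences n (x ∘ suc))
      ≈⟨ *-congˡ (*-assoc _ _ _) ⟩
    sgn n * (sgn n * differences (suc n) x) ≈⟨ *-assoc _ _ _ ⟨
    sgn n * sgn n * differences (suc n) x   ≈⟨ *-congʳ (sgn²≈1 n) ⟩
    1# * differences (suc n) x              ≈⟨ *-identityˡ _ ⟩
    differences (suc n) x                   ∎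
    where
    x₀ = x zero
    V W U : Mat (suc n) (suc n)
    V i j = descending (x i) n (toℕ j)
    U = bidiagonal x₀
    W i j = descending (x i) n (toℕ j) - x₀ * descending (x i) n (suc (toℕ j))
    det-U : det (suc n) U ≈ 1#
    det-U = trans (det-lower-triangular (suc n) U λ i j i<j → reflexive (bidiagonal-upper x₀ i j i<j))
                  (∏-one (suc n) _ λ i → reflexive (bidiagonal-diag x₀ i))
    W-inject₁ : ∀ i k → W i (punchIn (fromℕ n) k) ≈ (x i - x₀) * x i ^ (n ℕ.∸ suc (toℕ k))
    W-inject₁ i k rewrite punchIn-fromℕ k | Finₚ.toℕ-inject₁ k =
      descending-step (x i) x₀ n (toℕ k) (Finₚ.toℕ<n k)
    first-row : ∀ k → W zero (punchIn (fromℕ n) k) ≈ 0#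
    first-row k = trans (W-inject₁ zero k) (trans (*-congʳ (-‿inverseʳ x₀)) (zeroˡ _))
    corner : W zero (fromℕ n) ≈ 1#
    corner rewrite Finₚ.toℕ-fromℕ n = descending-last x₀ x₀ n
    other-rows = λ r k → W-inject₁ (suc r) k
    flip-sign : ∏ (λ r → x (suc r) - x₀) ≈ sgn n * ∏ (λ r → x₀ - x (suc r))
    flip-sign = trans (∏-cong {n} λ r → sym (⁻¹-anti-homo‿- x₀ (x (suc r))))
                      (∏-neg n (λ r → x₀ - x (suc r)))

-- Determinants under ring homomorphisms

module Homomorphism {c₁ ℓ₁ c₂ ℓ₂} (R : CommutativeRing c₁ ℓ₁) (S : CommutativeRing c₂ ℓ₂)
  (h : CommutativeRing.Carrier R → CommutativeRing.Carrier S)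
  (hom : RingMorphisms.IsRingHomomorphism (CommutativeRing.rawRing R) (CommutativeRing.rawRing S) h)
  where

  private
    module R = CommutativeRing R
    module S = CommutativeRing S
    module DR = Determinant R
    module DS = Determinant S
  open RingMorphisms.IsRingHomomorphism hom
  open import Algebra.Properties.Semiring.Sum R.semiring using () renaming (sum to sumR)
  open import Algebra.Properties.Semiring.Sum S.semiring using () renaming (sum to sumS; sum-cong-≋ to sumS-cong)

  sum-homo : ∀ n (f : Fin n → R.Carrier) → h (sumR f) S.≈ sumS (h ∘ f)
  sum-homo zero    f = 0#-homo
  sum-homo (suc n) f = S.trans (+-homo _ _) (S.+-congˡ (sum-homo n (f ∘ suc)))

  sgn-homo : ∀ n → h (DR.sgn n) S.≈ DS.sgn n
  sgn-homo zero    = 1#-homo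
  sgn-homo (suc n) = S.trans (-‿homo _) (S.-‿cong (sgn-homo n))

  det-homo : ∀ n M → h (DR.det n M) S.≈ DS.det n (λ i j → h (M i j))
  det-homo zero    M = 1#-homo
  det-homo (suc n) M = S.trans (sum-homo (suc n) t) (sumS-cong {suc n} λ j →
    S.trans (*-homo (DR.sgn (toℕ j)) _) (S.*-cong (sgn-homo (toℕ j))
      (S.trans (*-homo (M zero j) _) (S.*-congˡ (det-homo n (minor j))))))
    where
    minor : Fin (suc n) → Fin n → Fin n → R.Carrier
    minor j r k = M (suc r) (punchIn j k)
    t : Fin (suc n) → R.Carrier
    t j = DR.sgn (toℕ j) R.* (M zero j R.* DR.det n (minor j))

-- Power series

open import Defs

-- Used over ℤ for univariate series, and over series in m variables because a series in m + 1
-- variables is a univariate series with such coefficients.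
module Convolution {c ℓ} (R : CommutativeRing c ℓ) where

  open CommutativeRing R hiding (zero)
  open import Algebra.Properties.CommutativeSemigroup +-commutativeSemigroup
    using (x∙yz≈y∙xz; interchange)
  open import Relation.Binary.Reasoning.Setoid setoid

  Series : Set c
  Series = ℕ → Carrier

  conv : Series → Series → Series
  conv f g zero    = f 0 * g 0
  conv f g (suc n) = f 0 * g (suc n) + conv (f ∘ suc) g n

  constant : Carrier → Series
  constant a zero    = a
  constant a (suc n) = 0#

  conv-cong : ∀ {f f′ g g′} → (∀ n → f n ≈ f′ n) → (∀ n → g n ≈ g′ n) → ∀ n → conv f g n ≈ conv f′ g′ n
  conv-cong p q zero    = *-cong (p 0) (q 0)
  conv-cong p q (suc n) = +-cong (*-cong (p 0) (q (suc n))) (conv-cong (p ∘ suc) q n)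

  conv-distribʳ : ∀ f g h n → conv (λ i → f i + g i) h n ≈ conv f h n + conv g h n
  conv-distribʳ f g h zero    = distribʳ _ _ _
  conv-distribʳ f g h (suc n) = trans (+-cong (distribʳ _ _ _) (conv-distribʳ _ _ h n)) (interchange _ _ _ _)

  conv-scaleˡ : ∀ a f g n → conv (λ i → a * f i) g n ≈ a * conv f g n
  conv-scaleˡ a f g zero    = *-assoc _ _ _
  conv-scaleˡ a f g (suc n) = trans (+-cong (*-assoc _ _ _) (conv-scaleˡ a _ g n)) (sym (distribˡ _ _ _))

  conv-zeroˡ : ∀ g n → conv (λ _ → 0#) g n ≈ 0#
  conv-zeroˡ g zero    = zeroˡ _
  conv-zeroˡ g (suc n) = trans (+-cong (zeroˡ _) (conv-zeroˡ g n)) (+-identityˡ 0#)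

  conv-constantˡ : ∀ a g n → conv (constant a) g n ≈ a * g n
  conv-constantˡ a g zero    = refl
  conv-constantˡ a g (suc n) = trans (+-congˡ (conv-zeroˡ g n)) (+-identityʳ _)

  -- The product splits off its last term here and its first term by definition; `conv-comm` plays
  -- the two against each other.
  conv-snoc : ∀ f g n → conv f g (suc n) ≈ f (suc n) * g 0 + conv f (g ∘ suc) n
  conv-snoc f g zero    = +-comm _ _
  conv-snoc f g (suc n) = trans (+-congˡ (conv-snoc (f ∘ suc) g n)) (x∙yz≈y∙xz _ _ _)

  conv-comm : ∀ f g n → conv f g n ≈ conv g f n
  conv-comm f g zero    = *-comm _ _
  conv-comm f g (suc n) = trans (+-cong (*-comm _ _) (conv-comm (f ∘ suc) g n)) (sym (conv-snoc g f n))

  conv-assoc : ∀ f g h n → conv (conv f g) h n ≈ conv f (conv g h) n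
  conv-assoc f g h zero    = *-assoc _ _ _
  conv-assoc f g h (suc n) = begin
    f 0 * g 0 * h (suc n) + conv (λ i → f 0 * g (suc i) + conv (f ∘ suc) g i) h n
      ≈⟨ +-cong (*-assoc _ _ _) (conv-distribʳ _ _ h n) ⟩
    f 0 * (g 0 * h (suc n)) + (conv (λ i → f 0 * g (suc i)) h n + conv (conv (f ∘ suc) g) h n)
      ≈⟨ +-congˡ (+-cong (conv-scaleˡ (f 0) (g ∘ suc) h n) (conv-assoc (f ∘ suc) g h n)) ⟩
    f 0 * (g 0 * h (suc n)) + (f 0 * conv (g ∘ suc) h n + conv (f ∘ suc) (conv g h) n)
      ≈⟨ +-assoc _ _ _ ⟨
    f 0 * (g 0 * h (suc n)) + f 0 * conv (g ∘ suc) h n + conv (f ∘ suc) (conv g h) n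
      ≈⟨ +-congʳ (distribˡ _ _ _) ⟨
    conv f (conv g h) (suc n) ∎

infix 4 _≐_
_≐_ : ∀ {m} → PS m → PS m → Set
f ≐ g = ∀ u → f u ≡ g u

zeroPS : ∀ {m} → PS m
zeroPS u = + 0

negPS : ∀ {m} → PS m → PS m
negPS f u = ℤ.- f u

IsPSRing : ℕ → Set
IsPSRing m = IsCommutativeRing (_≐_ {m}) _⊕_ _⊗_ negPS zeroPS one

sumℤ-++ : ∀ xs ys → sumℤ (xs ++ ys) ≡ sumℤ xs ℤ.+ sumℤ ys
sumℤ-++ []       ys = ≡.sym (ℤₚ.+-identityˡ _)
sumℤ-++ (x ∷ xs) ys = ≡.trans (cong (ℤ._+_ x) (sumℤ-++ xs ys)) (≡.sym (ℤₚ.+-assoc x (sumℤ xs) (sumℤ ys)))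

mkPSRing : ∀ {m} → (∀ {f f′ g g′ : PS m} → f ≐ f′ → g ≐ g′ → f ⊗ g ≐ f′ ⊗ g′) →
           (∀ (f g h : PS m) → (f ⊗ g) ⊗ h ≐ f ⊗ (g ⊗ h)) →
           (∀ (f g : PS m) → f ⊗ g ≐ g ⊗ f) →
           (∀ (f : PS m) → one ⊗ f ≐ f) →
           (∀ (f g h : PS m) → (f ⊕ g) ⊗ h ≐ (f ⊗ h) ⊕ (g ⊗ h)) →
           IsPSRing m
mkPSRing ⊗-cong ⊗-assoc ⊗-comm ⊗-identityˡ ⊗-distribʳ = record
  { isRing = record
    { +-isAbelianGroup = record
      { isGroup = record
        { isMonoid = record
          { isSemigroup = record
            { isMagma = record
              { isEquivalence = record
                { refl  = λ u → ≡.refl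
                ; sym   = λ p u → ≡.sym (p u)
                ; trans = λ p q u → ≡.trans (p u) (q u)
                }
              ; ∙-cong = λ p q u → cong₂ ℤ._+_ (p u) (q u)
              }
            ; assoc = λ f g h u → ℤₚ.+-assoc (f u) (g u) (h u)
            }
          ; identity = (λ f u → ℤₚ.+-identityˡ (f u)) , (λ f u → ℤₚ.+-identityʳ (f u))
          }
        ; inverse = (λ f u → ℤₚ.+-inverseˡ (f u)) , (λ f u → ℤₚ.+-inverseʳ (f u))
        ; ⁻¹-cong = λ p u → cong ℤ.-_ (p u)
        }
      ; comm = λ f g u → ℤₚ.+-comm (f u) (g u)
      }
    ; *-cong     = ⊗-cong
    ; *-assoc    = ⊗-assoc
    ; *-identity = ⊗-identityˡ , (λ f u → ≡.trans (⊗-comm f one u) (⊗-identityˡ f u))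
    ; distrib    = (λ f g h u → ≡.trans (⊗-comm f (g ⊕ h) u) (≡.trans (⊗-distribʳ g h f u)
                     (cong₂ ℤ._+_ (⊗-comm g f u) (⊗-comm h f u))))
                 , (λ f g h u → ⊗-distribʳ g h f u)
    }
  ; *-comm = ⊗-comm
  }

⊗-[] : ∀ (f g : PS 0) → (f ⊗ g) [] ≡ f [] ℤ.* g []
⊗-[] f g = ℤₚ.+-identityʳ _

psRing₀ : IsPSRing 0
psRing₀ = mkPSRing
  (λ { {f} {f′} {g} {g′} p q [] → on f g f′ g′ (cong₂ ℤ._*_ (p []) (q [])) })
  (λ { f g h [] → ≡.trans (⊗-[] (f ⊗ g) h) (≡.trans (cong (ℤ._* h []) (⊗-[] f g))
         (≡.trans (ℤₚ.*-assoc (f []) (g []) (h [])) (≡.sym (≡.trans (⊗-[] f (g ⊗ h)) (cong (f [] ℤ.*_) (⊗-[] g h)))))) })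
  (λ { f g [] → on f g g f (ℤₚ.*-comm (f []) (g [])) })
  (λ { f [] → ≡.trans (⊗-[] one f) (ℤₚ.*-identityˡ (f [])) })
  (λ { f g h [] → ≡.trans (⊗-[] (f ⊕ g) h) (≡.trans (ℤₚ.*-distribʳ-+ (h []) (f []) (g []))
         (≡.sym (cong₂ ℤ._+_ (⊗-[] f h) (⊗-[] g h)))) })
  where
  on : ∀ f g f′ g′ → f [] ℤ.* g [] ≡ f′ [] ℤ.* g′ [] → (f ⊗ g) [] ≡ (f′ ⊗ g′) []
  on f g f′ g′ eq = ≡.trans (⊗-[] f g) (≡.trans eq (≡.sym (⊗-[] f′ g′)))

curryPS : ∀ {m} → PS (suc m) → ℕ → PS m
curryPS f n u = f (n ∷ u)

module _ {m} (isRing : IsPSRing m) where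

  private
    R : CommutativeRing 0ℓ 0ℓ
    R = record { isCommutativeRing = isRing }

  open Convolution R

  -- Sorting the exponent vectors of `below` by their first entry. Through this identity the ring
  -- laws pass from m to m + 1 variables.
  ⊗-curry : ∀ (f g : PS (suc m)) n u → (f ⊗ g) (n ∷ u) ≡ conv (curryPS f) (curryPS g) n u
  ⊗-curry f g n u = go (curryPS f) n id (λ v → f v ℤ.* g (zipWith ℕ._∸_ (n ∷ u) v)) (λ a v → ≡.refl)
    where
    slice = λ (a : ℕ) → map (a ∷_) (below u)
    head-term : ∀ (f′ : ℕ → PS m) n (e : ℕ → ℕ) F →
                (∀ a v → F (e a ∷ v) ≡ f′ a v ℤ.* g ((n ℕ.∸ a) ∷ zipWith ℕ._∸_ u v)) →
                sumℤ (map F (slice (e 0))) ≡ (f′ 0 ⊗ curryPS g n) u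
    head-term f′ n e F hyp = cong sumℤ (≡.trans (≡.sym (Listₚ.map-∘ (below u)))
      (Listₚ.map-cong (hyp 0) (below u)))
    -- The enumeration e and the series f′ are generalised so that the tail of `applyUpTo` and the
    -- tail in `conv` advance together, while g keeps its original indexing.
    go : ∀ (f′ : ℕ → PS m) n (e : ℕ → ℕ) F →
         (∀ a v → F (e a ∷ v) ≡ f′ a v ℤ.* g ((n ℕ.∸ a) ∷ zipWith ℕ._∸_ u v)) →
         sumℤ (map F (concatMap slice (applyUpTo e (suc n)))) ≡ conv f′ (curryPS g) n u
    go f′ zero e F hyp = ≡.trans (cong (sumℤ ∘ map F) (Listₚ.++-identityʳ (slice (e 0))))
      (head-term f′ 0 e F hyp)
    go f′ (suc n) e F hyp = begin
      sumℤ (map F (slice (e 0) ++ rest))              ≡⟨ cong sumℤ (Listₚ.map-++ F (slice (e 0)) rest) ⟩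
      sumℤ (map F (slice (e 0)) ++ map F rest)        ≡⟨ sumℤ-++ (map F (slice (e 0))) _ ⟩
      sumℤ (map F (slice (e 0))) ℤ.+ sumℤ (map F rest)
        ≡⟨ cong₂ ℤ._+_ (head-term f′ (suc n) e F hyp) (go (f′ ∘ suc) n (e ∘ suc) F (hyp ∘ suc)) ⟩
      conv f′ (curryPS g) (suc n) u                   ∎
      where
      open ≡.≡-Reasoning
      rest = concatMap slice (applyUpTo (e ∘ suc) (suc n))

  one-curry : ∀ n → curryPS (one {suc m}) n ≐ constant one n
  one-curry zero    u = ≡.refl
  one-curry (suc n) u = ≡.refl

  psRing-suc : IsPSRing (suc m)
  psRing-suc = mkPSRing
    (λ { {f} {f′} {g} {g′} p q (n ∷ u) → via f g f′ g′ n u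
           (conv-cong {curryPS f} {curryPS f′} {curryPS g} {curryPS g′}
             (λ i v → p (i ∷ v)) (λ i v → q (i ∷ v)) n u) })
    (λ { f g h (n ∷ u) → ≡.trans (⊗-curry (f ⊗ g) h n u)
           (≡.trans (conv-cong {g = curryPS h} (⊗-curry f g) (λ _ _ → ≡.refl) n u)
           (≡.trans (conv-assoc (curryPS f) (curryPS g) (curryPS h) n u)
           (≡.sym (≡.trans (⊗-curry f (g ⊗ h) n u)
             (conv-cong {f = curryPS f} (λ _ _ → ≡.refl) (⊗-curry g h) n u))))) })
    (λ { f g (n ∷ u) → via f g g f n u (conv-comm (curryPS f) (curryPS g) n u) })
    (λ { f (n ∷ u) → ≡.trans (⊗-curry one f n u) (≡.trans
           (conv-cong {g = curryPS f} one-curry (λ _ _ → ≡.refl) n u)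
           (≡.trans (conv-constantˡ one (curryPS f) n u)
             (IsCommutativeRing.*-identityˡ isRing (curryPS f n) u))) })
    (λ { f g h (n ∷ u) → ≡.trans (⊗-curry (f ⊕ g) h n u)
           (≡.trans (conv-distribʳ (curryPS f) (curryPS g) (curryPS h) n u)
           (≡.sym (cong₂ ℤ._+_ (⊗-curry f h n u) (⊗-curry g h n u)))) })
    where
    via : ∀ f g f′ g′ n u → conv (curryPS f) (curryPS g) n u ≡ conv (curryPS f′) (curryPS g′) n u →
          (f ⊗ g) (n ∷ u) ≡ (f′ ⊗ g′) (n ∷ u)
    via f g f′ g′ n u eq = ≡.trans (⊗-curry f g n u) (≡.trans eq (≡.sym (⊗-curry f′ g′ n u)))

isPSRing : ∀ m → IsPSRing m
isPSRing zero    = psRing₀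
isPSRing (suc m) = psRing-suc (isPSRing m)

psRing : ℕ → CommutativeRing 0ℓ 0ℓ
psRing m = record { isCommutativeRing = isPSRing m }

ℤ-ring : CommutativeRing 0ℓ 0ℓ
ℤ-ring = ℤₚ.+-*-commutativeRing

module ℤ-Series = Convolution ℤ-ring
module PS-Series (m : ℕ) = Convolution (psRing m)

open ℤ-Series using (Series)

PSHomomorphism : ∀ R m → (CommutativeRing.Carrier R → PS m) → Set
PSHomomorphism R m = RingMorphisms.IsRingHomomorphism (CommutativeRing.rawRing R) (CommutativeRing.rawRing (psRing m))

module _ (m : ℕ) where
  open CommutativeRing (psRing m) public using () renaming
    ( *-congˡ to ⊗-congˡ; *-congʳ to ⊗-congʳ; *-cong to ⊗-cong; *-assoc to ⊗-assoc
    ; *-identityˡ to ⊗-identityˡ; *-identityʳ to ⊗-identityʳ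
    ; zeroʳ to ⊗-zeroʳ)

scal-⊗ : ∀ {m} c (f g : PS m) → scal c f ⊗ g ≐ scal c (f ⊗ g)
scal-⊗ c f g u = go (below u)
  where
  open ≡.≡-Reasoning
  go : ∀ vs → sumℤ (map (λ v → c ℤ.* f v ℤ.* g (zipWith ℕ._∸_ u v)) vs) ≡
              c ℤ.* sumℤ (map (λ v → f v ℤ.* g (zipWith ℕ._∸_ u v)) vs)
  go []       = ≡.sym (ℤₚ.*-zeroʳ c)
  go (v ∷ vs) = begin
    c ℤ.* f v ℤ.* g _ ℤ.+ _            ≡⟨ cong₂ ℤ._+_ (ℤₚ.*-assoc c (f v) _) (go vs) ⟩
    c ℤ.* (f v ℤ.* g _) ℤ.+ c ℤ.* _    ≡⟨ ℤₚ.*-distribˡ-+ c (f v ℤ.* g _) _ ⟨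
    c ℤ.* (f v ℤ.* g _ ℤ.+ _)          ∎

cst-⊗ : ∀ {m} c (f : PS m) → cst c ⊗ f ≐ scal c f
cst-⊗ {m} c f u = ≡.trans (scal-⊗ c one f u) (cong (c ℤ.*_) (⊗-identityˡ m f u))

-- Univariate series inside the multivariate ring

lift : ∀ {m} → PS m → PS (suc m)
lift f (zero  ∷ u) = f u
lift f (suc _ ∷ u) = + 0

-- f(xᵢ) for a univariate series f.
embed : ∀ {m} → Fin m → Series → PS m
embed zero    f (a ∷ u) = f a ℤ.* one u
embed (suc i) f         = lift (embed i f)

lift-curry : ∀ {m} (f : PS m) n → curryPS (lift f) n ≐ PS-Series.constant m f n
lift-curry f zero    u = ≡.refl
lift-curry f (suc n) u = ≡.refl

lift-⊗ : ∀ {m} (f g : PS m) → lift (f ⊗ g) ≐ lift f ⊗ lift g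
lift-⊗ {m} f g (n ∷ u) = ≡.sym (begin
  (lift f ⊗ lift g) (n ∷ u)                      ≡⟨ ⊗-curry (isPSRing m) (lift f) (lift g) n u ⟩
  conv (curryPS (lift f)) (curryPS (lift g)) n u ≡⟨ conv-cong (lift-curry f) (λ _ _ → ≡.refl) n u ⟩
  conv (constant f) (curryPS (lift g)) n u       ≡⟨ conv-constantˡ f (curryPS (lift g)) n u ⟩
  (f ⊗ curryPS (lift g) n) u                     ≡⟨ ⊗-congˡ m {f} (lift-curry g n) u ⟩
  (f ⊗ constant g n) u                           ≡⟨ finish n ⟩
  lift (f ⊗ g) (n ∷ u)                           ∎)
  where
  open ≡.≡-Reasoning
  open PS-Series m
  finish : ∀ n → (f ⊗ constant g n) u ≡ lift (f ⊗ g) (n ∷ u)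
  finish zero    = ≡.refl
  finish (suc n) = ⊗-zeroʳ m f u

lift-cong : ∀ {m} {f g : PS m} → f ≐ g → lift f ≐ lift g
lift-cong p (zero  ∷ u) = p u
lift-cong p (suc _ ∷ u) = ≡.refl

lift-homomorphism : ∀ m → PSHomomorphism (psRing m) (suc m) lift
lift-homomorphism m = record
  { isSemiringHomomorphism = record
    { isNearSemiringHomomorphism = record
      { +-isMonoidHomomorphism = record
        { isMagmaHomomorphism = record
          { isRelHomomorphism = record { cong = lift-cong }
          ; homo = λ { f g (zero ∷ u) → ≡.refl ; f g (suc n ∷ u) → ≡.refl }
          }
        ; ε-homo = λ { (zero ∷ u) → ≡.refl ; (suc n ∷ u) → ≡.refl }
        }
      ; *-homo = lift-⊗
      }
    ; 1#-homo = λ { (zero ∷ u) → ≡.refl ; (suc n ∷ u) → ≡.refl }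
    }
  ; -‿homo = λ { f (zero ∷ u) → ≡.refl ; f (suc n ∷ u) → ≡.refl }
  }

embed-cong : ∀ {m} (i : Fin m) {f g} → (∀ n → f n ≡ g n) → embed i f ≐ embed i g
embed-cong zero    p (a ∷ u) = cong (ℤ._* one u) (p a)
embed-cong (suc i) p         = lift-cong (embed-cong i p)

embed-⊗ : ∀ {m} (i : Fin m) f g → embed i (ℤ-Series.conv f g) ≐ embed i f ⊗ embed i g
embed-⊗ {suc m} zero f g (n ∷ u) = ≡.sym (≡.trans (⊗-curry (isPSRing m) (embed zero f) (embed zero g) n u) (go f n u))
  where
  open PS-Series m
  open ≡.≡-Reasoning
  cst-* : ∀ a b → cst a ⊗ cst {m} b ≐ cst (a ℤ.* b)
  cst-* a b u = ≡.trans (cst-⊗ a (cst b) u) (≡.sym (ℤₚ.*-assoc a b (one u)))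
  go : ∀ f n u → conv (cst ∘ f) (cst ∘ g) n u ≡ cst (ℤ-Series.conv f g n) u
  go f zero    u = cst-* (f 0) (g 0) u
  go f (suc n) u = ≡.trans (cong₂ ℤ._+_ (cst-* (f 0) (g (suc n)) u) (go (f ∘ suc) n u))
    (≡.sym (ℤₚ.*-distribʳ-+ (one u) (f 0 ℤ.* g (suc n)) _))
embed-⊗ (suc i) f g u = ≡.trans (lift-cong (embed-⊗ i f g) u) (lift-⊗ (embed i f) (embed i g) u)

embed-+ : ∀ {m} (i : Fin m) f g → embed i (λ n → f n ℤ.+ g n) ≐ embed i f ⊕ embed i g
embed-+ zero    f g (a ∷ u) = ℤₚ.*-distribʳ-+ (one u) (f a) (g a)
embed-+ (suc i) f g (zero  ∷ u) = embed-+ i f g u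
embed-+ (suc i) f g (suc a ∷ u) = ≡.refl

embed-scal : ∀ {m} (i : Fin m) c f → embed i (λ n → c ℤ.* f n) ≐ scal c (embed i f)
embed-scal zero    c f (a ∷ u) = ℤₚ.*-assoc c (f a) (one u)
embed-scal (suc i) c f (zero  ∷ u) = embed-scal i c f u
embed-scal (suc i) c f (suc a ∷ u) = ≡.sym (ℤₚ.*-zeroʳ c)

embed-one : ∀ {m} (i : Fin m) → embed i (ℤ-Series.constant (+ 1)) ≐ one
embed-one zero    (zero  ∷ u) = ℤₚ.*-identityˡ (one u)
embed-one zero    (suc a ∷ u) = ≡.refl
embed-one (suc i) (zero  ∷ u) = embed-one i u
embed-one (suc i) (suc a ∷ u) = ≡.refl

X : Series
X zero          = + 0
X (suc zero)    = + 1
X (suc (suc n)) = + 0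

embed-X : ∀ {m} (i : Fin m) → embed i X ≐ var i
embed-X zero    (zero        ∷ u) = ≡.refl
embed-X zero    (suc zero    ∷ u) = ℤₚ.*-identityˡ (one u)
embed-X zero    (suc (suc a) ∷ u) = ≡.refl
embed-X (suc i) (zero  ∷ u) = embed-X i u
embed-X (suc i) (suc a ∷ u) = ≡.refl

geometric : Series
geometric n = + 1

embed-geometric : ∀ {m} (i : Fin m) → embed i geometric ≐ invOneMinus i
embed-geometric (suc i) (zero  ∷ u) = embed-geometric i u
embed-geometric (suc i) (suc a ∷ u) = ≡.refl
embed-geometric zero    (a ∷ u) = ≡.trans (ℤₚ.*-identityˡ (one u))
  (cong (λ b → if b then + 1 else + 0) (≡.trans (flip u) (cong (_∧ does (Vecₚ.≡-dec ℕ._≟_ u (replicate _ 0))) (≡.sym (self a)))))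
  where
  self : ∀ a → does (a ℕ.≟ a) ≡ true
  self zero    = ≡.refl
  self (suc a) = self a
  -- `monomial` and `invOneMinus` hand their two vectors to the decision procedure in opposite
  -- orders.
  flip : ∀ {m} (u : Vec ℕ m) →
         does (Vecₚ.≡-dec ℕ._≟_ (replicate m 0) u) ≡ does (Vecₚ.≡-dec ℕ._≟_ u (replicate m 0))
  flip []          = ≡.refl
  flip (zero  ∷ u) = flip u
  flip (suc a ∷ u) = ≡.refl

-- The factors share no variable, so only one splitting of the exponent vector contributes to the
-- Cauchy product.
embed-⊗-lift : ∀ {m} f (g : PS m) n u → (embed zero f ⊗ lift g) (n ∷ u) ≡ f n ℤ.* g u
embed-⊗-lift {m} f g n u = begin
  (embed zero f ⊗ lift g) (n ∷ u)                ≡⟨ ⊗-curry (isPSRing m) (embed zero f) (lift g) n u ⟩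
  conv (cst ∘ f) (curryPS (lift g)) n u          ≡⟨ conv-comm (cst ∘ f) (curryPS (lift g)) n u ⟩
  conv (curryPS (lift g)) (cst ∘ f) n u          ≡⟨ conv-cong (lift-curry g) (λ _ _ → ≡.refl) n u ⟩
  conv (constant g) (cst ∘ f) n u                ≡⟨ conv-constantˡ g (cst ∘ f) n u ⟩
  (g ⊗ cst (f n)) u                              ≡⟨ CommutativeRing.*-comm (psRing m) g (cst (f n)) u ⟩
  (cst (f n) ⊗ g) u                              ≡⟨ cst-⊗ (f n) g u ⟩
  f n ℤ.* g u                                    ∎
  where
  open ≡.≡-Reasoning
  open PS-Series m

-- Coefficients of determinants whose rows have separate variables

module D-ℤ = Determinant ℤ-ring

module ℤ-Sum where
  open import Algebra.Properties.Semiring.Sum (CommutativeRing.semiring ℤ-ring) public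
    using (sum; sum-cong-≗; ∑-distrib-+)
  open import Algebra.Properties.CommutativeMonoid.Sum (CommutativeRing.*-commutativeMonoid ℤ-ring) public
    using () renaming (sum to ∏; sum-cong-≗ to ∏-cong)

open ℤ-Sum using (sum)

sign≡sgn : ∀ n → sign n ≡ D-ℤ.sgn n
sign≡sgn zero          = ≡.refl
sign≡sgn (suc zero)    = ≡.refl
sign≡sgn (suc (suc n)) = ≡.trans (sign≡sgn n) (≡.sym (ℤₚ.neg-involutive (D-ℤ.sgn n)))

sumℤ-tabulate : ∀ n (f : Fin n → ℤ) → sumℤ (tabulate f) ≡ sum f
sumℤ-tabulate zero    f = ≡.refl
sumℤ-tabulate (suc n) f = cong (ℤ._+_ (f zero)) (sumℤ-tabulate n (f ∘ suc))

det≡ : ∀ n M → det n M ≡ D-ℤ.det n M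
det≡ zero    M = ≡.refl
det≡ (suc n) M = begin
  sumℤ (map t (tabulate id))  ≡⟨ cong sumℤ (Listₚ.map-tabulate id t) ⟩
  sumℤ (tabulate t)           ≡⟨ cong sumℤ (Listₚ.tabulate-cong t≡t′) ⟩
  sumℤ (tabulate t′)          ≡⟨ sumℤ-tabulate (suc n) t′ ⟩
  sum t′                      ∎
  where
  open ≡.≡-Reasoning
  t t′ : Fin (suc n) → ℤ
  t  j = sign (toℕ j) ℤ.* (M zero j ℤ.* det n (λ r c → M (suc r) (punchIn j c)))
  t′ j = D-ℤ.sgn (toℕ j) ℤ.* (M zero j ℤ.* D-ℤ.det n (λ r c → M (suc r) (punchIn j c)))
  t≡t′ : ∀ j → t j ≡ t′ j
  t≡t′ j = cong₂ (λ s d → s ℤ.* (M zero j ℤ.* d)) (sign≡sgn (toℕ j)) (det≡ n (λ r c → M (suc r) (punchIn j c)))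

module D-PS (m : ℕ) = Determinant (psRing m)

module PS-Sum (m : ℕ) where
  open import Algebra.Properties.Semiring.Sum (CommutativeRing.semiring (psRing m)) public using (sum; sum-cong-≋)
  open import Algebra.Properties.CommutativeMonoid.Sum (CommutativeRing.*-commutativeMonoid (psRing m))
    public using () renaming (sum to ∏; sum-cong-≋ to ∏-cong)
  open import Algebra.Properties.Semiring.Exp (CommutativeRing.semiring (psRing m)) public using (_^_)

sum-coefficient : ∀ {m} n (F : Fin n → PS m) u → PS-Sum.sum m F u ≡ sum (λ j → F j u)
sum-coefficient zero    F u = ≡.refl
sum-coefficient (suc n) F u = cong (ℤ._+_ (F zero u)) (sum-coefficient n (F ∘ suc) u)

sgn-coefficient : ∀ {m} n (f : PS m) u → (D-PS.sgn m n ⊗ f) u ≡ D-ℤ.sgn n ℤ.* f u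
sgn-coefficient {m} zero    f u = ≡.trans (⊗-identityˡ m f u) (≡.sym (ℤₚ.*-identityˡ (f u)))
sgn-coefficient {m} (suc n) f u = begin
  (negPS s ⊗ f) u              ≡⟨ -‿distribˡ-* s f u ⟨
  ℤ.- (s ⊗ f) u                ≡⟨ cong ℤ.-_ (sgn-coefficient n f u) ⟩
  ℤ.- (D-ℤ.sgn n ℤ.* f u)      ≡⟨ ℤₚ.neg-distribˡ-* (D-ℤ.sgn n) (f u) ⟩
  D-ℤ.sgn (suc n) ℤ.* f u      ∎
  where
  open ≡.≡-Reasoning
  open import Algebra.Properties.Ring (CommutativeRing.ring (psRing m)) using (-‿distribˡ-*)
  s = D-PS.sgn m n

-- The minors along row 0 are free of the first variable, hence lifted from the remaining ones. The
-- entry of row 0 alone absorbs the first exponent, and the minors are treated by induction.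
det-coefficient : ∀ m (f : Fin m → Fin m → Series) u →
  D-PS.det m m (λ i j → embed i (f i j)) u ≡ D-ℤ.det m (λ i j → f i j (lookup u i))
det-coefficient zero    f []      = ≡.refl
det-coefficient (suc m) f (a ∷ u) = ≡.trans (sum-coefficient (suc m) t (a ∷ u))
  (ℤ-Sum.sum-cong-≗ term)
  where
  open ≡.≡-Reasoning
  minor : Fin (suc m) → Fin m → Fin m → Series
  minor j r k = f (suc r) (punchIn j k)
  t = λ j → D-PS.sgn (suc m) (toℕ j) ⊗ (embed zero (f zero j) ⊗
        D-PS.det (suc m) m (λ r k → lift (embed r (minor j r k))))
  term : ∀ j → t j (a ∷ u) ≡ D-ℤ.sgn (toℕ j) ℤ.* (f zero j a ℤ.* D-ℤ.det m (λ r k → minor j r k (lookup u r)))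
  term j = begin
    t j (a ∷ u)
      ≡⟨ sgn-coefficient (toℕ j) (embed zero (f zero j) ⊗ D-PS.det (suc m) m (λ r k → lift (embed r (minor j r k)))) (a ∷ u) ⟩
    D-ℤ.sgn (toℕ j) ℤ.* (embed zero (f zero j) ⊗ D-PS.det (suc m) m (λ r k → lift (embed r (minor j r k)))) (a ∷ u)
      ≡⟨ cong (D-ℤ.sgn (toℕ j) ℤ.*_) (⊗-congˡ (suc m) {embed zero (f zero j)}
           (λ v → ≡.sym (det-homo m (λ r k → embed r (minor j r k)) v)) (a ∷ u)) ⟩
    D-ℤ.sgn (toℕ j) ℤ.* (embed zero (f zero j) ⊗ lift (D-PS.det m m (λ r k → embed r (minor j r k)))) (a ∷ u)
      ≡⟨ cong (D-ℤ.sgn (toℕ j) ℤ.*_) (embed-⊗-lift (f zero j) (D-PS.det m m (λ r k → embed r (minor j r k))) a u) ⟩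
    D-ℤ.sgn (toℕ j) ℤ.* (f zero j a ℤ.* D-PS.det m m (λ r k → embed r (minor j r k)) u)
      ≡⟨ cong (λ d → D-ℤ.sgn (toℕ j) ℤ.* (f zero j a ℤ.* d)) (det-coefficient m (minor j) u) ⟩
    D-ℤ.sgn (toℕ j) ℤ.* (f zero j a ℤ.* D-ℤ.det m (λ r k → minor j r k (lookup u r))) ∎
    where open Homomorphism (psRing m) (psRing (suc m)) lift (lift-homomorphism m)

prodL-tabulate : ∀ {m} n (F : Fin n → PS m) → prodL (tabulate F) ≐ PS-Sum.∏ m F
prodL-tabulate     zero    F u = ≡.refl
prodL-tabulate {m} (suc n) F   = ⊗-congˡ m {F zero} (prodL-tabulate n (F ∘ suc))

prodFin≐∏ : ∀ {m} (F : Fin m → PS m) → prodFin F ≐ PS-Sum.∏ m F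
prodFin≐∏ {m} F u = ≡.trans (cong (λ xs → prodL xs u) (Listₚ.map-tabulate id F)) (prodL-tabulate m F u)

module _ {m : ℕ} where

  open CommutativeRing (psRing m) using (setoid; _-_; sym; trans; -‿cong; distribʳ; distribˡ; +-cong; +-congˡ; +-congʳ; +-assoc; +-comm; *-comm; ring)
  open PS-Sum m hiding (sum)
  open D-PS m using (differences; vandermonde; det-scale-rows)
  open import Relation.Binary.Reasoning.Setoid setoid
  open import Algebra.Properties.Ring ring using (-‿distribˡ-*; -‿distribʳ-*)

  pairs≐differences : ∀ n (F : Fin n → Fin n → PS m) (x : Fin n → PS m) → (∀ i j → F i j ≐ x i - x j) →
    ∏ (λ i → ∏ (λ j → if toℕ i ℕ.<ᵇ toℕ j then F i j else one)) ≐ differences n x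
  pairs≐differences zero    F x eq = λ u → ≡.refl
  pairs≐differences (suc n) F x eq = ⊗-cong m
    (trans (⊗-identityˡ m _) (∏-cong {n} λ j → eq zero (suc j)))
    (trans (∏-cong {n} λ i → ⊗-identityˡ m _) (pairs≐differences n (λ i j → F (suc i) (suc j)) (x ∘ suc)
      (λ i j → eq (suc i) (suc j))))

  scal-neg1 : ∀ (f : PS m) → scal neg1 f ≐ negPS f
  scal-neg1 f u = ℤₚ.-1*i≡-i (f u)

  prodPairs≐differences : ∀ (F : Fin m → Fin m → PS m) (x : Fin m → PS m) →
    (∀ i j → F i j ≐ x i - x j) → prodPairs F ≐ differences m x
  prodPairs≐differences F x eq = trans (prodFin≐∏ _)
    (trans (∏-cong {m} λ i → prodFin≐∏ _) (pairs≐differences m F x eq))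

  -- The coefficients of ∏ (qᵢ - qⱼ) ∏ gₗ form a determinant of univariate coefficients:
  -- the first product is a Vandermonde determinant and row i only involves the i-th variable.
  product-coefficient : ∀ (F : Fin m → Fin m → PS m) (q g : Fin m → PS m) (f : Fin m → Series) →
    (∀ i j → F i j ≐ q i - q j) →
    (∀ i j → g i ⊗ (q i ^ (m ℕ.∸ suc (toℕ j))) ≐ embed i (f j)) →
    ∀ u → (prodPairs F ⊗ prodFin g) u ≡ D-ℤ.det m (λ i j → f j (lookup u i))
  product-coefficient F q g f F≐ g≐ u = ≡.trans (eq u) (det-coefficient m (λ i j → f j) u)
    where
    V : Fin m → Fin m → PS m
    V i j = q i ^ (m ℕ.∸ suc (toℕ j))
    eq : prodPairs F ⊗ prodFin g ≐ D-PS.det m m (λ i j → embed i (f j))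
    eq = begin
      prodPairs F ⊗ prodFin g      ≈⟨ ⊗-cong m (prodPairs≐differences F q F≐) (prodFin≐∏ g) ⟩
      differences m q ⊗ ∏ g        ≈⟨ ⊗-congʳ m {∏ g} (sym (vandermonde m q)) ⟩
      D-PS.det m m V ⊗ ∏ g         ≈⟨ *-comm (D-PS.det m m V) (∏ g) ⟩
      ∏ g ⊗ D-PS.det m m V         ≈⟨ sym (det-scale-rows m g V) ⟩
      D-PS.det m m (λ i j → g i ⊗ V i j)  ≈⟨ D-PS.det-cong m m g≐ ⟩
      D-PS.det m m (λ i j → embed i (f j)) ∎

  factor₂ : ∀ (x y : PS m) → (x ⊕ scal neg1 y) ⊗ ((one ⊕ x) ⊕ y) ≐ (x ⊕ (x ⊗ x)) - (y ⊕ (y ⊗ y))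
  factor₂ x y = begin
    (x ⊕ scal neg1 y) ⊗ ((one ⊕ x) ⊕ y)
      ≈⟨ ⊗-congʳ m {(one ⊕ x) ⊕ y} (+-congˡ {x} (scal-neg1 y)) ⟩
    (x - y) ⊗ ((one ⊕ x) ⊕ y)
      ≈⟨ distribʳ ((one ⊕ x) ⊕ y) x (negPS y) ⟩
    (x ⊗ ((one ⊕ x) ⊕ y)) ⊕ (negPS y ⊗ ((one ⊕ x) ⊕ y))
      ≈⟨ +-cong {x ⊗ ((one ⊕ x) ⊕ y)} (expand x y) (trans (⊗-congˡ m {negPS y} (trans (+-assoc one x y) (trans (+-congˡ {one} (+-comm x y)) (sym (+-assoc one y x)))))
           (trans (sym (-‿distribˡ-* y ((one ⊕ y) ⊕ x))) (-‿cong (expand y x)))) ⟩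
    ((x ⊕ (x ⊗ x)) ⊕ (x ⊗ y)) ⊕ negPS ((y ⊕ (y ⊗ y)) ⊕ (y ⊗ x))
      ≈⟨ +-congˡ {(x ⊕ (x ⊗ x)) ⊕ (x ⊗ y)} (-‿cong (+-congˡ {y ⊕ (y ⊗ y)} (*-comm y x))) ⟩
    ((x ⊕ (x ⊗ x)) ⊕ (x ⊗ y)) ⊕ negPS ((y ⊕ (y ⊗ y)) ⊕ (x ⊗ y))
      ≈⟨ (λ u → cancel ((x ⊕ (x ⊗ x)) u) ((x ⊗ y) u) ((y ⊕ (y ⊗ y)) u)) ⟩
    (x ⊕ (x ⊗ x)) - (y ⊕ (y ⊗ y)) ∎
    where
    expand : ∀ x y → x ⊗ ((one ⊕ x) ⊕ y) ≐ (x ⊕ (x ⊗ x)) ⊕ (x ⊗ y)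
    expand x y = trans (distribˡ x (one ⊕ x) y) (+-congʳ {x ⊗ y} (trans (distribˡ x one x) (+-congʳ {x ⊗ x} (⊗-identityʳ m x))))
    cancel : ∀ a c b → (a ℤ.+ c) ℤ.+ ℤ.- (b ℤ.+ c) ≡ a ℤ.+ ℤ.- b
    cancel = solve-∀

  -- Replacing x and y by their negatives turns this into the previous identity.
  factor₁ : ∀ (x y : PS m) → (x ⊕ scal neg1 y) ⊗ ((one ⊕ scal neg1 x) ⊕ scal neg1 y) ≐
            (x ⊕ negPS (x ⊗ x)) - (y ⊕ negPS (y ⊗ y))
  factor₁ x y = begin
    (x ⊕ scal neg1 y) ⊗ ((one ⊕ scal neg1 x) ⊕ scal neg1 y)
      ≈⟨ ⊗-cong m (λ u → lemma (x u) (y u)) (+-cong {one ⊕ scal neg1 x} (+-congˡ {one} (scal-neg1 x)) (scal-neg1 y)) ⟩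
    negPS (negPS x ⊕ scal neg1 (negPS y)) ⊗ ((one ⊕ negPS x) ⊕ negPS y)
      ≈⟨ sym (-‿distribˡ-* (negPS x ⊕ scal neg1 (negPS y)) ((one ⊕ negPS x) ⊕ negPS y)) ⟩
    negPS ((negPS x ⊕ scal neg1 (negPS y)) ⊗ ((one ⊕ negPS x) ⊕ negPS y))
      ≈⟨ -‿cong (factor₂ (negPS x) (negPS y)) ⟩
    negPS ((negPS x ⊕ (negPS x ⊗ negPS x)) - (negPS y ⊕ (negPS y ⊗ negPS y)))
      ≈⟨ -‿cong (+-cong (+-congˡ {negPS x} (square x)) (-‿cong (+-congˡ {negPS y} (square y)))) ⟩
    negPS ((negPS x ⊕ (x ⊗ x)) - (negPS y ⊕ (y ⊗ y)))
      ≈⟨ (λ u → lemma′ (x u) ((x ⊗ x) u) (y u) ((y ⊗ y) u)) ⟩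
    (x ⊕ negPS (x ⊗ x)) - (y ⊕ negPS (y ⊗ y)) ∎
    where
    square : ∀ x → negPS x ⊗ negPS x ≐ x ⊗ x
    square x = trans (sym (-‿distribˡ-* x (negPS x))) (trans (-‿cong (sym (-‿distribʳ-* x x))) (λ u → ℤₚ.neg-involutive _))
    lemma : ∀ a b → a ℤ.+ neg1 ℤ.* b ≡ ℤ.- (ℤ.- a ℤ.+ neg1 ℤ.* (ℤ.- b))
    lemma = solve-∀
    lemma′ : ∀ a b c d → ℤ.- ((ℤ.- a ℤ.+ b) ℤ.+ ℤ.- (ℤ.- c ℤ.+ d)) ≡ (a ℤ.+ ℤ.- b) ℤ.+ ℤ.- (c ℤ.+ ℤ.- d)
    lemma′ = solve-∀

-- The univariate series in the rows of the two determinants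

open ℤ-Series using (conv; constant)

shift : Series → Series
shift f zero    = + 0
shift f (suc n) = f n

shiftⁿ : ℕ → Series → Series
shiftⁿ zero    f = f
shiftⁿ (suc s) f = shift (shiftⁿ s f)

-- E c is the coefficient sequence of (1 + 2z)(z + z²)ᶜ.
E : ℕ → Series
E zero    n = constant (+ 1) n ℤ.+ + 2 ℤ.* X n
E (suc c) n = shift (E c) n ℤ.+ shift (shift (E c)) n

timesOnePlusX : ℕ → Series → Series
timesOnePlusX zero    f   = f
timesOnePlusX (suc b) f n = timesOnePlusX b f n ℤ.+ shift (timesOnePlusX b f) n

-- Γ a b is the binomial coefficient (a + b choose a), the coefficient of yᵃ in (1 - y)^(-b-1).
Γ : ℕ → ℕ → ℤ
Γ zero    b       = + 1
Γ (suc a) zero    = + 1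
Γ (suc a) (suc b) = Γ a (suc b) ℤ.+ Γ (suc a) b

conv-X : ∀ f n → conv X f n ≡ shift f n
conv-X f zero    = ≡.refl
conv-X f (suc n) = begin
  + 0 ℤ.+ conv (X ∘ suc) f n  ≡⟨ ℤₚ.+-identityˡ _ ⟩
  conv (X ∘ suc) f n          ≡⟨ ℤ-Series.conv-cong {X ∘ suc} {constant (+ 1)} {f} (λ { zero → ≡.refl ; (suc _) → ≡.refl }) (λ _ → ≡.refl) n ⟩
  conv (constant (+ 1)) f n   ≡⟨ ℤ-Series.conv-constantˡ (+ 1) f n ⟩
  + 1 ℤ.* f n                 ≡⟨ ℤₚ.*-identityˡ (f n) ⟩
  f n                         ∎
  where open ≡.≡-Reasoning

E-below : ∀ c n → n ℕ.< c → E c n ≡ + 0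
E-below (suc c) zero          _           = ≡.refl
E-below (suc c) (suc zero)    (ℕ.s≤s n<c) = ≡.trans (ℤₚ.+-identityʳ _) (E-below c zero n<c)
E-below (suc c) (suc (suc n)) (ℕ.s≤s n<c) =
  cong₂ ℤ._+_ (E-below c (suc n) n<c) (E-below c n (ℕₚ.<-trans (ℕₚ.n<1+n n) n<c))

E-diagonal : ∀ c → E c c ≡ + 1
E-diagonal zero          = ≡.refl
E-diagonal (suc zero)    = ≡.refl
E-diagonal (suc (suc c)) = cong₂ ℤ._+_ (E-diagonal (suc c)) (E-below (suc c) c ℕₚ.≤-refl)

-- A factor z^b completes (1 + z)^b to (z + z²)^b. In this way the powers (1 + z)^(k-n) of the
-- second product are absorbed by raising both the index of `E` and the exponent.
timesOnePlusX-E : ∀ b c n → timesOnePlusX b (E c) n ≡ E (b ℕ.+ c) (b ℕ.+ n)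
timesOnePlusX-E zero    c n = ≡.refl
timesOnePlusX-E (suc b) c n = cong₂ ℤ._+_ (timesOnePlusX-E b c n) (go n)
  where
  vanish : ∀ b c → shift (E (b ℕ.+ c)) b ≡ + 0
  vanish zero    c = ≡.refl
  vanish (suc b) c = E-below (suc b ℕ.+ c) b (ℕ.s≤s (ℕₚ.m≤m+n b c))
  go : ∀ n → shift (timesOnePlusX b (E c)) n ≡ shift (E (b ℕ.+ c)) (b ℕ.+ n)
  go zero    = ≡.sym (≡.trans (cong (shift (E (b ℕ.+ c))) (ℕₚ.+-identityʳ b)) (vanish b c))
  go (suc n) = ≡.trans (timesOnePlusX-E b c n) (≡.sym (cong (shift (E (b ℕ.+ c))) (ℕₚ.+-suc b n)))

embed-neg : ∀ {m} (i : Fin m) f → embed i (λ n → ℤ.- f n) ≐ negPS (embed i f)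
embed-neg zero    f (a ∷ u)     = ≡.sym (ℤₚ.neg-distribˡ-* (f a) (one u))
embed-neg (suc i) f (zero  ∷ u) = embed-neg i f u
embed-neg (suc i) f (suc a ∷ u) = ≡.refl

conv-geometric : ∀ b n → conv geometric (λ a → Γ a b) n ≡ Γ n (suc b)
conv-geometric b zero    = ℤₚ.*-identityˡ (Γ 0 b)
conv-geometric b (suc n) = ≡.trans
  (cong₂ ℤ._+_ (ℤₚ.*-identityˡ (Γ (suc n) b)) (conv-geometric b n))
  (ℤₚ.+-comm (Γ (suc n) b) (Γ n (suc b)))

conv-geometric-one : ∀ n → conv geometric (constant (+ 1)) n ≡ Γ n 0
conv-geometric-one zero    = ≡.refl
conv-geometric-one (suc n) = ≡.trans (ℤₚ.+-identityˡ _) (≡.trans (conv-geometric-one n) (Γ₀ n))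
  where
  Γ₀ : ∀ n → Γ n 0 ≡ + 1
  Γ₀ zero    = ≡.refl
  Γ₀ (suc n) = ≡.refl

-- Multiplication of (1 - y)^(-b-2) by 1 - y.
Γ-difference : ∀ b a → Γ a (suc b) ℤ.+ ℤ.- shift (λ a → Γ a (suc b)) a ≡ Γ a b
Γ-difference b zero    = ≡.refl
Γ-difference b (suc a) = cancel (Γ a (suc b)) (Γ (suc a) b)
  where
  cancel : ∀ x y → (x ℤ.+ y) ℤ.+ ℤ.- x ≡ y
  cancel = solve-∀

-- The same identity after a factor y^s. It serves both `row₁` and the duality `pairing-H`.
shiftⁿ-Γ-difference : ∀ b s n → shiftⁿ s (λ a → Γ a (suc b)) n ℤ.+ ℤ.- shift (shiftⁿ s (λ a → Γ a (suc b))) n ≡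
                                shiftⁿ s (λ a → Γ a b) n
shiftⁿ-Γ-difference b zero    n       = Γ-difference b n
shiftⁿ-Γ-difference b (suc s) zero    = ≡.refl
shiftⁿ-Γ-difference b (suc s) (suc n) = shiftⁿ-Γ-difference b s n

module _ {m : ℕ} where

  open CommutativeRing (psRing m) using (setoid; sym; trans; -‿cong; distribʳ; +-cong; *-comm; ring)
  open import Relation.Binary.Reasoning.Setoid setoid
  open import Algebra.Properties.Ring ring using (-‿distribˡ-*)
  open import Algebra.Properties.CommutativeSemigroup (CommutativeRing.*-commutativeSemigroup (psRing m))
    using (x∙yz≈y∙xz)
  open PS-Sum m using (_^_)

  var-⊗-embed : ∀ i f → var i ⊗ embed i f ≐ embed i (shift f)
  var-⊗-embed i f = begin
    var i ⊗ embed i f       ≈⟨ ⊗-congʳ m {embed i f} (sym (embed-X i)) ⟩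
    embed i X ⊗ embed i f   ≈⟨ sym (embed-⊗ i X f) ⟩
    embed i (conv X f)      ≈⟨ embed-cong i (conv-X f) ⟩
    embed i (shift f)       ∎

  var²-⊗-embed : ∀ i f → (var i ⊗ var i) ⊗ embed i f ≐ embed i (shift (shift f))
  var²-⊗-embed i f = begin
    (var i ⊗ var i) ⊗ embed i f   ≈⟨ ⊗-assoc m (var i) (var i) (embed i f) ⟩
    var i ⊗ (var i ⊗ embed i f)   ≈⟨ ⊗-congˡ m {var i} (var-⊗-embed i f) ⟩
    var i ⊗ embed i (shift f)     ≈⟨ var-⊗-embed i (shift f) ⟩
    embed i (shift (shift f))     ∎

  q₁ q₂ : Fin m → PS m
  q₁ i = var i ⊕ negPS (var i ⊗ var i)
  q₂ i = var i ⊕ (var i ⊗ var i)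

  q₁-⊗-embed : ∀ i f → q₁ i ⊗ embed i f ≐ embed i (λ n → shift f n ℤ.+ ℤ.- shift (shift f) n)
  q₁-⊗-embed i f = begin
    q₁ i ⊗ embed i f   ≈⟨ distribʳ (embed i f) (var i) (negPS (var i ⊗ var i)) ⟩
    (var i ⊗ embed i f) ⊕ (negPS (var i ⊗ var i) ⊗ embed i f)
      ≈⟨ +-cong (var-⊗-embed i f) (trans (sym (-‿distribˡ-* (var i ⊗ var i) (embed i f)))
           (trans (-‿cong (var²-⊗-embed i f)) (sym (embed-neg i _)))) ⟩
    embed i (shift f) ⊕ embed i (λ n → ℤ.- shift (shift f) n)  ≈⟨ sym (embed-+ i _ _) ⟩
    embed i (λ n → shift f n ℤ.+ ℤ.- shift (shift f) n)        ∎

  q₂-⊗-embed : ∀ i f → q₂ i ⊗ embed i f ≐ embed i (λ n → shift f n ℤ.+ shift (shift f) n)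
  q₂-⊗-embed i f = begin
    q₂ i ⊗ embed i f   ≈⟨ distribʳ (embed i f) (var i) (var i ⊗ var i) ⟩
    (var i ⊗ embed i f) ⊕ ((var i ⊗ var i) ⊗ embed i f)
      ≈⟨ +-cong (var-⊗-embed i f) (var²-⊗-embed i f) ⟩
    embed i (shift f) ⊕ embed i (shift (shift f))        ≈⟨ sym (embed-+ i _ _) ⟩
    embed i (λ n → shift f n ℤ.+ shift (shift f) n)      ∎

  embed-E₀ : ∀ i → embed i (E 0) ≐ one ⊕ scal (+ 2) (var i)
  embed-E₀ i = begin
    embed i (E 0)  ≈⟨ embed-+ i (constant (+ 1)) (λ n → + 2 ℤ.* X n) ⟩
    embed i (constant (+ 1)) ⊕ embed i (λ n → + 2 ℤ.* X n)
      ≈⟨ +-cong (embed-one i) (trans (embed-scal i (+ 2) X) (λ u → cong (ℤ._*_ (+ 2)) (embed-X i u))) ⟩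
    one ⊕ scal (+ 2) (var i) ∎

  q₂^-⊗-embed-E₀ : ∀ i s → (q₂ i ^ s) ⊗ embed i (E 0) ≐ embed i (E s)
  q₂^-⊗-embed-E₀ i zero    = ⊗-identityˡ m _
  q₂^-⊗-embed-E₀ i (suc s) = begin
    (q₂ i ⊗ (q₂ i ^ s)) ⊗ embed i (E 0)  ≈⟨ ⊗-assoc m (q₂ i) (q₂ i ^ s) (embed i (E 0)) ⟩
    q₂ i ⊗ ((q₂ i ^ s) ⊗ embed i (E 0))  ≈⟨ ⊗-congˡ m {q₂ i} (q₂^-⊗-embed-E₀ i s) ⟩
    q₂ i ⊗ embed i (E s)                 ≈⟨ q₂-⊗-embed i (E s) ⟩
    embed i (E (suc s))                  ∎

  pow-⊗-embed : ∀ i b f → pow (one ⊕ var i) b ⊗ embed i f ≐ embed i (timesOnePlusX b f)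
  pow-⊗-embed i zero    f = ⊗-identityˡ m _
  pow-⊗-embed i (suc b) f = begin
    ((one ⊕ var i) ⊗ pow (one ⊕ var i) b) ⊗ embed i f
      ≈⟨ ⊗-assoc m (one ⊕ var i) (pow (one ⊕ var i) b) (embed i f) ⟩
    (one ⊕ var i) ⊗ (pow (one ⊕ var i) b ⊗ embed i f)  ≈⟨ ⊗-congˡ m {one ⊕ var i} (pow-⊗-embed i b f) ⟩
    (one ⊕ var i) ⊗ embed i g                          ≈⟨ distribʳ (embed i g) one (var i) ⟩
    (one ⊗ embed i g) ⊕ (var i ⊗ embed i g)            ≈⟨ +-cong (⊗-identityˡ m (embed i g)) (var-⊗-embed i g) ⟩
    embed i g ⊕ embed i (shift g)                      ≈⟨ sym (embed-+ i g (shift g)) ⟩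
    embed i (timesOnePlusX (suc b) f)                  ∎
    where g = timesOnePlusX b f

  row₂ : ∀ b i s → ((one ⊕ scal (+ 2) (var i)) ⊗ pow (one ⊕ var i) b) ⊗ (q₂ i ^ s) ≐
                   embed i (timesOnePlusX b (E s))
  row₂ b i s = begin
    (A ⊗ B) ⊗ Q                ≈⟨ ⊗-congʳ m {Q} (*-comm A B) ⟩
    (B ⊗ A) ⊗ Q                ≈⟨ ⊗-assoc m B A Q ⟩
    B ⊗ (A ⊗ Q)                ≈⟨ ⊗-congˡ m {B} (*-comm A Q) ⟩
    B ⊗ (Q ⊗ A)                ≈⟨ ⊗-congˡ m {B} (trans (⊗-congˡ m {Q} (sym (embed-E₀ i))) (q₂^-⊗-embed-E₀ i s)) ⟩
    B ⊗ embed i (E s)          ≈⟨ pow-⊗-embed i b (E s) ⟩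
    embed i (timesOnePlusX b (E s)) ∎
    where
    A B Q : PS m
    A = one ⊕ scal (+ 2) (var i)
    B = pow (one ⊕ var i) b
    Q = q₂ i ^ s

  invOneMinus-⊗-embed : ∀ i f → invOneMinus i ⊗ embed i f ≐ embed i (conv geometric f)
  invOneMinus-⊗-embed i f = trans (⊗-congʳ m {embed i f} (sym (embed-geometric i))) (sym (embed-⊗ i geometric f))

  pow-invOneMinus : ∀ i b → pow (invOneMinus i) (suc b) ≐ embed i (λ a → Γ a b)
  pow-invOneMinus i zero    = begin
    invOneMinus i ⊗ one                       ≈⟨ ⊗-congˡ m {invOneMinus i} (sym (embed-one i)) ⟩
    invOneMinus i ⊗ embed i (constant (+ 1))  ≈⟨ invOneMinus-⊗-embed i (constant (+ 1)) ⟩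
    embed i (conv geometric (constant (+ 1))) ≈⟨ embed-cong i conv-geometric-one ⟩
    embed i (λ a → Γ a 0)                     ∎
  pow-invOneMinus i (suc b) = begin
    invOneMinus i ⊗ pow (invOneMinus i) (suc b)  ≈⟨ ⊗-congˡ m {invOneMinus i} (pow-invOneMinus i b) ⟩
    invOneMinus i ⊗ embed i (λ a → Γ a b)        ≈⟨ invOneMinus-⊗-embed i (λ a → Γ a b) ⟩
    embed i (conv geometric (λ a → Γ a b))       ≈⟨ embed-cong i (conv-geometric b) ⟩
    embed i (λ a → Γ a (suc b))                  ∎

  -- Here `q₁ i ^ s` is y^s (1 - y)^s: its second factor lowers the inverse power from s + b + 1 to
  -- b + 1, and the first remains as a shift.
  row₁ : ∀ i s b → pow (invOneMinus i) (s ℕ.+ suc b) ⊗ (q₁ i ^ s) ≐ embed i (shiftⁿ s (λ a → Γ a b))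
  row₁ i zero    b = trans (⊗-identityʳ m _) (pow-invOneMinus i b)
  row₁ i (suc s) b = begin
    pow (invOneMinus i) (suc s ℕ.+ suc b) ⊗ (q₁ i ⊗ Q)   ≈⟨ ⊗-congʳ m {q₁ i ⊗ Q} (λ u → cong (λ e → pow (invOneMinus i) e u) (≡.sym (ℕₚ.+-suc s (suc b)))) ⟩
    P ⊗ (q₁ i ⊗ Q)                                       ≈⟨ x∙yz≈y∙xz P (q₁ i) Q ⟩
    q₁ i ⊗ (P ⊗ Q)                                       ≈⟨ ⊗-congˡ m {q₁ i} (row₁ i s (suc b)) ⟩
    q₁ i ⊗ embed i h                                     ≈⟨ q₁-⊗-embed i h ⟩
    embed i (λ n → shift h n ℤ.+ ℤ.- shift (shift h) n)  ≈⟨ embed-cong i (λ { zero → ≡.refl ; (suc n) → shiftⁿ-Γ-difference b s n }) ⟩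
    embed i (shiftⁿ (suc s) (λ a → Γ a b))               ∎
    where
    P = pow (invOneMinus i) (s ℕ.+ suc (suc b))
    Q = q₁ i ^ s
    h = shiftⁿ s (λ a → Γ a (suc b))

series2-coefficient : ∀ n k u → series2 n k u ≡
  D-ℤ.det n (λ i j → E ((k ℕ.∸ n) ℕ.+ (n ℕ.∸ suc (toℕ j))) ((k ℕ.∸ n) ℕ.+ lookup u i))
series2-coefficient n k u = ≡.trans
  (product-coefficient _ q₂ _ (λ j → timesOnePlusX (k ℕ.∸ n) (E (n ℕ.∸ suc (toℕ j))))
    (λ i j → factor₂ (var i) (var j))
    (λ i j → row₂ (k ℕ.∸ n) i (n ℕ.∸ suc (toℕ j))) u)
  (D-ℤ.det-cong n λ i j → timesOnePlusX-E (k ℕ.∸ n) (n ℕ.∸ suc (toℕ j)) (lookup u i))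

series1-coefficient : ∀ m k u → series1 m k u ≡
  D-ℤ.det m (λ i j → shiftⁿ (m ℕ.∸ suc (toℕ j)) (λ a → Γ a (k ℕ.+ toℕ j)) (lookup u i))
series1-coefficient m k u =
  product-coefficient _ q₁ _ (λ j → shiftⁿ (m ℕ.∸ suc (toℕ j)) (λ a → Γ a (k ℕ.+ toℕ j)))
    (λ i j → factor₁ (var i) (var j))
    (λ i j → CommutativeRing.trans (psRing m)
      (⊗-congʳ m {PS-Sum._^_ m (q₁ i) (m ℕ.∸ suc (toℕ j))} (λ u → cong (λ e → pow (invOneMinus i) e u) (exponent j)))
      (row₁ i (m ℕ.∸ suc (toℕ j)) (k ℕ.+ toℕ j))) u
  where
  open ≡.≡-Reasoning
  -- Column j carries the power m - 1 - j of `q₁`, so k + m inverse factors leave (1 -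
  -- y)^(-(k+j)-1).
  exponent : ∀ (j : Fin m) → k ℕ.+ m ≡ (m ℕ.∸ suc (toℕ j)) ℕ.+ suc (k ℕ.+ toℕ j)
  exponent j = begin
    k ℕ.+ m                                         ≡⟨ cong (k ℕ.+_) (ℕₚ.m∸n+n≡m (Finₚ.toℕ<n j)) ⟨
    k ℕ.+ ((m ℕ.∸ suc (toℕ j)) ℕ.+ suc (toℕ j))     ≡⟨ ℕₚ.+-assoc k _ _ ⟨
    (k ℕ.+ (m ℕ.∸ suc (toℕ j))) ℕ.+ suc (toℕ j)     ≡⟨ cong (ℕ._+ suc (toℕ j)) (ℕₚ.+-comm k _) ⟩
    ((m ℕ.∸ suc (toℕ j)) ℕ.+ k) ℕ.+ suc (toℕ j)     ≡⟨ ℕₚ.+-assoc (m ℕ.∸ suc (toℕ j)) k _ ⟩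
    (m ℕ.∸ suc (toℕ j)) ℕ.+ (k ℕ.+ suc (toℕ j))     ≡⟨ cong ((m ℕ.∸ suc (toℕ j)) ℕ.+_) (ℕₚ.+-suc k (toℕ j)) ⟩
    (m ℕ.∸ suc (toℕ j)) ℕ.+ suc (k ℕ.+ toℕ j)       ∎

-- Complementary minors

open ℤ-Sum using (sum-cong-≗; ∏)
open D-ℤ using (sgn; sgn²≈1)
open ≡.≡-Reasoning

-- Entries indexed by ℕ make blocks, reversals and changes of size free of transports between `Fin`
-- types; bounds appear as hypotheses where an entry depends on them.
detℕ : ℕ → (ℕ → ℕ → ℤ) → ℤ
detℕ n g = D-ℤ.det n (λ i j → g (toℕ i) (toℕ j))

sumℕ : ℕ → (ℕ → ℤ) → ℤ
sumℕ n f = sum {n} (λ l → f (toℕ l))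

δℕ : ℕ → ℕ → ℤ
δℕ zero    zero    = + 1
δℕ zero    (suc p) = + 0
δℕ (suc m) zero    = + 0
δℕ (suc m) (suc p) = δℕ m p

δℕ-refl : ∀ n → δℕ n n ≡ + 1
δℕ-refl zero    = ≡.refl
δℕ-refl (suc n) = δℕ-refl n

δℕ-≢ : ∀ m p → m ≢ p → δℕ m p ≡ + 0
δℕ-≢ zero    zero    m≢p = ⊥-elim (m≢p ≡.refl)
δℕ-≢ zero    (suc p) m≢p = ≡.refl
δℕ-≢ (suc m) zero    m≢p = ≡.refl
δℕ-≢ (suc m) (suc p) m≢p = δℕ-≢ m p (m≢p ∘ cong suc)

skip : ℕ → ℕ → ℕ
skip zero    j       = suc j
skip (suc p) zero    = zero
skip (suc p) (suc j) = suc (skip p j)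

toℕ-punchIn : ∀ {n} (p : Fin (suc n)) j → toℕ (punchIn p j) ≡ skip (toℕ p) (toℕ j)
toℕ-punchIn zero    j       = ≡.refl
toℕ-punchIn (suc p) zero    = ≡.refl
toℕ-punchIn (suc p) (suc j) = cong suc (toℕ-punchIn p j)

skip-< : ∀ {p j} → j ℕ.< p → skip p j ≡ j
skip-< {suc p} {zero}  _           = ≡.refl
skip-< {suc p} {suc j} (ℕ.s≤s j<p) = cong suc (skip-< j<p)

skip-≥ : ∀ {p j} → p ℕ.≤ j → skip p j ≡ suc j
skip-≥ {zero}          _           = ≡.refl
skip-≥ {suc p} {suc j} (ℕ.s≤s p≤j) = cong suc (skip-≥ p≤j)

skip-≢ : ∀ p j → skip p j ≢ p
skip-≢ (suc p) (suc j) eq = skip-≢ p j (ℕₚ.suc-injective eq)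

detℕ-cong : ∀ n {g h : ℕ → ℕ → ℤ} → (∀ i j → i ℕ.< n → j ℕ.< n → g i j ≡ h i j) → detℕ n g ≡ detℕ n h
detℕ-cong n eq = D-ℤ.det-cong n λ i j → eq _ _ (Finₚ.toℕ<n i) (Finₚ.toℕ<n j)

detℕ-single : ∀ n g p → p ℕ.< suc n → (∀ j → j ≢ p → g 0 j ≡ + 0) →
  detℕ (suc n) g ≡ sgn p ℤ.* (g 0 p ℤ.* detℕ n (λ i j → g (suc i) (skip p j)))
detℕ-single n g p p<n eq = ≡.trans
  (D-ℤ.det-expand-single n (λ i j → g (toℕ i) (toℕ j)) q λ k →
    eq _ (λ e → skip-≢ (toℕ q) (toℕ k) (≡.trans (≡.sym (toℕ-punchIn q k)) (≡.trans e (≡.sym q≡p)))))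
  (≡.trans
    (cong (λ d → sgn (toℕ q) ℤ.* (g 0 (toℕ q) ℤ.* d))
      (D-ℤ.det-cong n {λ i j → g (suc (toℕ i)) (toℕ (punchIn q j))} λ i j → cong (g (suc (toℕ i))) (toℕ-punchIn q j)))
    (cong (λ q → sgn q ℤ.* (g 0 q ℤ.* detℕ n (λ i j → g (suc i) (skip q j)))) q≡p))
  where
  q = fromℕ< p<n
  q≡p = Finₚ.toℕ-fromℕ< p<n

detℕ-block : ∀ a b g → D-ℤ.det a (λ i j → g (toℕ (i ↑ˡ b)) (toℕ (j ↑ˡ b))) ℤ.*
                       D-ℤ.det b (λ i j → g (toℕ (a ↑ʳ i)) (toℕ (a ↑ʳ j))) ≡
                       detℕ a g ℤ.* detℕ b (λ i j → g (a ℕ.+ i) (a ℕ.+ j))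
detℕ-block a b g = cong₂ ℤ._*_
  (D-ℤ.det-cong a λ i j → cong₂ g (Finₚ.toℕ-↑ˡ i b) (Finₚ.toℕ-↑ˡ j b))
  (D-ℤ.det-cong b λ i j → cong₂ g (Finₚ.toℕ-↑ʳ a i) (Finₚ.toℕ-↑ʳ a j))

detℕ-block-upper : ∀ a b g → (∀ i j → i ℕ.< b → j ℕ.< a → g (a ℕ.+ i) j ≡ + 0) →
  detℕ (a ℕ.+ b) g ≡ detℕ a g ℤ.* detℕ b (λ i j → g (a ℕ.+ i) (a ℕ.+ j))
detℕ-block-upper a b g eq = ≡.trans
  (D-ℤ.det-block-upper a b (λ i j → g (toℕ i) (toℕ j)) λ i j →
    ≡.trans (cong₂ g (Finₚ.toℕ-↑ʳ a i) (Finₚ.toℕ-↑ˡ j b)) (eq _ _ (Finₚ.toℕ<n i) (Finₚ.toℕ<n j)))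
  (detℕ-block a b g)

detℕ-transpose : ∀ n g → detℕ n (λ i j → g j i) ≡ detℕ n g
detℕ-transpose n g = D-ℤ.det-transpose n (λ i j → g (toℕ i) (toℕ j))

detℕ-reverse : ∀ n g → detℕ n (λ i j → g (n ℕ.∸ suc i) (n ℕ.∸ suc j)) ≡ detℕ n g
detℕ-reverse n g = ≡.trans
  (D-ℤ.det-cong n λ i j → ≡.sym (cong₂ g (Finₚ.opposite-prop i) (Finₚ.opposite-prop j)))
  (D-ℤ.det-reverse n (λ i j → g (toℕ i) (toℕ j)))

detℕ-* : ∀ n g h → detℕ n (λ i j → sumℕ n (λ l → g i l ℤ.* h l j)) ≡ detℕ n g ℤ.* detℕ n h
detℕ-* n g h = D-ℤ.det-* n (λ i j → g (toℕ i) (toℕ j)) (λ i j → h (toℕ i) (toℕ j))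

∏ℕ : ℕ → (ℕ → ℤ) → ℤ
∏ℕ n f = ∏ {n} (λ l → f (toℕ l))

detℕ-lower-triangular : ∀ n g → (∀ i j → i ℕ.< j → j ℕ.< n → g i j ≡ + 0) → detℕ n g ≡ ∏ℕ n (λ i → g i i)
detℕ-lower-triangular n g eq =
  D-ℤ.det-lower-triangular n (λ i j → g (toℕ i) (toℕ j)) λ i j i<j → eq _ _ i<j (Finₚ.toℕ<n j)

∏ℕ-one : ∀ n f → (∀ i → i ℕ.< n → f i ≡ + 1) → ∏ℕ n f ≡ + 1
∏ℕ-one n f eq = D-ℤ.∏-one n (λ i → f (toℕ i)) λ i → eq _ (Finₚ.toℕ<n i)

detℕ-scale-rows : ∀ n f g → detℕ n (λ i j → f i ℤ.* g i j) ≡ ∏ℕ n f ℤ.* detℕ n g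
detℕ-scale-rows n f g = D-ℤ.det-scale-rows n (λ i → f (toℕ i)) (λ i j → g (toℕ i) (toℕ j))

sumℕ-cong : ∀ n {f g : ℕ → ℤ} → (∀ l → f l ≡ g l) → sumℕ n f ≡ sumℕ n g
sumℕ-cong n eq = sum-cong-≗ {n} λ l → eq (toℕ l)

sumℕ-+ : ∀ n (f g : Series) → sumℕ n (λ l → f l ℤ.+ g l) ≡ sumℕ n f ℤ.+ sumℕ n g
sumℕ-+ n f g = ℤ-Sum.∑-distrib-+ {n} (λ l → f (toℕ l)) (λ l → g (toℕ l))

sumℕ-zero : ∀ n (f : Series) → (∀ l → f l ≡ + 0) → sumℕ n f ≡ + 0
sumℕ-zero n f eq = D-ℤ.sum-zero {n} (λ l → f (toℕ l)) λ l → eq (toℕ l)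

sumℕ-δ : ∀ n m (f : Series) → m ℕ.< n → sumℕ n (λ l → δℕ m l ℤ.* f l) ≡ f m
sumℕ-δ (suc n) zero    f _           = ≡.trans
  (cong₂ ℤ._+_ (ℤₚ.*-identityˡ (f 0)) (sumℕ-zero n _ λ l → ≡.refl)) (ℤₚ.+-identityʳ (f 0))
sumℕ-δ (suc n) (suc m) f (ℕ.s≤s m<n) = ≡.trans (ℤₚ.+-identityˡ _) (sumℕ-δ n m (λ l → f (suc l)) m<n)

-- pairing c f is the value at (1 + 2z)(z + z²)ᶜ of the linear functional sending zⁿ to f n.
pairing : ℕ → Series → ℤ
pairing zero    f = f 0 ℤ.+ + 2 ℤ.* f 1
pairing (suc c) f = pairing c (λ n → f (suc n) ℤ.+ f (suc (suc n)))

pairing-cong : ∀ c {f g : Series} → (∀ n → f n ≡ g n) → pairing c f ≡ pairing c g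
pairing-cong zero    eq = cong₂ (λ x y → x ℤ.+ + 2 ℤ.* y) (eq 0) (eq 1)
pairing-cong (suc c) eq = pairing-cong c λ n → cong₂ ℤ._+_ (eq (suc n)) (eq (suc (suc n)))

pairing-+ : ∀ c (f g : Series) → pairing c (λ n → f n ℤ.+ g n) ≡ pairing c f ℤ.+ pairing c g
pairing-+ zero    f g = lemma (f 0) (g 0) (f 1) (g 1)
  where
  lemma : ∀ a b c d → (a ℤ.+ b) ℤ.+ + 2 ℤ.* (c ℤ.+ d) ≡ (a ℤ.+ + 2 ℤ.* c) ℤ.+ (b ℤ.+ + 2 ℤ.* d)
  lemma = solve-∀
pairing-+ (suc c) f g = ≡.trans
  (pairing-cong c λ n → lemma (f (suc n)) (g (suc n)) (f (suc (suc n))) (g (suc (suc n))))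
  (pairing-+ c (λ n → f (suc n) ℤ.+ f (suc (suc n))) (λ n → g (suc n) ℤ.+ g (suc (suc n))))
  where
  lemma : ∀ a b c d → (a ℤ.+ b) ℤ.+ (c ℤ.+ d) ≡ (a ℤ.+ c) ℤ.+ (b ℤ.+ d)
  lemma = solve-∀

pairing-* : ∀ c a (f : Series) → pairing c (λ n → a ℤ.* f n) ≡ a ℤ.* pairing c f
pairing-* zero    a f = lemma a (f 0) (f 1)
  where
  lemma : ∀ a b c → a ℤ.* b ℤ.+ + 2 ℤ.* (a ℤ.* c) ≡ a ℤ.* (b ℤ.+ + 2 ℤ.* c)
  lemma = solve-∀
pairing-* (suc c) a f = ≡.trans
  (pairing-cong c λ n → ≡.sym (ℤₚ.*-distribˡ-+ a (f (suc n)) (f (suc (suc n)))))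
  (pairing-* c a (λ n → f (suc n) ℤ.+ f (suc (suc n))))

sumℕ-shift : ∀ n (f g : Series) → sumℕ (suc n) (λ l → shift f l ℤ.* g l) ≡ sumℕ n (λ l → f l ℤ.* g (suc l))
sumℕ-shift n f g = ℤₚ.+-identityˡ _

-- `E c` has degree 2c + 1, so 2c + 2 terms exhaust it; n is slack for the common length 2k. The
-- recursion moves the factor z + z² from the series to the functional.
sumℕ-E : ∀ c n (f : Series) → sumℕ (suc (suc (c ℕ.+ c)) ℕ.+ n) (λ l → E c l ℤ.* f l) ≡ pairing c f
sumℕ-E zero    n f = begin
  + 1 ℤ.* f 0 ℤ.+ (+ 2 ℤ.* f 1 ℤ.+ sumℕ n (λ l → + 0 ℤ.* f (suc (suc l))))
    ≡⟨ cong₂ (λ x y → x ℤ.+ (+ 2 ℤ.* f 1 ℤ.+ y)) (ℤₚ.*-identityˡ (f 0)) (sumℕ-zero n (λ l → + 0 ℤ.* f (suc (suc l))) λ l → ≡.refl) ⟩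
  f 0 ℤ.+ (+ 2 ℤ.* f 1 ℤ.+ + 0)  ≡⟨ cong (ℤ._+_ (f 0)) (ℤₚ.+-identityʳ _) ⟩
  f 0 ℤ.+ + 2 ℤ.* f 1            ∎
sumℕ-E (suc c) n f = begin
  sumℕ (suc L) (λ l → E (suc c) l ℤ.* f l)
    ≡⟨ sumℕ-cong (suc L) (λ l → ℤₚ.*-distribʳ-+ (f l) (shift (E c) l) (shift (shift (E c)) l)) ⟩
  sumℕ (suc L) (λ l → shift (E c) l ℤ.* f l ℤ.+ shift (shift (E c)) l ℤ.* f l)
    ≡⟨ sumℕ-+ (suc L) (λ l → shift (E c) l ℤ.* f l) (λ l → shift (shift (E c)) l ℤ.* f l) ⟩
  sumℕ (suc L) (λ l → shift (E c) l ℤ.* f l) ℤ.+ sumℕ (suc L) (λ l → shift (shift (E c)) l ℤ.* f l)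
    ≡⟨ cong₂ ℤ._+_ (sumℕ-shift L (E c) f) (≡.trans (sumℕ-shift L (shift (E c)) f) (sumℕ-shift L′ (E c) (λ l → f (suc l)))) ⟩
  sumℕ L (λ l → E c l ℤ.* f (suc l)) ℤ.+ sumℕ L′ (λ l → E c l ℤ.* f (suc (suc l)))
    ≡⟨ cong₂ ℤ._+_ (≡.trans (cong (λ L → sumℕ L (λ l → E c l ℤ.* f (suc l))) L≡) (sumℕ-E c (suc n) (λ l → f (suc l))))
                   (≡.trans (cong (λ L → sumℕ L (λ l → E c l ℤ.* f (suc (suc l)))) L′≡) (sumℕ-E c n (λ l → f (suc (suc l))))) ⟩
  pairing c (λ l → f (suc l)) ℤ.+ pairing c (λ l → f (suc (suc l)))  ≡⟨ pairing-+ c (λ l → f (suc l)) (λ l → f (suc (suc l))) ⟨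
  pairing (suc c) f ∎
  where
  L′ = suc (c ℕ.+ suc c) ℕ.+ n
  L = suc L′
  L′≡ : L′ ≡ suc (suc (c ℕ.+ c)) ℕ.+ n
  L′≡ = cong (λ x → suc x ℕ.+ n) (ℕₚ.+-suc c c)
  L≡ : L ≡ suc (suc (c ℕ.+ c)) ℕ.+ suc n
  L≡ = ≡.trans (cong suc L′≡) (≡.sym (ℕₚ.+-suc (suc (suc (c ℕ.+ c))) n))

-- Rows and columns of the diagram are numbered from 0, so L a = λ_{a+1} and M j = μ_{j+1}.
record Conjugate (k : ℕ) (L M : ℕ → ℕ) : Set where
  field
    antitone : ∀ {a b} → a ℕ.≤ b → L b ℕ.≤ L a
    L≤k      : ∀ a → L a ℕ.≤ k
    Lk≡0     : L k ≡ 0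
    transposed : ∀ {a j} → j ℕ.< L a → a ℕ.< M j
    transposed⁻¹ : ∀ {a j} → a ℕ.< M j → j ℕ.< L a

-- The sets { N a ∣ a < k } and { Nᶜ j ∣ j < k } are complementary in { 0, …, 2k - 1 }.  A signed
-- unit row for each N a on top of rows 0, …, k - 1 of E is expanded along the unit rows while
-- the boundary path of the diagram is followed from its end.
module Complement {k L M} (dual : Conjugate k L M) where

  open Conjugate dual

  N Nᶜ : ℕ → ℕ
  N a = (k ℕ.+ a) ℕ.∸ L a
  Nᶜ j = (k ℕ.∸ suc j) ℕ.+ M j

  -- The largest N comes first, so the columns already removed lie to the right of `N a`. Its unit
  -- therefore still stands in position `N a`, with cofactor sign `sgn (N a)`, which the sign in the
  -- row cancels. Only the rows of `E` need γ, which sends the position of a surviving column to its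
  -- original index.
  stack : ℕ → (ℕ → ℕ) → ℕ → ℕ → ℤ
  stack zero    γ i       p = E i (γ p)
  stack (suc a) γ zero    p = sgn (N a) ℤ.* δℕ (N a) p
  stack (suc a) γ (suc i) p = stack a γ i p

  stack-top : ∀ a γ i p → i ℕ.< a → stack a γ i p ≡ sgn (N (a ℕ.∸ suc i)) ℤ.* δℕ (N (a ℕ.∸ suc i)) p
  stack-top (suc a) γ zero    p _           = ≡.refl
  stack-top (suc a) γ (suc i) p (ℕ.s≤s i<a) = stack-top a γ i p i<a

  stack-bottom : ∀ a γ i p → stack a γ (a ℕ.+ i) p ≡ E i (γ p)
  stack-bottom zero    γ i p = ≡.refl
  stack-bottom (suc a) γ i p = stack-bottom a γ i p

  stack-cong : ∀ a {γ γ′} i p → γ p ≡ γ′ p → stack a γ i p ≡ stack a γ′ i p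
  stack-cong zero    i       p eq = cong (E i) eq
  stack-cong (suc a) zero    p eq = ≡.refl
  stack-cong (suc a) (suc i) p eq = stack-cong a i p eq

  -- Deleting column q moves only the columns beyond it, and the remaining units lie before it, so γ
  -- alone has to be adjusted.
  stack-skip : ∀ a {γ γ′} q i p → (∀ r → r ℕ.< a → N r ℕ.< q) → γ (skip q p) ≡ γ′ p →
               stack a γ i (skip q p) ≡ stack a γ′ i p
  stack-skip zero    q i       p N<q eq = cong (E i) eq
  stack-skip (suc a) q zero    p N<q eq = cong (sgn (N a) ℤ.*_) unit
    where
    N<q′ = N<q a ℕₚ.≤-refl
    unit : δℕ (N a) (skip q p) ≡ δℕ (N a) p
    unit with p ℕ.<? q
    ... | yes p<q = cong (δℕ (N a)) (skip-< p<q)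
    ... | no  p≮q = ≡.trans
      (δℕ-≢ (N a) (skip q p) (λ eq → ℕₚ.<⇒≢ (ℕₚ.<-≤-trans N<q′ (ℕₚ.≤-trans q≤p (ℕₚ.n≤1+n p))) (≡.trans eq (skip-≥ q≤p))))
      (≡.sym (δℕ-≢ (N a) p (ℕₚ.<⇒≢ (ℕₚ.<-≤-trans N<q′ q≤p))))
      where q≤p = ℕₚ.≮⇒≥ p≮q
  stack-skip (suc a) q (suc i) p N<q eq = stack-skip a q i p (λ r r<a → N<q r (ℕₚ.<-trans r<a (ℕₚ.n<1+n a))) eq

  N-mono : ∀ {r a} → r ℕ.< a → N r ℕ.< N a
  N-mono {r} {a} r<a = ℕₚ.≤-<-trans
    (ℕₚ.∸-monoʳ-≤ (k ℕ.+ r) (antitone (ℕₚ.<⇒≤ r<a)))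
    (ℕₚ.∸-monoˡ-< (ℕₚ.+-monoʳ-< k r<a) (ℕₚ.≤-trans (L≤k a) (ℕₚ.m≤m+n k r)))

  -- The state of the walk: of the a + k columns left, the first a + b are undecided and still in
  -- place, and the last k - b have been recognised as the values of `Nᶜ` at k - b - 1, ..., 0.
  columns : ℕ → ℕ → ℕ → ℕ
  columns a b p = if ⌊ p ℕ.<? a ℕ.+ b ⌋ then p else Nᶜ (k ℕ.+ a ℕ.∸ suc p)

  columns-< : ∀ {a b p} → p ℕ.< a ℕ.+ b → columns a b p ≡ p
  columns-< {a} {b} {p} p< with p ℕ.<? a ℕ.+ b
  ... | yes _  = ≡.refl
  ... | no  p≮ = ⊥-elim (p≮ p<)

  columns-≥ : ∀ {a b p} → a ℕ.+ b ℕ.≤ p → columns a b p ≡ Nᶜ (k ℕ.+ a ℕ.∸ suc p)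
  columns-≥ {a} {b} {p} p≥ with p ℕ.<? a ℕ.+ b
  ... | yes p< = ⊥-elim (ℕₚ.<⇒≱ p< p≥)
  ... | no  _  = ≡.refl

  columns-skip : ∀ a b p → columns (suc a) b (skip (a ℕ.+ b) p) ≡ columns a b p
  columns-skip a b p with p ℕ.<? a ℕ.+ b
  ... | yes p< rewrite skip-< p< = columns-< {suc a} {b} (ℕₚ.m<n⇒m<1+n p<)
  ... | no  p≮ rewrite skip-≥ (ℕₚ.≮⇒≥ p≮) | columns-≥ {suc a} {b} (ℕ.s≤s (ℕₚ.≮⇒≥ p≮)) | ℕₚ.+-suc k a = ≡.refl

  columns-step : ∀ a b p → Nᶜ (k ℕ.∸ suc b) ≡ a ℕ.+ b → columns a (suc b) p ≡ columns a b p
  columns-step a b p eq with ℕₚ.<-cmp p (a ℕ.+ b)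
  ... | tri< p< _ _ = ≡.trans (columns-< {a} {suc b} (ℕₚ.<-trans p< (ℕₚ.+-monoʳ-< a (ℕₚ.n<1+n b)))) (≡.sym (columns-< {a} {b} p<))
  ... | tri> _ _ p> = ≡.trans (columns-≥ {a} {suc b} (ℕₚ.≤-trans (ℕₚ.≤-reflexive (ℕₚ.+-suc a b)) p>)) (≡.sym (columns-≥ {a} {b} (ℕₚ.<⇒≤ p>)))
  ... | tri≈ _ ≡.refl _ = ≡.trans (columns-< {a} {suc b} (ℕₚ.+-monoʳ-< a (ℕₚ.n<1+n b)))
    (≡.sym (≡.trans (columns-≥ {a} {b} ℕₚ.≤-refl) (≡.trans (cong Nᶜ index) eq)))
    where
    index : k ℕ.+ a ℕ.∸ suc (a ℕ.+ b) ≡ k ℕ.∸ suc b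
    index = ≡.trans (cong₂ ℕ._∸_ (ℕₚ.+-comm k a) (≡.sym (ℕₚ.+-suc a b))) (ℕₚ.[m+n]∸[m+o]≡n∸o a k (suc b))

  -- Together with L a + b ≤ k this says L a ≤ k - b ≤ L (a - 1): the corner at row a and column k -
  -- b lies on the boundary path. For a = 0 no row above limits it.
  LastRow : ℕ → ℕ → Set
  LastRow zero    b = ⊤
  LastRow (suc a) b = k ℕ.≤ L a ℕ.+ b

  Minor : ℤ
  Minor = detℕ k (λ i p → E i (Nᶜ (k ℕ.∸ suc p)))

  -- Column k - b - 1 of the diagram has exactly a cells, since row a does not reach it and M is at
  -- least a there.
  Nᶜ-step : ∀ a b → suc b ℕ.≤ k → a ℕ.≤ M (k ℕ.∸ suc b) → L a ℕ.+ suc b ℕ.≤ k →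
           Nᶜ (k ℕ.∸ suc b) ≡ a ℕ.+ b
  Nᶜ-step a b b<k a≤M La = ≡.trans (cong₂ ℕ._+_ first (ℕₚ.≤-antisym M≤a a≤M)) (ℕₚ.+-comm b a)
    where
    j = k ℕ.∸ suc b
    first : k ℕ.∸ suc j ≡ b
    first = ≡.trans (cong (k ℕ.∸_) (≡.sym (ℕₚ.+-∸-assoc 1 b<k))) (ℕₚ.m∸[m∸n]≡n (ℕₚ.<⇒≤ b<k))
    M≤a : M j ℕ.≤ a
    M≤a = ℕₚ.≮⇒≥ λ a<M → ℕₚ.<⇒≱ (transposed⁻¹ a<M) (ℕₚ.m+n≤o⇒m≤o∸n (L a) La)

  -- With `suc a` unit rows left, the last undecided column is a + b. If row a ends exactly at k -
  -- b, this column is `N a` and disappears with its unit row. Otherwise row a is longer, the path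
  -- takes a step in the other direction, and `skip-column` assigns the column to the minor.
  along-path : ∀ a b → b ℕ.≤ k → LastRow a b → L a ℕ.+ b ℕ.≤ k →
               detℕ (a ℕ.+ k) (stack a (columns a b)) ≡ Minor
  skip-column : ∀ a b → suc b ℕ.≤ k → LastRow a b → a ℕ.≤ M (k ℕ.∸ suc b) → L a ℕ.+ suc b ℕ.≤ k →
                detℕ (a ℕ.+ k) (stack a (columns a (suc b))) ≡ Minor

  skip-column a b b<k last a≤M La = ≡.trans
    (detℕ-cong (a ℕ.+ k) λ i p _ _ → stack-cong a i p
      (columns-step a b p (Nᶜ-step a b b<k a≤M La)))
    (along-path a b (ℕₚ.<⇒≤ b<k) last (ℕₚ.≤-trans (ℕₚ.+-monoʳ-≤ (L a) (ℕₚ.n≤1+n b)) La))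

  along-path zero    zero    _   _    _  = detℕ-cong k λ i p _ _ →
    cong (E i) (≡.trans (columns-≥ {0} {0} ℕ.z≤n) (cong (λ x → Nᶜ (x ℕ.∸ suc p)) (ℕₚ.+-identityʳ k)))
  along-path zero    (suc b) b<k last La = skip-column zero b b<k last ℕ.z≤n La
  along-path (suc a) b b≤k last La with k ℕ.≟ L a ℕ.+ b
  -- At b = 0 only equality is possible, because no row is longer than k.
  along-path (suc a) zero    b≤k last La | no k≢ =
    ⊥-elim (k≢ (ℕₚ.≤-antisym last (ℕₚ.≤-trans (ℕₚ.≤-reflexive (ℕₚ.+-identityʳ (L a))) (L≤k a))))
  along-path (suc a) (suc b) b<k last La | no k≢ = skip-column (suc a) b b<k
    (ℕₚ.≤-pred (ℕₚ.≤-trans k< (ℕₚ.≤-reflexive (ℕₚ.+-suc (L a) b))))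
    (transposed (ℕₚ.+-cancelʳ-< (suc b) _ _ (ℕₚ.≤-<-trans (ℕₚ.≤-reflexive (ℕₚ.m∸n+n≡m b<k)) k<)))
    La
    where k< = ℕₚ.≤∧≢⇒< last k≢
  along-path (suc a) b b≤k last La | yes k≡ = begin
    detℕ (suc a ℕ.+ k) (stack (suc a) γ)
      ≡⟨ detℕ-single (a ℕ.+ k) (stack (suc a) γ) q (ℕ.s≤s (ℕₚ.+-monoʳ-≤ a b≤k)) (λ p p≢q →
           ≡.trans (cong (sgn (N a) ℤ.*_) (δℕ-≢ (N a) p (λ eq → p≢q (≡.trans (≡.sym eq) N≡q)))) (ℤₚ.*-zeroʳ (sgn (N a)))) ⟩
    sgn q ℤ.* (sgn (N a) ℤ.* δℕ (N a) q ℤ.* detℕ (a ℕ.+ k) (λ i p → stack a γ i (skip q p)))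
      ≡⟨ cong (λ x → sgn q ℤ.* (sgn x ℤ.* δℕ x q ℤ.* detℕ (a ℕ.+ k) (λ i p → stack a γ i (skip q p)))) N≡q ⟩
    sgn q ℤ.* (sgn q ℤ.* δℕ q q ℤ.* detℕ (a ℕ.+ k) (λ i p → stack a γ i (skip q p)))
      ≡⟨ cong₂ (λ x y → sgn q ℤ.* (sgn q ℤ.* x ℤ.* y)) (δℕ-refl q) (detℕ-cong (a ℕ.+ k) λ i p _ _ →
           stack-skip a q i p (λ r r<a → ℕₚ.<-≤-trans (N-mono r<a) (ℕₚ.≤-reflexive N≡q)) (columns-skip a b p)) ⟩
    sgn q ℤ.* (sgn q ℤ.* + 1 ℤ.* detℕ (a ℕ.+ k) (stack a (columns a b)))
      ≡⟨ sign-cancels (sgn q) (detℕ (a ℕ.+ k) (stack a (columns a b))) (D-ℤ.sgn²≈1 q) ⟩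
    detℕ (a ℕ.+ k) (stack a (columns a b))
      ≡⟨ along-path a b b≤k (previous a k≡) (ℕₚ.≤-reflexive (≡.sym k≡)) ⟩
    Minor ∎
    where
    γ = columns (suc a) b
    q = a ℕ.+ b
    N≡q : N a ≡ q
    N≡q = begin
      k ℕ.+ a ℕ.∸ L a             ≡⟨ cong (λ x → x ℕ.+ a ℕ.∸ L a) k≡ ⟩
      L a ℕ.+ b ℕ.+ a ℕ.∸ L a     ≡⟨ cong (ℕ._∸ L a) (ℕₚ.+-assoc (L a) b a) ⟩
      L a ℕ.+ (b ℕ.+ a) ℕ.∸ L a   ≡⟨ ℕₚ.m+n∸m≡n (L a) (b ℕ.+ a) ⟩
      b ℕ.+ a                     ≡⟨ ℕₚ.+-comm b a ⟩
      q                           ∎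
    previous : ∀ a → k ≡ L a ℕ.+ b → LastRow a b
    previous zero    _  = _
    previous (suc a) eq = ℕₚ.≤-trans (ℕₚ.≤-reflexive eq) (ℕₚ.+-monoˡ-≤ b (antitone (ℕₚ.n≤1+n a)))
    sign-cancels : ∀ s d → s ℤ.* s ≡ + 1 → s ℤ.* (s ℤ.* + 1 ℤ.* d) ≡ d
    sign-cancels s d eq = begin
      s ℤ.* (s ℤ.* + 1 ℤ.* d)  ≡⟨ cong (λ x → s ℤ.* (x ℤ.* d)) (ℤₚ.*-identityʳ s) ⟩
      s ℤ.* (s ℤ.* d)          ≡⟨ ℤₚ.*-assoc s s d ⟨
      s ℤ.* s ℤ.* d            ≡⟨ cong (ℤ._* d) eq ⟩
      + 1 ℤ.* d                ≡⟨ ℤₚ.*-identityˡ d ⟩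
      d                        ∎

  Z : ℕ → ℕ → ℤ
  Z = stack k id

  det-Z : detℕ (k ℕ.+ k) Z ≡ Minor
  det-Z = ≡.trans
    (detℕ-cong (k ℕ.+ k) λ i p _ p< → stack-cong k i p (≡.sym (columns-< {k} {k} p<)))
    (along-path k k ℕₚ.≤-refl (start k) (ℕₚ.≤-reflexive (cong (ℕ._+ k) Lk≡0)))
    where
    start : ∀ a → LastRow a k
    start zero    = _
    start (suc a) = ℕₚ.m≤n+m k (L a)

  N<2k : ∀ {a} → a ℕ.< k → N a ℕ.< k ℕ.+ k
  N<2k {a} a<k = ℕₚ.≤-<-trans (ℕₚ.m∸n≤m (k ℕ.+ a) (L a)) (ℕₚ.+-monoʳ-< k a<k)

  -- If the left half of B is annihilated by the rows of E, then Z B is block triangular.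
  Minor-* : ∀ (B : ℕ → ℕ → ℤ) → (∀ c p → c ℕ.< k → p ℕ.< k → pairing c (λ l → B l p) ≡ + 0) →
    Minor ℤ.* detℕ (k ℕ.+ k) B ≡
    detℕ k (λ i p → sgn (N (k ℕ.∸ suc i)) ℤ.* B (N (k ℕ.∸ suc i)) p) ℤ.*
    detℕ k (λ c p → pairing c (λ l → B l (k ℕ.+ p)))
  Minor-* B vanishes = begin
    Minor ℤ.* detℕ (k ℕ.+ k) B                    ≡⟨ cong (ℤ._* detℕ (k ℕ.+ k) B) det-Z ⟨
    detℕ (k ℕ.+ k) Z ℤ.* detℕ (k ℕ.+ k) B         ≡⟨ detℕ-* (k ℕ.+ k) Z B ⟨
    detℕ (k ℕ.+ k) ZB
      ≡⟨ detℕ-block-upper k k ZB (λ c p c<k p<k → ≡.trans (bottom c p c<k) (vanishes c p c<k p<k)) ⟩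
    detℕ k ZB ℤ.* detℕ k (λ c p → ZB (k ℕ.+ c) (k ℕ.+ p))
      ≡⟨ cong₂ ℤ._*_ (detℕ-cong k λ i p i<k _ → top i p i<k) (detℕ-cong k λ c p c<k _ → bottom c (k ℕ.+ p) c<k) ⟩
    detℕ k (λ i p → sgn (N (k ℕ.∸ suc i)) ℤ.* B (N (k ℕ.∸ suc i)) p) ℤ.*
    detℕ k (λ c p → pairing c (λ l → B l (k ℕ.+ p))) ∎
    where
    ZB : ℕ → ℕ → ℤ
    ZB i p = sumℕ (k ℕ.+ k) (λ l → Z i l ℤ.* B l p)
    bottom : ∀ c p → c ℕ.< k → ZB (k ℕ.+ c) p ≡ pairing c (λ l → B l p)
    bottom c p c<k = begin
      ZB (k ℕ.+ c) p
        ≡⟨ sumℕ-cong (k ℕ.+ k) (λ l → cong (ℤ._* B l p) (stack-bottom k id c l)) ⟩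
      sumℕ (k ℕ.+ k) (λ l → E c l ℤ.* B l p)
        ≡⟨ cong (λ n → sumℕ n (λ l → E c l ℤ.* B l p)) (ℕₚ.m+[n∸m]≡n {suc (suc (c ℕ.+ c))} {k ℕ.+ k} bound) ⟨
      sumℕ (suc (suc (c ℕ.+ c)) ℕ.+ (k ℕ.+ k ℕ.∸ suc (suc (c ℕ.+ c)))) (λ l → E c l ℤ.* B l p)
        ≡⟨ sumℕ-E c (k ℕ.+ k ℕ.∸ suc (suc (c ℕ.+ c))) (λ l → B l p) ⟩
      pairing c (λ l → B l p) ∎
      where
      bound : suc (suc (c ℕ.+ c)) ℕ.≤ k ℕ.+ k
      bound = ℕₚ.≤-trans (ℕₚ.≤-reflexive (cong suc (≡.sym (ℕₚ.+-suc c c)))) (ℕₚ.+-mono-≤ c<k c<k)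
    top : ∀ i p → i ℕ.< k → ZB i p ≡ sgn (N (k ℕ.∸ suc i)) ℤ.* B (N (k ℕ.∸ suc i)) p
    top i p i<k = begin
      ZB i p
        ≡⟨ sumℕ-cong (k ℕ.+ k) (λ l → ≡.trans (cong (ℤ._* B l p) (stack-top k id i l i<k)) (reorder (sgn n) (δℕ n l) (B l p))) ⟩
      sumℕ (k ℕ.+ k) (λ l → δℕ n l ℤ.* (sgn n ℤ.* B l p))
        ≡⟨ sumℕ-δ (k ℕ.+ k) n (λ l → sgn n ℤ.* B l p) (N<2k (ℕₚ.∸-monoʳ-< {k} (ℕ.s≤s ℕ.z≤n) i<k)) ⟩
      sgn n ℤ.* B n p ∎
      where
      n = N (k ℕ.∸ suc i)
      reorder : ∀ a b c → a ℤ.* b ℤ.* c ≡ b ℤ.* (a ℤ.* c)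
      reorder = solve-∀

-- The coefficient of y^M in y^N (1 - y)^(-M-1). Writing the difference M - N as a shift makes it
-- vanish for N > M.
H : ℕ → ℕ → ℤ
H N M = shiftⁿ N (λ a → Γ a M) M

shiftⁿ-below : ∀ s (f : Series) n → n ℕ.< s → shiftⁿ s f n ≡ + 0
shiftⁿ-below (suc s) f zero    _           = ≡.refl
shiftⁿ-below (suc s) f (suc n) (ℕ.s≤s n<s) = shiftⁿ-below s f n n<s

shiftⁿ-diagonal : ∀ s (f : Series) → shiftⁿ s f s ≡ f 0
shiftⁿ-diagonal zero    f = ≡.refl
shiftⁿ-diagonal (suc s) f = shiftⁿ-diagonal s f

Γ-sym : ∀ a b → Γ a b ≡ Γ b a
Γ-sym zero    zero    = ≡.refl
Γ-sym zero    (suc b) = ≡.refl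
Γ-sym (suc a) zero    = ≡.refl
Γ-sym (suc a) (suc b) = ≡.trans (cong₂ ℤ._+_ (Γ-sym a (suc b)) (Γ-sym (suc a) b))
  (ℤₚ.+-comm (Γ (suc b) a) (Γ b (suc a)))

pairing-zero : ∀ c (f : Series) → (∀ n → f n ≡ + 0) → pairing c f ≡ + 0
pairing-zero c f eq = ≡.trans (pairing-cong c eq) (pairing-* c (+ 0) (λ _ → + 0))

-- The pairing substitutes z = -y in `E c` and yields, up to the sign (-1)^c, the residue of
-- q^(c-M-1) dq for q = y - y². The induction expresses this without residues: lowering c and M
-- together cancels one factor q, by `shiftⁿ-Γ-difference`.
pairing-H : ∀ c M → pairing c (λ n → sgn n ℤ.* H n M) ≡ sgn M ℤ.* δℕ c M
pairing-H zero    zero    = ≡.refl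
pairing-H zero    (suc M) = begin
  + 1 ℤ.* (x ℤ.+ Γ (suc M) M) ℤ.+ + 2 ℤ.* (ℤ.-[1+ 0 ] ℤ.* x)
    -- The central binomial coefficient is the sum of two equal neighbours, so it cancels against
    -- the term with factor 2.
    ≡⟨ cong (λ y → + 1 ℤ.* (x ℤ.+ y) ℤ.+ + 2 ℤ.* (ℤ.-[1+ 0 ] ℤ.* x)) (Γ-sym (suc M) M) ⟩
  + 1 ℤ.* (x ℤ.+ x) ℤ.+ + 2 ℤ.* (ℤ.-[1+ 0 ] ℤ.* x)  ≡⟨ cancel x (sgn (suc M)) ⟩
  sgn (suc M) ℤ.* + 0 ∎
  where
  x = Γ M (suc M)
  cancel : ∀ x s → + 1 ℤ.* (x ℤ.+ x) ℤ.+ + 2 ℤ.* (ℤ.-[1+ 0 ] ℤ.* x) ≡ s ℤ.* + 0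
  cancel = solve-∀
pairing-H (suc c) zero    = pairing-zero c _ λ n → cong₂ ℤ._+_ (ℤₚ.*-zeroʳ (sgn (suc n))) (ℤₚ.*-zeroʳ (sgn (suc (suc n))))
pairing-H (suc c) (suc M) = begin
  pairing c (λ n → sgn (suc n) ℤ.* H (suc n) (suc M) ℤ.+ sgn (suc (suc n)) ℤ.* H (suc (suc n)) (suc M))
    ≡⟨ pairing-cong c (λ n → pascal n) ⟩
  pairing c (λ n → ℤ.-[1+ 0 ] ℤ.* (sgn n ℤ.* H n M))  ≡⟨ pairing-* c ℤ.-[1+ 0 ] (λ n → sgn n ℤ.* H n M) ⟩
  ℤ.-[1+ 0 ] ℤ.* pairing c (λ n → sgn n ℤ.* H n M)    ≡⟨ cong (ℤ._*_ ℤ.-[1+ 0 ]) (pairing-H c M) ⟩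
  ℤ.-[1+ 0 ] ℤ.* (sgn M ℤ.* δℕ c M)                   ≡⟨ neg (sgn M) (δℕ c M) ⟩
  sgn (suc M) ℤ.* δℕ c M                              ∎
  where
  neg : ∀ s d → ℤ.-[1+ 0 ] ℤ.* (s ℤ.* d) ≡ ℤ.- s ℤ.* d
  neg = solve-∀
  pascal : ∀ n → sgn (suc n) ℤ.* H (suc n) (suc M) ℤ.+ sgn (suc (suc n)) ℤ.* H (suc (suc n)) (suc M) ≡
                 ℤ.-[1+ 0 ] ℤ.* (sgn n ℤ.* H n M)
  pascal n = ≡.trans (collect (sgn n) (H (suc n) (suc M)) (H (suc (suc n)) (suc M)))
    (cong (λ x → ℤ.-[1+ 0 ] ℤ.* (sgn n ℤ.* x)) (shiftⁿ-Γ-difference M n M))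
    where
    collect : ∀ s x y → ℤ.- s ℤ.* x ℤ.+ ℤ.- (ℤ.- s) ℤ.* y ≡ ℤ.-[1+ 0 ] ℤ.* (s ℤ.* (x ℤ.+ ℤ.- y))
    collect = solve-∀

glue : ∀ {A : Set} → ℕ → (ℕ → A) → (ℕ → A) → ℕ → A
glue k f g p = if ⌊ p ℕ.<? k ⌋ then f p else g (p ℕ.∸ k)

glue-< : ∀ {A : Set} k (f g : ℕ → A) {p} → p ℕ.< k → glue k f g p ≡ f p
glue-< k f g {p} p<k with p ℕ.<? k
... | yes _   = ≡.refl
... | no  p≮k = ⊥-elim (p≮k p<k)

glue-+ : ∀ {A : Set} k (f g : ℕ → A) p → glue k f g (k ℕ.+ p) ≡ g p
glue-+ k f g p with k ℕ.+ p ℕ.<? k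
... | yes kp<k = ⊥-elim (ℕₚ.m+n≮m k p kp<k)
... | no  _    = cong g (ℕₚ.m+n∸m≡n k p)

sgn-sgn : ∀ n x → sgn n ℤ.* (sgn n ℤ.* x) ≡ x
sgn-sgn n x = ≡.trans (≡.sym (ℤₚ.*-assoc (sgn n) (sgn n) x))
  (≡.trans (cong (ℤ._* x) (sgn²≈1 n)) (ℤₚ.*-identityˡ x))

detℕ-δ : ∀ n → detℕ n δℕ ≡ + 1
detℕ-δ n = ≡.trans (detℕ-lower-triangular n δℕ λ i j i<j _ → δℕ-≢ i j (ℕₚ.<⇒≢ i<j))
  (∏ℕ-one n (λ i → δℕ i i) λ i _ → δℕ-refl i)

reverse² : ∀ {k p} → p ℕ.< k → k ℕ.∸ suc (k ℕ.∸ suc p) ≡ p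
reverse² {k} {p} p<k = ≡.trans (cong (k ℕ.∸_) (≡.sym (ℕₚ.+-∸-assoc 1 p<k))) (ℕₚ.m∸[m∸n]≡n (ℕₚ.<⇒≤ p<k))

empty-diagram : ∀ k → Conjugate k (λ _ → 0) (λ _ → 0)
empty-diagram k = record
  { antitone = λ _ → ℕ.z≤n ; L≤k = λ _ → ℕ.z≤n ; Lk≡0 = ≡.refl
  ; transposed = λ () ; transposed⁻¹ = λ () }

module _ (k : ℕ) where

  -- The left columns are the functionals with M = 2k - 1, ..., k, which annihilate `E 0`, ...,
  -- `E (k - 1)`. The right ones have M = 0, ..., k - 1, with signs that make their pairings exactly
  -- the identity matrix.
  Ĥ : ℕ → ℕ → ℤ
  Ĥ l = glue k (λ p → sgn l ℤ.* H l (k ℕ.+ k ℕ.∸ suc p)) (λ M → sgn M ℤ.* (sgn l ℤ.* H l M))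

  Ĥ-left : ∀ l p → p ℕ.< k → Ĥ l p ≡ sgn l ℤ.* H l (k ℕ.+ k ℕ.∸ suc p)
  Ĥ-left l p = glue-< k (λ p → sgn l ℤ.* H l (k ℕ.+ k ℕ.∸ suc p)) (λ M → sgn M ℤ.* (sgn l ℤ.* H l M))

  Ĥ-right : ∀ l p → Ĥ l (k ℕ.+ p) ≡ sgn p ℤ.* (sgn l ℤ.* H l p)
  Ĥ-right l = glue-+ k (λ p → sgn l ℤ.* H l (k ℕ.+ k ℕ.∸ suc p)) (λ M → sgn M ℤ.* (sgn l ℤ.* H l M))

  H-det : ∀ {L M} → Conjugate k L M → ℤ
  H-det c = detℕ k (λ i p → H (N (k ℕ.∸ suc i)) (k ℕ.+ k ℕ.∸ suc p))
    where open Complement c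

  Minor-*-Ĥ : ∀ {L M} (c : Conjugate k L M) → Complement.Minor c ℤ.* detℕ (k ℕ.+ k) Ĥ ≡ H-det c
  Minor-*-Ĥ dual = begin
    Minor ℤ.* detℕ (k ℕ.+ k) Ĥ   ≡⟨ Minor-* Ĥ left ⟩
    detℕ k (λ i p → sgn (N (k ℕ.∸ suc i)) ℤ.* Ĥ (N (k ℕ.∸ suc i)) p) ℤ.* detℕ k (λ c p → pairing c (λ l → Ĥ l (k ℕ.+ p)))
      ≡⟨ cong₂ ℤ._*_ (detℕ-cong k {h = λ i p → H (N (k ℕ.∸ suc i)) (k ℕ.+ k ℕ.∸ suc p)} λ i p _ p<k → top (N (k ℕ.∸ suc i)) p p<k)
                     (≡.trans (detℕ-cong k λ c p _ _ → right c p) (detℕ-δ k)) ⟩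
    H-det dual ℤ.* + 1           ≡⟨ ℤₚ.*-identityʳ _ ⟩
    H-det dual                   ∎
    where
    open Complement dual
    top : ∀ l p → p ℕ.< k → sgn l ℤ.* Ĥ l p ≡ H l (k ℕ.+ k ℕ.∸ suc p)
    top l p p<k = ≡.trans (cong (sgn l ℤ.*_) (Ĥ-left l p p<k)) (sgn-sgn l _)
    left : ∀ c p → c ℕ.< k → p ℕ.< k → pairing c (λ l → Ĥ l p) ≡ + 0
    left c p c<k p<k = begin
      pairing c (λ l → Ĥ l p)           ≡⟨ pairing-cong c (λ l → Ĥ-left l p p<k) ⟩
      pairing c (λ l → sgn l ℤ.* H l m) ≡⟨ pairing-H c m ⟩
      sgn m ℤ.* δℕ c m                  ≡⟨ cong (sgn m ℤ.*_) (δℕ-≢ c m (ℕₚ.<⇒≢ (ℕₚ.<-≤-trans c<k k≤m))) ⟩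
      sgn m ℤ.* + 0                     ≡⟨ ℤₚ.*-zeroʳ (sgn m) ⟩
      + 0                               ∎
      where
      m = k ℕ.+ k ℕ.∸ suc p
      k≤m : k ℕ.≤ m
      k≤m = ℕₚ.≤-trans (ℕₚ.m≤m+n k (k ℕ.∸ suc p)) (ℕₚ.≤-reflexive (≡.sym (ℕₚ.+-∸-assoc k p<k)))
    right : ∀ c p → pairing c (λ l → Ĥ l (k ℕ.+ p)) ≡ δℕ c p
    right c p = begin
      pairing c (λ l → Ĥ l (k ℕ.+ p))                    ≡⟨ pairing-cong c (λ l → Ĥ-right l p) ⟩
      pairing c (λ l → sgn p ℤ.* (sgn l ℤ.* H l p))      ≡⟨ pairing-* c (sgn p) (λ l → sgn l ℤ.* H l p) ⟩
      sgn p ℤ.* pairing c (λ l → sgn l ℤ.* H l p)        ≡⟨ cong (sgn p ℤ.*_) (pairing-H c p) ⟩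
      sgn p ℤ.* (sgn p ℤ.* δℕ c p)                       ≡⟨ sgn-sgn p _ ⟩
      δℕ c p                                             ∎

  -- The determinant of Ĥ does not depend on the diagram, so it can be read off the empty one.
  det-Ĥ : detℕ (k ℕ.+ k) Ĥ ≡ + 1
  det-Ĥ = begin
    detℕ (k ℕ.+ k) Ĥ                 ≡⟨ ℤₚ.*-identityˡ _ ⟨
    + 1 ℤ.* detℕ (k ℕ.+ k) Ĥ         ≡⟨ cong (ℤ._* detℕ (k ℕ.+ k) Ĥ) minor≡1 ⟨
    Minor ℤ.* detℕ (k ℕ.+ k) Ĥ       ≡⟨ Minor-*-Ĥ (empty-diagram k) ⟩
    H-det (empty-diagram k)          ≡⟨ H-det≡1 ⟩
    + 1                              ∎
    where
    open Complement (empty-diagram k)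
    minor≡1 : Minor ≡ + 1
    minor≡1 = begin
      Minor  ≡⟨ detℕ-cong k (λ i p _ p<k → cong (E i) (≡.trans (ℕₚ.+-identityʳ _) (reverse² p<k))) ⟩
      detℕ k E                  ≡⟨ detℕ-transpose k E ⟨
      detℕ k (λ i j → E j i)    ≡⟨ detℕ-lower-triangular k (λ i j → E j i) (λ i j i<j _ → E-below j i i<j) ⟩
      ∏ℕ k (λ i → E i i)        ≡⟨ ∏ℕ-one k (λ i → E i i) (λ i _ → E-diagonal i) ⟩
      + 1                       ∎
    H-det≡1 : H-det (empty-diagram k) ≡ + 1
    H-det≡1 = begin
      H-det (empty-diagram k)
        ≡⟨ detℕ-cong k (λ i p i<k _ → cong (λ x → H x (k ℕ.+ k ℕ.∸ suc p)) (≡.sym (ℕₚ.+-∸-assoc k i<k))) ⟩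
      detℕ k g                   ≡⟨ detℕ-lower-triangular k g (λ i j i<j j<k → shiftⁿ-below (k ℕ.+ k ℕ.∸ suc i) (λ a → Γ a (k ℕ.+ k ℕ.∸ suc j)) _
                                      (ℕₚ.∸-monoʳ-< {k ℕ.+ k} (ℕ.s≤s i<j) (ℕₚ.≤-trans j<k (ℕₚ.m≤m+n k k)))) ⟩
      ∏ℕ k (λ i → g i i)         ≡⟨ ∏ℕ-one k (λ i → g i i) (λ i _ → shiftⁿ-diagonal (k ℕ.+ k ℕ.∸ suc i) (λ a → Γ a (k ℕ.+ k ℕ.∸ suc i))) ⟩
      + 1                        ∎
      where g = λ i j → H (k ℕ.+ k ℕ.∸ suc i) (k ℕ.+ k ℕ.∸ suc j)

  Minor≡H-det : ∀ {L M} (c : Conjugate k L M) → Complement.Minor c ≡ H-det c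
  Minor≡H-det c = begin
    Minor                       ≡⟨ ℤₚ.*-identityʳ Minor ⟨
    Minor ℤ.* + 1               ≡⟨ cong (Minor ℤ.*_) det-Ĥ ⟨
    Minor ℤ.* detℕ (k ℕ.+ k) Ĥ  ≡⟨ Minor-*-Ĥ c ⟩
    H-det c                     ∎
    where open Complement c using (Minor)

-- Binomial determinants

double : ℕ → ℕ
double zero    = zero
double (suc n) = suc (suc (double n))

2^ : ℕ → ℤ
2^ n = + (2 ℕ.^ n)

2^-suc : ∀ n → 2^ (suc n) ≡ + 2 ℤ.* 2^ n
2^-suc n = ℤₚ.pos-* 2 (2 ℕ.^ n)

2^-+ : ∀ m n → 2^ (m ℕ.+ n) ≡ 2^ m ℤ.* 2^ n
2^-+ m n = ≡.trans (cong +_ (ℕₚ.^-distribˡ-+-* 2 m n)) (ℤₚ.pos-* (2 ℕ.^ m) (2 ℕ.^ n))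

binomial : ℕ → Series
binomial zero      = constant (+ 1)
binomial (suc n) d = binomial n d ℤ.+ shift (binomial n) d

binomial-above : ∀ n d → n ℕ.< d → binomial n d ≡ + 0
binomial-above zero    (suc d) _           = ≡.refl
binomial-above (suc n) (suc d) (ℕ.s≤s n<d) = cong₂ ℤ._+_ (binomial-above n (suc d) (ℕₚ.<-trans n<d (ℕₚ.n<1+n d))) (binomial-above n d n<d)

binomial-diagonal : ∀ n → binomial n n ≡ + 1
binomial-diagonal zero    = ≡.refl
binomial-diagonal (suc n) = cong₂ ℤ._+_ (binomial-above n (suc n) ℕₚ.≤-refl) (binomial-diagonal n)

-- oddPart c is the coefficient sequence of t (t² - 1)ᶜ; up to a factor this is
-- (1 + 2z)(z + z²)ᶜ at z = -(1 + t)/2.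
oddPart : ℕ → Series
oddPart zero      = X
oddPart (suc c) d = shift (shift (oddPart c)) d ℤ.+ ℤ.- oddPart c d

oddPart-even : ∀ c p → oddPart c (double p) ≡ + 0
oddPart-even zero    zero    = ≡.refl
oddPart-even zero    (suc p) = ≡.refl
oddPart-even (suc c) zero    = cong (λ x → + 0 ℤ.+ ℤ.- x) (oddPart-even c zero)
oddPart-even (suc c) (suc p) = cong₂ (λ x y → x ℤ.+ ℤ.- y) (oddPart-even c p) (oddPart-even c (suc p))

oddPart-above : ∀ c p → c ℕ.< p → oddPart c (suc (double p)) ≡ + 0
oddPart-above zero    (suc p) _           = ≡.refl
oddPart-above (suc c) (suc p) (ℕ.s≤s c<p) =
  cong₂ (λ x y → x ℤ.+ ℤ.- y) (oddPart-above c p c<p) (oddPart-above c (suc p) (ℕₚ.<-trans c<p (ℕₚ.n<1+n p)))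

oddPart-diagonal : ∀ c → oddPart c (suc (double c)) ≡ + 1
oddPart-diagonal zero    = ≡.refl
oddPart-diagonal (suc c) = cong₂ (λ x y → x ℤ.+ ℤ.- y) (oddPart-diagonal c) (oddPart-above c (suc c) ℕₚ.≤-refl)

-- Only the 2c + 2 coefficients of `E c` enter. The bound is what keeps K - l free of truncation
-- when `weighted-step` is applied under the pairing.
pairing-cong-< : ∀ c {f g : Series} → (∀ n → n ℕ.< suc (suc (double c)) → f n ≡ g n) → pairing c f ≡ pairing c g
pairing-cong-< zero    eq = cong₂ (λ x y → x ℤ.+ + 2 ℤ.* y) (eq 0 (ℕ.s≤s ℕ.z≤n)) (eq 1 (ℕ.s≤s (ℕ.s≤s ℕ.z≤n)))
pairing-cong-< (suc c) eq = pairing-cong-< c λ n n< →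
  cong₂ ℤ._+_ (eq (suc n) (ℕ.s≤s (ℕₚ.m<n⇒m<1+n n<))) (eq (suc (suc n)) (ℕ.s≤s (ℕ.s≤s n<)))

-- The weights 2^(K - l) clear the denominators of the substitution z = -(1 + t)/2.
degree : ℕ → ℕ → ℕ
degree zero    e = suc e
degree (suc c) e = suc (suc (degree c e))

degree-bound : ∀ c e n → n ℕ.< suc (suc (double c)) → n ℕ.≤ degree c e
degree-bound zero    e zero       _ = ℕ.z≤n
degree-bound zero    e (suc zero) _ = ℕ.s≤s ℕ.z≤n
degree-bound zero    e (suc (suc n)) (ℕ.s≤s (ℕ.s≤s ()))
degree-bound (suc c) e zero          _ = ℕ.z≤n
degree-bound (suc c) e (suc zero)    _ = ℕ.s≤s ℕ.z≤n
degree-bound (suc c) e (suc (suc n)) (ℕ.s≤s (ℕ.s≤s n<)) = ℕ.s≤s (ℕ.s≤s (degree-bound c e n n<))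

-- For l ≤ K, this is 2^K times the coefficient of t^d in (-(1 + t)/2)^l.
weighted : ℕ → ℕ → Series
weighted K d l = sgn l ℤ.* (2^ (K ℕ.∸ l) ℤ.* binomial l d)

-- At z = -(1 + t)/2 the factor z + z² is (t² - 1)/4, and raising K by two clears the 4.
weighted-step : ∀ K d l → l ℕ.≤ K →
  weighted (suc (suc K)) d (suc l) ℤ.+ weighted (suc (suc K)) d (suc (suc l)) ≡
  sgn l ℤ.* (2^ (K ℕ.∸ l) ℤ.* (shift (shift (binomial l)) d ℤ.+ ℤ.- binomial l d))
weighted-step K d l l≤K = begin
  ℤ.- s ℤ.* (2^ (suc K ℕ.∸ l) ℤ.* (b ℤ.+ b₁)) ℤ.+ ℤ.- (ℤ.- s) ℤ.* (w ℤ.* ((b ℤ.+ b₁) ℤ.+ shift (binomial (suc l)) d))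
    ≡⟨ cong₂ (λ x y → ℤ.- s ℤ.* (x ℤ.* (b ℤ.+ b₁)) ℤ.+ ℤ.- (ℤ.- s) ℤ.* (w ℤ.* ((b ℤ.+ b₁) ℤ.+ y)))
         (≡.trans (cong 2^ (ℕₚ.+-∸-assoc 1 l≤K)) (2^-suc (K ℕ.∸ l))) (shift-binomial d) ⟩
  ℤ.- s ℤ.* (+ 2 ℤ.* w ℤ.* (b ℤ.+ b₁)) ℤ.+ ℤ.- (ℤ.- s) ℤ.* (w ℤ.* ((b ℤ.+ b₁) ℤ.+ (b₁ ℤ.+ b₂)))
    ≡⟨ collect s w b b₁ b₂ ⟩
  s ℤ.* (w ℤ.* (b₂ ℤ.+ ℤ.- b)) ∎
  where
  s  = sgn l
  w  = 2^ (K ℕ.∸ l)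
  b  = binomial l d
  b₁ = shift (binomial l) d
  b₂ = shift (shift (binomial l)) d
  shift-binomial : ∀ d → shift (binomial (suc l)) d ≡ shift (binomial l) d ℤ.+ shift (shift (binomial l)) d
  shift-binomial zero    = ≡.refl
  shift-binomial (suc d) = ≡.refl
  collect : ∀ s w b b₁ b₂ → ℤ.- s ℤ.* (+ 2 ℤ.* w ℤ.* (b ℤ.+ b₁)) ℤ.+ ℤ.- (ℤ.- s) ℤ.* (w ℤ.* ((b ℤ.+ b₁) ℤ.+ (b₁ ℤ.+ b₂))) ≡
            s ℤ.* (w ℤ.* (b₂ ℤ.+ ℤ.- b))
  collect = solve-∀

-- Since 1 + 2z = -t and z + z² = (t² - 1)/4, the series `E c` becomes -t (t² - 1)^c / 4^c. Of the
-- weight 2^(2c+1+e) the denominator uses 2^(2c).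
pairing-weighted : ∀ c e d → pairing c (weighted (degree c e) d) ≡ ℤ.- 2^ (suc e) ℤ.* oddPart c d
pairing-weighted zero    e d = ≡.trans
  (cong (λ x → + 1 ℤ.* (x ℤ.* b) ℤ.+ + 2 ℤ.* (ℤ.-[1+ 0 ] ℤ.* (2^ e ℤ.* (b ℤ.+ b₁)))) (2^-suc e))
  (≡.trans (collect (2^ e) b b₁)
    (cong₂ (λ x y → ℤ.- x ℤ.* y) (≡.sym (2^-suc e)) (shifted d)))
  where
  b  = binomial 0 d
  b₁ = shift (binomial 0) d
  shifted : ∀ d → shift (constant (+ 1)) d ≡ X d
  shifted zero          = ≡.refl
  shifted (suc zero)    = ≡.refl
  shifted (suc (suc d)) = ≡.refl
  collect : ∀ w b b₁ → + 1 ℤ.* (+ 2 ℤ.* w ℤ.* b) ℤ.+ + 2 ℤ.* (ℤ.-[1+ 0 ] ℤ.* (w ℤ.* (b ℤ.+ b₁))) ≡ ℤ.- (+ 2 ℤ.* w) ℤ.* b₁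
  collect = solve-∀
pairing-weighted (suc c) e d = begin
  pairing c (λ l → weighted (suc (suc K)) d (suc l) ℤ.+ weighted (suc (suc K)) d (suc (suc l)))
    ≡⟨ pairing-cong-< c (λ l l< → ≡.trans (weighted-step K d l (degree-bound c e l l<)) (split (sgn l) (2^ (K ℕ.∸ l)) _ (binomial l d))) ⟩
  pairing c (λ l → shifted d l ℤ.+ ℤ.-[1+ 0 ] ℤ.* weighted K d l)
    ≡⟨ pairing-+ c (shifted d) (λ l → ℤ.-[1+ 0 ] ℤ.* weighted K d l) ⟩
  pairing c (shifted d) ℤ.+ pairing c (λ l → ℤ.-[1+ 0 ] ℤ.* weighted K d l)
    ≡⟨ cong₂ ℤ._+_ (pairing-shifted d) (≡.trans (pairing-* c ℤ.-[1+ 0 ] (weighted K d)) (cong (ℤ._*_ ℤ.-[1+ 0 ]) (pairing-weighted c e d))) ⟩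
  t ℤ.* shift (shift (oddPart c)) d ℤ.+ ℤ.-[1+ 0 ] ℤ.* (t ℤ.* oddPart c d)
    ≡⟨ collect t _ (oddPart c d) ⟩
  t ℤ.* oddPart (suc c) d ∎
  where
  K = degree c e
  t = ℤ.- 2^ (suc e)
  shifted : ℕ → Series
  shifted d l = sgn l ℤ.* (2^ (K ℕ.∸ l) ℤ.* shift (shift (binomial l)) d)
  split : ∀ s w x y → s ℤ.* (w ℤ.* (x ℤ.+ ℤ.- y)) ≡ s ℤ.* (w ℤ.* x) ℤ.+ ℤ.-[1+ 0 ] ℤ.* (s ℤ.* (w ℤ.* y))
  split = solve-∀
  collect : ∀ t x y → t ℤ.* x ℤ.+ ℤ.-[1+ 0 ] ℤ.* (t ℤ.* y) ≡ t ℤ.* (x ℤ.+ ℤ.- y)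
  collect = solve-∀
  annihilate : ∀ s w → s ℤ.* (w ℤ.* + 0) ≡ + 0
  annihilate = solve-∀
  pairing-shifted : ∀ d → pairing c (shifted d) ≡ t ℤ.* shift (shift (oddPart c)) d
  pairing-shifted zero          = ≡.trans (pairing-zero c (shifted 0) λ l → annihilate (sgn l) (2^ (K ℕ.∸ l))) (≡.sym (ℤₚ.*-zeroʳ t))
  pairing-shifted (suc zero)    = ≡.trans (pairing-zero c (shifted 1) λ l → annihilate (sgn l) (2^ (K ℕ.∸ l))) (≡.sym (ℤₚ.*-zeroʳ t))
  pairing-shifted (suc (suc d)) = pairing-weighted c e d

∏ℕ-cong : ∀ n {f g : Series} → (∀ i → i ℕ.< n → f i ≡ g i) → ∏ℕ n f ≡ ∏ℕ n g
∏ℕ-cong n eq = ℤ-Sum.∏-cong {n} λ i → eq (toℕ i) (Finₚ.toℕ<n i)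

∏ℕ-* : ∀ n (f g : Series) → ∏ℕ n (λ i → f i ℤ.* g i) ≡ ∏ℕ n f ℤ.* ∏ℕ n g
∏ℕ-* zero    f g = ≡.refl
∏ℕ-* (suc n) f g = ≡.trans (cong (f 0 ℤ.* g 0 ℤ.*_) (∏ℕ-* n (λ i → f (suc i)) (λ i → g (suc i))))
  (interchange (f 0) (g 0) (∏ℕ n (λ i → f (suc i))) (∏ℕ n (λ i → g (suc i))))
  where
  interchange : ∀ a b c d → a ℤ.* b ℤ.* (c ℤ.* d) ≡ a ℤ.* c ℤ.* (b ℤ.* d)
  interchange = solve-∀

∏ℕ-pairs : ∀ k (f : Series) → ∏ℕ (k ℕ.+ k) f ≡ ∏ℕ k (λ c → f (double c) ℤ.* f (suc (double c)))
∏ℕ-pairs zero    f = ≡.refl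
∏ℕ-pairs (suc k) f = begin
  f 0 ℤ.* ∏ℕ (k ℕ.+ suc k) (λ i → f (suc i))
    ≡⟨ cong (λ n → f 0 ℤ.* ∏ℕ n (λ i → f (suc i))) (ℕₚ.+-suc k k) ⟩
  f 0 ℤ.* (f 1 ℤ.* ∏ℕ (k ℕ.+ k) (λ i → f (suc (suc i))))  ≡⟨ ℤₚ.*-assoc (f 0) (f 1) _ ⟨
  f 0 ℤ.* f 1 ℤ.* ∏ℕ (k ℕ.+ k) (λ i → f (suc (suc i)))
    ≡⟨ cong (f 0 ℤ.* f 1 ℤ.*_) (∏ℕ-pairs k (λ i → f (suc (suc i)))) ⟩
  ∏ℕ (suc k) (λ c → f (double c) ℤ.* f (suc (double c))) ∎

∏ℕ-≢0 : ∀ n (f : Series) → (∀ i → f i ≢ + 0) → ∏ℕ n f ≢ + 0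
∏ℕ-≢0 zero    f f≢0 ()
∏ℕ-≢0 (suc n) f f≢0 eq with ℤₚ.i*j≡0⇒i≡0∨j≡0 (f 0) eq
... | inj₁ eq₀ = f≢0 0 eq₀
... | inj₂ eq₁ = ∏ℕ-≢0 n (λ i → f (suc i)) (λ i → f≢0 (suc i)) eq₁

*-cancelʳ : ∀ a b c → c ≢ + 0 → a ℤ.* c ≡ b ℤ.* c → a ≡ b
*-cancelʳ a b c c≢0 = ℤₚ.*-cancelʳ-≡ a b c {{ℤ.≢-nonZero c≢0}}

2^≢0 : ∀ n → 2^ n ≢ + 0
2^≢0 n eq = ℕ.≢-nonZero⁻¹ (2 ℕ.^ n) {{ℕₚ.m^n≢0 2 n}} (ℤₚ.+-injective eq)

sum< : ℕ → (ℕ → ℕ) → ℕ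
sum< zero    f = 0
sum< (suc n) f = f 0 ℕ.+ sum< n (λ i → f (suc i))

∏ℕ-2^ : ∀ n (f : ℕ → ℕ) → ∏ℕ n (λ i → 2^ (f i)) ≡ 2^ (sum< n f)
∏ℕ-2^ zero    f = ≡.refl
∏ℕ-2^ (suc n) f = ≡.trans (cong (2^ (f 0) ℤ.*_) (∏ℕ-2^ n (λ i → f (suc i)))) (≡.sym (2^-+ (f 0) _))

double-+ : ∀ m n → double (m ℕ.+ n) ≡ double m ℕ.+ double n
double-+ zero    n = ≡.refl
double-+ (suc m) n = cong (2 ℕ.+_) (double-+ m n)

double≡ : ∀ n → double n ≡ n ℕ.+ n
double≡ zero    = ≡.refl
double≡ (suc n) = cong suc (≡.trans (cong suc (double≡ n)) (≡.sym (ℕₚ.+-suc n n)))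

sgn-double : ∀ n → sgn (double n) ≡ + 1
sgn-double zero    = ≡.refl
sgn-double (suc n) = ≡.trans (ℤₚ.neg-involutive _) (sgn-double n)

degree≡ : ∀ c e → suc (degree c (double e)) ≡ double (suc (c ℕ.+ e))
degree≡ zero    e = ≡.refl
degree≡ (suc c) e = cong (2 ℕ.+_) (degree≡ c e)

sum<-cong : ∀ n {f g : ℕ → ℕ} → (∀ i → i ℕ.< n → f i ≡ g i) → sum< n f ≡ sum< n g
sum<-cong zero    eq = ≡.refl
sum<-cong (suc n) eq = cong₂ ℕ._+_ (eq 0 (ℕ.s≤s ℕ.z≤n)) (sum<-cong n λ i i<n → eq (suc i) (ℕ.s≤s i<n))

sum<-+ : ∀ n (f g : ℕ → ℕ) → sum< n (λ i → f i ℕ.+ g i) ≡ sum< n f ℕ.+ sum< n g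
sum<-+ zero    f g = ≡.refl
sum<-+ (suc n) f g = ≡.trans (cong (f 0 ℕ.+ g 0 ℕ.+_) (sum<-+ n (λ i → f (suc i)) (λ i → g (suc i))))
  (interchange (f 0) (g 0) _ _)
  where open import Algebra.Properties.CommutativeSemigroup ℕₚ.+-commutativeSemigroup using (interchange)

-- Even degrees go left, where the odd polynomials have no coefficients, in the decreasing order 2k
-- - 2j of the columns of `Dmat`; odd degrees go right, increasing. For every k this arrangement is
-- an even permutation.
columnDegree : ℕ → ℕ → ℕ
columnDegree k = glue k (λ p → double (k ℕ.∸ suc p)) (λ p → suc (double p))

columnDegree-< : ∀ k {p} → p ℕ.< k → columnDegree k p ≡ double (k ℕ.∸ suc p)
columnDegree-< k = glue-< k (λ p → double (k ℕ.∸ suc p)) (λ p → suc (double p))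

columnDegree-+ : ∀ k p → columnDegree k (k ℕ.+ p) ≡ suc (double p)
columnDegree-+ k = glue-+ k (λ p → double (k ℕ.∸ suc p)) (λ p → suc (double p))

columnDegree-bound : ∀ k p → p ℕ.< k ℕ.+ k → columnDegree k p ℕ.< k ℕ.+ k
columnDegree-bound k p p<2k with p ℕ.<? k
... | yes p<k = ℕₚ.<-≤-trans (double-< (ℕₚ.∸-monoʳ-< {k} (ℕ.s≤s (ℕ.z≤n {p})) p<k)) (ℕₚ.≤-reflexive (double≡ k))
  where
  double-< : ∀ {m n} → m ℕ.< n → double m ℕ.< double n
  double-< {zero}  (ℕ.s≤s _)   = ℕ.s≤s ℕ.z≤n
  double-< {suc m} (ℕ.s≤s m<n) = ℕ.s≤s (ℕ.s≤s (double-< m<n))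
... | no  p≮k = ℕₚ.<-≤-trans (suc-double-< p∸k<k) (ℕₚ.≤-reflexive (double≡ k))
  where
  suc-double-< : ∀ {m n} → m ℕ.< n → suc (double m) ℕ.< double n
  suc-double-< {zero}  (ℕ.s≤s _)   = ℕ.s≤s (ℕ.s≤s ℕ.z≤n)
  suc-double-< {suc m} (ℕ.s≤s m<n) = ℕ.s≤s (ℕ.s≤s (suc-double-< m<n))
  p∸k<k : p ℕ.∸ k ℕ.< k
  p∸k<k = ℕₚ.<-≤-trans (ℕₚ.∸-monoˡ-< p<2k (ℕₚ.≮⇒≥ p≮k)) (ℕₚ.≤-reflexive (ℕₚ.m+n∸n≡m k k))

columnDegree-suc-< : ∀ k {p} → p ℕ.< k → columnDegree (suc k) p ≡ suc (suc (columnDegree k p))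
columnDegree-suc-< k {p} p<k = begin
  columnDegree (suc k) p           ≡⟨ columnDegree-< (suc k) (ℕₚ.m<n⇒m<1+n p<k) ⟩
  double (k ℕ.∸ p)                 ≡⟨ cong double (ℕₚ.+-∸-assoc 1 p<k) ⟩
  double (suc (k ℕ.∸ suc p))       ≡⟨ cong (2 ℕ.+_) (columnDegree-< k p<k) ⟨
  suc (suc (columnDegree k p))     ∎

columnDegree-suc-≥ : ∀ k {p} → k ℕ.≤ p → columnDegree (suc k) (suc (suc p)) ≡ suc (suc (columnDegree k p))
columnDegree-suc-≥ k {p} k≤p = ≡.subst (λ p → columnDegree (suc k) (suc (suc p)) ≡ suc (suc (columnDegree k p)))
  (ℕₚ.m+[n∸m]≡n k≤p) (begin
    columnDegree (suc k) (suc (suc (k ℕ.+ (p ℕ.∸ k))))   ≡⟨ cong (columnDegree (suc k) ∘ suc) (ℕₚ.+-suc k (p ℕ.∸ k)) ⟨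
    columnDegree (suc k) (suc k ℕ.+ suc (p ℕ.∸ k))       ≡⟨ columnDegree-+ (suc k) (suc (p ℕ.∸ k)) ⟩
    suc (suc (suc (double (p ℕ.∸ k))))                   ≡⟨ cong (2 ℕ.+_) (columnDegree-+ k (p ℕ.∸ k)) ⟨
    suc (suc (columnDegree k (k ℕ.+ (p ℕ.∸ k))))         ∎)

-- Row 0 has its unit in column k and, once that column is removed, so has row 1.
det-columnDegree : ∀ k → detℕ (k ℕ.+ k) (λ d p → δℕ d (columnDegree k p)) ≡ + 1
det-columnDegree zero    = ≡.refl
det-columnDegree (suc k) = begin
  detℕ (suc k ℕ.+ suc k) P          ≡⟨ cong (λ n → detℕ (suc n) P) (ℕₚ.+-suc k k) ⟩
  detℕ (suc (suc (k ℕ.+ k))) P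
    ≡⟨ detℕ-single (suc (k ℕ.+ k)) P k (ℕ.s≤s (ℕₚ.m≤n⇒m≤1+n (ℕₚ.m≤m+n k k))) (λ p p≢k → δℕ-≢ 0 (col p) (λ eq → col≢0 p p≢k (≡.sym eq))) ⟩
  sgn k ℤ.* (P 0 k ℤ.* detℕ (suc (k ℕ.+ k)) P₁)   ≡⟨ cong₂ (λ x y → sgn k ℤ.* (x ℤ.* y)) (cong (δℕ 0) col-k)
    (detℕ-single (k ℕ.+ k) P₁ k (ℕ.s≤s (ℕₚ.m≤m+n k k)) (λ p p≢k → δℕ-≢ 1 (col (skip k p)) (λ eq → col≢1 p p≢k (≡.sym eq)))) ⟩
  sgn k ℤ.* (+ 1 ℤ.* (sgn k ℤ.* (P₁ 0 k ℤ.* detℕ (k ℕ.+ k) P₂)))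
    ≡⟨ cong₂ (λ x y → sgn k ℤ.* (+ 1 ℤ.* (sgn k ℤ.* (x ℤ.* y)))) (cong (δℕ 1) col-k′)
         (≡.trans (detℕ-cong (k ℕ.+ k) λ d p _ _ → cong (δℕ (suc (suc d))) (col-skip p)) (det-columnDegree k)) ⟩
  sgn k ℤ.* (+ 1 ℤ.* (sgn k ℤ.* (+ 1 ℤ.* + 1)))   ≡⟨ cong (sgn k ℤ.*_) (ℤₚ.*-identityˡ _) ⟩
  sgn k ℤ.* (sgn k ℤ.* (+ 1 ℤ.* + 1))             ≡⟨ sgn-sgn k _ ⟩
  + 1 ∎
  where
  col = columnDegree (suc k)
  P P₁ P₂ : ℕ → ℕ → ℤ
  P  d p = δℕ d (col p)
  P₁ d p = δℕ (suc d) (col (skip k p))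
  P₂ d p = δℕ (suc (suc d)) (col (skip k (skip k p)))
  col-k : col k ≡ 0
  col-k = ≡.trans (columnDegree-< (suc k) ℕₚ.≤-refl) (cong double (ℕₚ.n∸n≡0 k))
  col-suc-k : col (suc k) ≡ 1
  col-suc-k = ≡.trans (cong col (≡.sym (ℕₚ.+-identityʳ (suc k)))) (columnDegree-+ (suc k) 0)
  col-k′ : col (skip k k) ≡ 1
  col-k′ = ≡.trans (cong col (skip-≥ (ℕₚ.≤-refl {k}))) col-suc-k
  col-skip : ∀ p → col (skip k (skip k p)) ≡ suc (suc (columnDegree k p))
  col-skip p = case (p ℕ.<? k) of λ where
    (yes p<k) → ≡.trans (cong (λ x → col (skip k x)) (skip-< p<k))
      (≡.trans (cong col (skip-< p<k)) (columnDegree-suc-< k p<k))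
    (no p≮k) → let k≤p = ℕₚ.≮⇒≥ p≮k in ≡.trans (cong (λ x → col (skip k x)) (skip-≥ k≤p))
      (≡.trans (cong col (skip-≥ (ℕₚ.m≤n⇒m≤1+n k≤p))) (columnDegree-suc-≥ k k≤p))
  col≢0 : ∀ p → p ≢ k → col p ≢ 0
  col≢0 p p≢k eq with ℕₚ.<-cmp p k
  ... | tri< p<k _ _ = ℕₚ.1+n≢0 (≡.trans (≡.sym (columnDegree-suc-< k p<k)) eq)
  ... | tri≈ _ p≡k _ = p≢k p≡k
  ... | tri> _ _ p>k = ℕₚ.1+n≢0 (≡.trans (≡.sym (columnDegree-+ (suc k) (p ℕ.∸ suc k))) (≡.trans (cong col (ℕₚ.m+[n∸m]≡n p>k)) eq))
  col≢1 : ∀ p → p ≢ k → col (skip k p) ≢ 1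
  col≢1 p p≢k eq with ℕₚ.<-cmp p k
  ... | tri< p<k _ _ = ℕₚ.1+n≢0 (ℕₚ.suc-injective (≡.trans (≡.sym (columnDegree-suc-< k p<k)) (≡.trans (cong col (≡.sym (skip-< p<k))) eq)))
  ... | tri≈ _ p≡k _ = p≢k p≡k
  ... | tri> _ _ (ℕ.s≤s k≤p) = ℕₚ.1+n≢0 (ℕₚ.suc-injective (≡.trans (≡.sym (columnDegree-suc-≥ k k≤p)) (≡.trans (cong col (≡.sym (skip-≥ (ℕₚ.m≤n⇒m≤1+n k≤p)))) eq)))

module Binomial (k : ℕ) where

  -- The largest row index 2k - 1, so that K - l is an honest difference in all 2k rows.
  K : ℕ
  K = ℕ.pred (double k)

  B̂ : ℕ → ℕ → ℤ
  B̂ l p = weighted K (columnDegree k p) l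

  B̂-< : ∀ l p → p ℕ.< k → B̂ l p ≡ weighted K (double (k ℕ.∸ suc p)) l
  B̂-< l p p<k = cong (λ d → weighted K d l) (columnDegree-< k p<k)

  B̂-+ : ∀ l p → B̂ l (k ℕ.+ p) ≡ weighted K (suc (double p)) l
  B̂-+ l p = cong (λ d → weighted K d l) (columnDegree-+ k p)

  degree≡K : ∀ c → c ℕ.< k → degree c (double (k ℕ.∸ suc c)) ≡ K
  degree≡K c c<k = cong ℕ.pred (≡.trans (degree≡ c (k ℕ.∸ suc c)) (cong double (ℕₚ.m+[n∸m]≡n c<k)))

  pairing-B̂ : ∀ c d → c ℕ.< k → pairing c (weighted K d) ≡ ℤ.- 2^ (suc (double (k ℕ.∸ suc c))) ℤ.* oddPart c d
  pairing-B̂ c d c<k = ≡.trans (cong (λ K → pairing c (weighted K d)) (≡.sym (degree≡K c c<k)))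
    (pairing-weighted c (double (k ℕ.∸ suc c)) d)

  Q : ℤ
  Q = ∏ℕ k (λ c → ℤ.- 2^ (suc (double (k ℕ.∸ suc c))))

  staircaseSize : ℕ
  staircaseSize = sum< k (λ a → k ℕ.∸ suc a)

  -- The matrix is the unitriangular Pascal matrix times the permutation matrix of `columnDegree`.
  det-binomial : detℕ (k ℕ.+ k) (λ l p → binomial l (columnDegree k p)) ≡ + 1
  det-binomial = begin
    detℕ n (λ l p → binomial l (columnDegree k p))
      ≡⟨ detℕ-cong n (λ l p _ p<n → ≡.sym (≡.trans (sumℕ-cong n {λ d → binomial l d ℤ.* δℕ d (columnDegree k p)} (λ d → ≡.trans (ℤₚ.*-comm (binomial l d) (δℕ d (columnDegree k p))) (cong (ℤ._* binomial l d) (δℕ-sym d (columnDegree k p)))))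
           (sumℕ-δ n (columnDegree k p) (binomial l) (columnDegree-bound k p p<n)))) ⟩
    detℕ n (λ l p → sumℕ n (λ d → binomial l d ℤ.* δℕ d (columnDegree k p)))
      ≡⟨ detℕ-* n binomial (λ d p → δℕ d (columnDegree k p)) ⟩
    detℕ n binomial ℤ.* detℕ n (λ d p → δℕ d (columnDegree k p))
      ≡⟨ cong₂ ℤ._*_ (≡.trans (detℕ-lower-triangular n binomial λ i j i<j _ → binomial-above i j i<j)
           (∏ℕ-one n (λ i → binomial i i) λ i _ → binomial-diagonal i)) (det-columnDegree k) ⟩
    + 1 ℤ.* + 1 ∎
    where
    n = k ℕ.+ k
    δℕ-sym : ∀ m p → δℕ m p ≡ δℕ p m
    δℕ-sym zero    zero    = ≡.refl
    δℕ-sym zero    (suc p) = ≡.refl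
    δℕ-sym (suc m) zero    = ≡.refl
    δℕ-sym (suc m) (suc p) = δℕ-sym m p

  -- The weights of rows 2c and 2c + 1 multiply to -2^(e+1) 2^e with e = 2(k - 1 - c). The first
  -- factors form `Q`, which is also the determinant of the right block and will cancel; the second
  -- give twice the staircase exponent.
  det-B̂ : detℕ (k ℕ.+ k) B̂ ≡ Q ℤ.* 2^ (staircaseSize ℕ.+ staircaseSize)
  det-B̂ = begin
    detℕ n B̂
      ≡⟨ detℕ-cong n (λ l p _ _ → ≡.sym (ℤₚ.*-assoc (sgn l) (2^ (K ℕ.∸ l)) (binomial l (columnDegree k p)))) ⟩
    detℕ n (λ l p → w l ℤ.* binomial l (columnDegree k p))
      ≡⟨ detℕ-scale-rows n w (λ l p → binomial l (columnDegree k p)) ⟩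
    ∏ℕ n w ℤ.* detℕ n (λ l p → binomial l (columnDegree k p))   ≡⟨ cong (∏ℕ n w ℤ.*_) det-binomial ⟩
    ∏ℕ n w ℤ.* + 1                                 ≡⟨ ℤₚ.*-identityʳ (∏ℕ n w) ⟩
    ∏ℕ n w                                         ≡⟨ ∏ℕ-pairs k w ⟩
    ∏ℕ k (λ c → w (double c) ℤ.* w (suc (double c)))   ≡⟨ ∏ℕ-cong k pair ⟩
    ∏ℕ k (λ c → ℤ.- 2^ (suc (e c)) ℤ.* 2^ (e c))        ≡⟨ ∏ℕ-* k (λ c → ℤ.- 2^ (suc (e c))) (λ c → 2^ (e c)) ⟩
    Q ℤ.* ∏ℕ k (λ c → 2^ (e c))                    ≡⟨ cong (Q ℤ.*_) (∏ℕ-2^ k e) ⟩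
    Q ℤ.* 2^ (sum< k e)                            ≡⟨ cong (λ s → Q ℤ.* 2^ s) exponent ⟩
    Q ℤ.* 2^ (staircaseSize ℕ.+ staircaseSize)     ∎
    where
    n = k ℕ.+ k
    w : ℕ → ℤ
    w l = sgn l ℤ.* 2^ (K ℕ.∸ l)
    e : ℕ → ℕ
    e c = double (k ℕ.∸ suc c)
    exponent : sum< k e ≡ staircaseSize ℕ.+ staircaseSize
    exponent = ≡.trans (sum<-cong k λ c _ → double≡ (k ℕ.∸ suc c)) (sum<-+ k _ _)
    K≡ : ∀ c → c ℕ.< k → K ≡ suc (double c ℕ.+ e c)
    K≡ c c<k = ≡.trans (cong (ℕ.pred ∘ double) (≡.sym (ℕₚ.m+[n∸m]≡n c<k))) (cong suc (double-+ c (k ℕ.∸ suc c)))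
    pair : ∀ c → c ℕ.< k → w (double c) ℤ.* w (suc (double c)) ≡ ℤ.- 2^ (suc (e c)) ℤ.* 2^ (e c)
    pair c c<k = begin
      s ℤ.* 2^ (K ℕ.∸ double c) ℤ.* (ℤ.- s ℤ.* 2^ (K ℕ.∸ suc (double c)))
        ≡⟨ cong₂ (λ x y → s ℤ.* 2^ x ℤ.* (ℤ.- s ℤ.* 2^ y))
             (≡.trans (cong (ℕ._∸ double c) (≡.trans (K≡ c c<k) (≡.sym (ℕₚ.+-suc (double c) (e c))))) (ℕₚ.m+n∸m≡n (double c) (suc (e c))))
             (≡.trans (cong (ℕ._∸ suc (double c)) (K≡ c c<k)) (ℕₚ.m+n∸m≡n (suc (double c)) (e c))) ⟩
      s ℤ.* 2^ (suc (e c)) ℤ.* (ℤ.- s ℤ.* 2^ (e c))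
        ≡⟨ cong (λ s → s ℤ.* 2^ (suc (e c)) ℤ.* (ℤ.- s ℤ.* 2^ (e c))) (sgn-double c) ⟩
      + 1 ℤ.* 2^ (suc (e c)) ℤ.* (ℤ.-[1+ 0 ] ℤ.* 2^ (e c))  ≡⟨ collect (2^ (suc (e c))) (2^ (e c)) ⟩
      ℤ.- 2^ (suc (e c)) ℤ.* 2^ (e c) ∎
      where
      s = sgn (double c)
      collect : ∀ x y → + 1 ℤ.* x ℤ.* (ℤ.-[1+ 0 ] ℤ.* y) ≡ ℤ.- x ℤ.* y
      collect = solve-∀

  module _ {L M} (dual : Conjugate k L M) where

    open Complement dual
    open Conjugate dual

    binomialDet : ℤ
    binomialDet = detℕ k (λ i p → binomial (N (k ℕ.∸ suc i)) (double (k ℕ.∸ suc p)))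

    -- Here |λ| enters the exponent: the weight of row `N a` is 2^(K - N a), and K - N a = (k - 1 -
    -- a) + L a.
    left-block : detℕ k (λ i p → sgn (N (k ℕ.∸ suc i)) ℤ.* B̂ (N (k ℕ.∸ suc i)) p) ≡
                 2^ (staircaseSize ℕ.+ sum< k L) ℤ.* binomialDet
    left-block = begin
      detℕ k (λ i p → sgn (N (k ℕ.∸ suc i)) ℤ.* B̂ (N (k ℕ.∸ suc i)) p)
        ≡⟨ detℕ-cong k (λ i p i<k p<k → ≡.trans (cong (sgn (N (k ℕ.∸ suc i)) ℤ.*_) (B̂-< (N (k ℕ.∸ suc i)) p p<k)) (sgn-sgn (N (k ℕ.∸ suc i)) _)) ⟩
      detℕ k (λ i p → g (k ℕ.∸ suc i) (k ℕ.∸ suc p))    ≡⟨ detℕ-reverse k g ⟩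
      detℕ k g                                          ≡⟨ detℕ-scale-rows k (λ a → 2^ (K ℕ.∸ N a)) (λ a q → binomial (N a) (double q)) ⟩
      ∏ℕ k (λ a → 2^ (K ℕ.∸ N a)) ℤ.* detℕ k (λ a q → binomial (N a) (double q))
        ≡⟨ cong₂ ℤ._*_ (∏ℕ-2^ k (λ a → K ℕ.∸ N a)) (≡.sym (detℕ-reverse k (λ a q → binomial (N a) (double q)))) ⟩
      2^ (sum< k (λ a → K ℕ.∸ N a)) ℤ.* binomialDet
        ≡⟨ cong (λ s → 2^ s ℤ.* binomialDet) (≡.trans (sum<-cong k exponent) (sum<-+ k _ L)) ⟩
      2^ (staircaseSize ℕ.+ sum< k L) ℤ.* binomialDet ∎
      where
      g : ℕ → ℕ → ℤ
      g a q = 2^ (K ℕ.∸ N a) ℤ.* binomial (N a) (double q)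
      exponent : ∀ a → a ℕ.< k → K ℕ.∸ N a ≡ (k ℕ.∸ suc a) ℕ.+ L a
      exponent a a<k = ≡.trans (cong (ℕ._∸ N a) (cong ℕ.pred 2k≡)) (ℕₚ.m+n∸m≡n (N a) _)
        where
        x = k ℕ.∸ suc a
        2k≡ : double k ≡ suc (N a ℕ.+ (x ℕ.+ L a))
        2k≡ = begin
          double k                        ≡⟨ double≡ k ⟩
          k ℕ.+ k                         ≡⟨ cong (k ℕ.+_) (ℕₚ.m+[n∸m]≡n a<k) ⟨
          k ℕ.+ suc (a ℕ.+ x)             ≡⟨ ℕₚ.+-suc k (a ℕ.+ x) ⟩
          suc (k ℕ.+ (a ℕ.+ x))           ≡⟨ cong suc (ℕₚ.+-assoc k a x) ⟨
          suc (k ℕ.+ a ℕ.+ x)             ≡⟨ cong (λ y → suc (y ℕ.+ x)) (ℕₚ.m∸n+n≡m (ℕₚ.≤-trans (L≤k a) (ℕₚ.m≤m+n k a))) ⟨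
          suc (N a ℕ.+ L a ℕ.+ x)         ≡⟨ cong suc (ℕₚ.+-assoc (N a) (L a) x) ⟩
          suc (N a ℕ.+ (L a ℕ.+ x))       ≡⟨ cong (λ y → suc (N a ℕ.+ y)) (ℕₚ.+-comm (L a) x) ⟩
          suc (N a ℕ.+ (x ℕ.+ L a))       ∎

    -- The polynomial t (t² - 1)^c is monic of degree 2c + 1, so its odd coefficients form a
    -- unitriangular matrix once the row factors are removed.
    right-block : detℕ k (λ c p → pairing c (λ l → B̂ l (k ℕ.+ p))) ≡ Q
    right-block = begin
      detℕ k (λ c p → pairing c (λ l → B̂ l (k ℕ.+ p)))
        ≡⟨ detℕ-cong k (λ c p c<k _ → ≡.trans (pairing-cong c λ l → B̂-+ l p) (pairing-B̂ c (suc (double p)) c<k)) ⟩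
      detℕ k (λ c p → q c ℤ.* o c p)    ≡⟨ detℕ-scale-rows k q o ⟩
      Q ℤ.* detℕ k o                    ≡⟨ cong (Q ℤ.*_) (≡.trans (detℕ-lower-triangular k o λ i j i<j _ → oddPart-above i j i<j)
                                             (∏ℕ-one k (λ i → o i i) λ i _ → oddPart-diagonal i)) ⟩
      Q ℤ.* + 1                         ≡⟨ ℤₚ.*-identityʳ Q ⟩
      Q                                 ∎
      where
      q : ℕ → ℤ
      q c = ℤ.- 2^ (suc (double (k ℕ.∸ suc c)))
      o : ℕ → ℕ → ℤ
      o c p = oddPart c (suc (double p))

    -- `Minor-*` evaluated for B̂, with the nonzero factors `Q` and one of the two staircase powers
    -- of 2 cancelled inside ℤ.
    Minor-binomialDet : Minor ℤ.* 2^ staircaseSize ≡ 2^ (sum< k L) ℤ.* binomialDet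
    Minor-binomialDet = *-cancelʳ _ _ (2^ T) (2^≢0 T) (*-cancelʳ _ _ Q Q≢0 (begin
      Minor ℤ.* 2^ T ℤ.* 2^ T ℤ.* Q       ≡⟨ regroup Minor (2^ T) Q ⟩
      Minor ℤ.* (Q ℤ.* (2^ T ℤ.* 2^ T))   ≡⟨ cong (λ x → Minor ℤ.* (Q ℤ.* x)) (2^-+ T T) ⟨
      Minor ℤ.* (Q ℤ.* 2^ (T ℕ.+ T))      ≡⟨ cong (Minor ℤ.*_) det-B̂ ⟨
      Minor ℤ.* detℕ (k ℕ.+ k) B̂          ≡⟨ Minor-* B̂ vanishes ⟩
      detℕ k (λ i p → sgn (N (k ℕ.∸ suc i)) ℤ.* B̂ (N (k ℕ.∸ suc i)) p) ℤ.* detℕ k (λ c p → pairing c (λ l → B̂ l (k ℕ.+ p)))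
        ≡⟨ cong₂ ℤ._*_ left-block right-block ⟩
      2^ (T ℕ.+ sum< k L) ℤ.* binomialDet ℤ.* Q
        ≡⟨ cong (λ x → x ℤ.* binomialDet ℤ.* Q) (2^-+ T (sum< k L)) ⟩
      2^ T ℤ.* 2^ (sum< k L) ℤ.* binomialDet ℤ.* Q
        ≡⟨ cong (ℤ._* Q) (regroup′ (2^ T) (2^ (sum< k L)) binomialDet) ⟩
      2^ (sum< k L) ℤ.* binomialDet ℤ.* 2^ T ℤ.* Q ∎))
      where
      T = staircaseSize
      Q≢0 : Q ≢ + 0
      Q≢0 = ∏ℕ-≢0 k (λ c → ℤ.- 2^ (suc (double (k ℕ.∸ suc c)))) λ c eq →
        2^≢0 (suc (double (k ℕ.∸ suc c))) (ℤₚ.neg-injective eq)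
      vanishes : ∀ c p → c ℕ.< k → p ℕ.< k → pairing c (λ l → B̂ l p) ≡ + 0
      vanishes c p c<k p<k = begin
        pairing c (λ l → B̂ l p)                            ≡⟨ pairing-cong c (λ l → B̂-< l p p<k) ⟩
        pairing c (weighted K (double (k ℕ.∸ suc p)))      ≡⟨ pairing-B̂ c _ c<k ⟩
        t ℤ.* oddPart c (double (k ℕ.∸ suc p))             ≡⟨ cong (t ℤ.*_) (oddPart-even c (k ℕ.∸ suc p)) ⟩
        t ℤ.* + 0                                          ≡⟨ ℤₚ.*-zeroʳ t ⟩
        + 0                                                ∎
        where t = ℤ.- 2^ (suc (double (k ℕ.∸ suc c)))
      regroup : ∀ m t q → m ℤ.* t ℤ.* t ℤ.* q ≡ m ℤ.* (q ℤ.* (t ℤ.* t))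
      regroup = solve-∀
      regroup′ : ∀ t s b → t ℤ.* s ℤ.* b ≡ s ℤ.* b ℤ.* t
      regroup′ = solve-∀

-- Partitions

open import Data.Nat.Combinatorics using (_C_; nC1≡n; k>n⇒nCk≡0; nCk+nC[k+1]≡[n+1]C[k+1])

part-step : ∀ {ℓ} → Linked ℕ._≥_ ℓ → ∀ a → part ℓ (suc (suc a)) ℕ.≤ part ℓ (suc a)
part-step []       a       = ℕ.z≤n
part-step [-]      zero    = ℕ.z≤n
part-step [-]      (suc a) = ℕ.z≤n
part-step (r ∷ rs) zero    = r
part-step (r ∷ rs) (suc a) = part-step rs a

part-antitone : ∀ {ℓ} → Linked ℕ._≥_ ℓ → ∀ {a b} → a ℕ.≤ b → part ℓ (suc b) ℕ.≤ part ℓ (suc a)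
part-antitone {ℓ} sorted a≤b = go (ℕₚ.≤⇒≤′ a≤b)
  where
  go : ∀ {a b} → a ℕ.≤′ b → part ℓ (suc b) ℕ.≤ part ℓ (suc a)
  go (ℕ.≤′-reflexive ≡.refl) = ℕₚ.≤-refl
  go (ℕ.≤′-step {n = b} p)   = ℕₚ.≤-trans (part-step sorted b) (go p)

part-beyond : ∀ ℓ a → length ℓ ℕ.≤ a → part ℓ (suc a) ≡ 0
part-beyond []      a       _             = ≡.refl
part-beyond (x ∷ ℓ) (suc a) (ℕ.s≤s len≤a) = part-beyond ℓ a len≤a

part-map-applyUpTo : ∀ (f g : ℕ → ℕ) n j → j ℕ.< n → part (map f (applyUpTo g n)) (suc j) ≡ f (g j)
part-map-applyUpTo f g (suc n) zero    _           = ≡.refl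
part-map-applyUpTo f g (suc n) (suc j) (ℕ.s≤s j<n) = part-map-applyUpTo f (g ∘ suc) n j j<n

length-conj : ∀ ℓ → length (conj ℓ) ≡ part ℓ 1
length-conj ℓ = ≡.trans (Listₚ.length-map _ (applyUpTo suc (part ℓ 1))) (Listₚ.length-applyUpTo suc (part ℓ 1))

count : ℕ → List ℕ → ℕ
count i ℓ = length (filter (λ x → i ℕ.≤? x) ℓ)

part-conj : ∀ ℓ j → j ℕ.< part ℓ 1 → part (conj ℓ) (suc j) ≡ count (suc j) ℓ
part-conj ℓ j = part-map-applyUpTo (λ i → count i ℓ) suc (part ℓ 1) j

-- In a weakly decreasing list the parts greater than j form a prefix, so counting them measures how
-- far it extends.
<part⇒<count : ∀ {ℓ} → Linked ℕ._≥_ ℓ → ∀ a j → j ℕ.< part ℓ (suc a) → a ℕ.< count (suc j) ℓ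
<part⇒<count {x ∷ ℓ} sorted a j j<
  rewrite Listₚ.filter-accept (λ x → suc j ℕ.≤? x) {x} {ℓ} (ℕₚ.<-≤-trans j< (part-antitone sorted (ℕ.z≤n {a}))) = go a j<
  where
  go : ∀ a → j ℕ.< part (x ∷ ℓ) (suc a) → a ℕ.< suc (count (suc j) ℓ)
  go zero    _  = ℕ.s≤s ℕ.z≤n
  go (suc a) j< = ℕ.s≤s (<part⇒<count (Linked.tail sorted) a j j<)

<count⇒<part : ∀ {ℓ} → Linked ℕ._≥_ ℓ → ∀ a j → a ℕ.< count (suc j) ℓ → j ℕ.< part ℓ (suc a)
<count⇒<part {x ∷ ℓ} sorted a j a< = case-x (suc j ℕ.≤? x)
  where
  accepted : ∀ a → j ℕ.< x → a ℕ.< suc (count (suc j) ℓ) → j ℕ.< part (x ∷ ℓ) (suc a)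
  accepted zero    j<x _           = j<x
  accepted (suc a) _   (ℕ.s≤s a<) = <count⇒<part (Linked.tail sorted) a j a<
  case-x : Dec (j ℕ.< x) → j ℕ.< part (x ∷ ℓ) (suc a)
  case-x (yes j<x) = accepted a j<x (ℕₚ.<-≤-trans a< (ℕₚ.≤-reflexive
    (cong length (Listₚ.filter-accept (λ x → suc j ℕ.≤? x) {x} {ℓ} j<x))))
  -- A rejected head leaves the count to the tail; the induction bounds the next part, and
  -- monotonicity carries the bound up to this one.
  case-x (no  j≮x) = ℕₚ.<-≤-trans
    (<count⇒<part (Linked.tail sorted) a j (ℕₚ.<-≤-trans a< (ℕₚ.≤-reflexive
      (cong length (Listₚ.filter-reject (λ x → suc j ℕ.≤? x) {x} {ℓ} j≮x)))))
    (part-step sorted a)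

conjugate : ∀ ℓ k → Linked ℕ._≥_ ℓ → length ℓ ℕ.≤ k → part ℓ 1 ℕ.≤ k →
            Conjugate k (λ a → part ℓ (suc a)) (λ j → part (conj ℓ) (suc j))
conjugate ℓ k sorted len≤k λ₁≤k = record
  { antitone     = part-antitone sorted
  ; L≤k          = λ a → ℕₚ.≤-trans (part-antitone sorted (ℕ.z≤n {a})) λ₁≤k
  ; Lk≡0         = part-beyond ℓ k len≤k
  ; transposed   = λ {a} {j} j< → ℕₚ.<-≤-trans (<part⇒<count sorted a j j<)
      (ℕₚ.≤-reflexive (≡.sym (part-conj ℓ j (ℕₚ.<-≤-trans j< (part-antitone sorted (ℕ.z≤n {a}))))))
  ; transposed⁻¹ = λ {a} {j} a< → case-j a j a< (j ℕ.<? part ℓ 1)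
  }
  where
  case-j : ∀ a j → a ℕ.< part (conj ℓ) (suc j) → Dec (j ℕ.< part ℓ 1) → j ℕ.< part ℓ (suc a)
  case-j a j a< (yes j<) = <count⇒<part sorted a j (ℕₚ.<-≤-trans a< (ℕₚ.≤-reflexive (part-conj ℓ j j<)))
  case-j a j a< (no j≮)  = ⊥-elim (ℕₚ.n≮0 (ℕₚ.<-≤-trans a< (ℕₚ.≤-reflexive
    (part-beyond (conj ℓ) j (ℕₚ.≤-trans (ℕₚ.≤-reflexive (length-conj ℓ)) (ℕₚ.≮⇒≥ j≮))))))

sum<-part : ∀ ℓ k → length ℓ ℕ.≤ k → sum< k (λ a → part ℓ (suc a)) ≡ size ℓ
sum<-part []      zero    _             = ≡.refl
sum<-part []      (suc k) _             = sum<-part [] k ℕ.z≤n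
sum<-part (x ∷ ℓ) (suc k) (ℕ.s≤s len≤k) = cong (x ℕ.+_) (sum<-part ℓ k len≤k)

staircaseSize≡ : ∀ k → Binomial.staircaseSize k ≡ k C 2
staircaseSize≡ zero    = ≡.refl
staircaseSize≡ (suc k) = begin
  k ℕ.+ Binomial.staircaseSize k  ≡⟨ cong₂ ℕ._+_ (≡.sym (nC1≡n k)) (staircaseSize≡ k) ⟩
  (k C 1) ℕ.+ (k C 2)             ≡⟨ nCk+nC[k+1]≡[n+1]C[k+1] k 1 ⟩
  suc k C 2                       ∎

binomial≡C : ∀ n d → binomial n d ≡ + (n C d)
binomial≡C zero    zero    = ≡.refl
binomial≡C zero    (suc d) = cong +_ (≡.sym (k>n⇒nCk≡0 {0} {suc d} (ℕ.s≤s ℕ.z≤n)))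
binomial≡C (suc n) zero    = ≡.trans (ℤₚ.+-identityʳ _) (binomial≡C n zero)
binomial≡C (suc n) (suc d) = begin
  binomial n (suc d) ℤ.+ binomial n d   ≡⟨ cong₂ ℤ._+_ (binomial≡C n (suc d)) (binomial≡C n d) ⟩
  + (n C suc d ℕ.+ n C d)               ≡⟨ cong +_ (ℕₚ.+-comm (n C suc d) (n C d)) ⟩
  + (n C d ℕ.+ n C suc d)               ≡⟨ cong +_ (nCk+nC[k+1]≡[n+1]C[k+1] n d) ⟩
  + (suc n C suc d)                     ∎

detℕ-upper-unitriangular : ∀ n g → (∀ i j → j ℕ.< i → i ℕ.< n → g i j ≡ + 0) → (∀ i → i ℕ.< n → g i i ≡ + 1) → detℕ n g ≡ + 1
detℕ-upper-unitriangular n g zeros ones = begin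
  detℕ n g                 ≡⟨ detℕ-transpose n g ⟨
  detℕ n (λ i j → g j i)   ≡⟨ detℕ-lower-triangular n (λ i j → g j i) (λ i j → zeros j i) ⟩
  ∏ℕ n (λ i → g i i)       ≡⟨ ∏ℕ-one n (λ i → g i i) ones ⟩
  + 1                      ∎

-- The coefficients are determinants of size `length ℓ` or `length (conj ℓ)`, the minor has size k.
-- Beyond the diagram the larger matrix continues with unitriangular rows, which contribute a factor
-- 1.
truncate : ∀ {n k} → n ℕ.≤ k → ∀ g → (∀ i j → n ℕ.≤ i → j ℕ.< i → i ℕ.< k → g i j ≡ + 0) →
           (∀ i → n ℕ.≤ i → i ℕ.< k → g i i ≡ + 1) → detℕ k g ≡ detℕ n g
truncate {n} {k} n≤k g zeros ones = begin
  detℕ k g           ≡⟨ cong (λ k → detℕ k g) k≡ ⟨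
  detℕ (n ℕ.+ x) g   ≡⟨ detℕ-block-upper n x g (λ i j i<x j<n → zeros (n ℕ.+ i) j (ℕₚ.m≤m+n n i) (ℕₚ.<-≤-trans j<n (ℕₚ.m≤m+n n i)) (bound i<x)) ⟩
  detℕ n g ℤ.* detℕ x (λ i j → g (n ℕ.+ i) (n ℕ.+ j))
    ≡⟨ cong (detℕ n g ℤ.*_) (detℕ-upper-unitriangular x _
         (λ i j j<i i<x → zeros (n ℕ.+ i) (n ℕ.+ j) (ℕₚ.m≤m+n n i) (ℕₚ.+-monoʳ-< n j<i) (bound i<x))
         (λ i i<x → ones (n ℕ.+ i) (ℕₚ.m≤m+n n i) (bound i<x))) ⟩
  detℕ n g ℤ.* + 1   ≡⟨ ℤₚ.*-identityʳ _ ⟩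
  detℕ n g           ∎
  where
  x = k ℕ.∸ n
  k≡ : n ℕ.+ x ≡ k
  k≡ = ℕₚ.m+[n∸m]≡n n≤k
  bound : ∀ {i} → i ℕ.< x → n ℕ.+ i ℕ.< k
  bound i<x = ℕₚ.<-≤-trans (ℕₚ.+-monoʳ-< n i<x) (ℕₚ.≤-reflexive k≡)

-- Both sides read f at n - s = M - N, or are 0 if this is negative. Padding each side by a common
-- shift replaces the signed difference.
shiftⁿ-balance : ∀ s n N M (f : Series) → s ℕ.+ M ≡ n ℕ.+ N → shiftⁿ s f n ≡ shiftⁿ N f M
shiftⁿ-balance s n N M f eq = begin
  shiftⁿ s f n                      ≡⟨ common M s n ⟨
  shiftⁿ (M ℕ.+ s) f (M ℕ.+ n)
    ≡⟨ cong₂ (λ x y → shiftⁿ x f y) (≡.trans (ℕₚ.+-comm M s) eq) (ℕₚ.+-comm M n) ⟩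
  shiftⁿ (n ℕ.+ N) f (n ℕ.+ M)      ≡⟨ common n N M ⟩
  shiftⁿ N f M                      ∎
  where
  common : ∀ c s n → shiftⁿ (c ℕ.+ s) f (c ℕ.+ n) ≡ shiftⁿ s f n
  common zero    s n = ≡.refl
  common (suc c) s n = common c s n

lookup-staircase : ∀ ℓ i → lookup (staircase ℓ) i ≡ part ℓ (suc (toℕ i)) ℕ.+ (length ℓ ℕ.∸ suc (toℕ i))
lookup-staircase ℓ = Vecₚ.lookup∘tabulate _

-- The three determinants of the theorem in terms of one minor

module Evaluation (ℓ : List ℕ) (k : ℕ) (sorted : Linked ℕ._≥_ ℓ) (len≤k : length ℓ ℕ.≤ k) (λ₁≤k : part ℓ 1 ℕ.≤ k) where

  conj-ℓ = conjugate ℓ k sorted len≤k λ₁≤k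
  open Complement conj-ℓ hiding (Nᶜ)
  open Complement conj-ℓ using () renaming (Nᶜ to column)
  open Conjugate conj-ℓ

  m n : ℕ
  m = length ℓ
  n = length (conj ℓ)

  n≤k : n ℕ.≤ k
  n≤k = ℕₚ.≤-trans (ℕₚ.≤-reflexive (length-conj ℓ)) λ₁≤k

  -- Row i, counted from 0, has upper index 2k - 1 - i - λ_(k-i), which is `N a` for a = k - 1 - i;
  -- the lower indices are the even numbers 2(k - 1 - j).
  D≡binomialDet : D ℓ k ≡ Binomial.binomialDet k conj-ℓ
  D≡binomialDet = ≡.trans (det≡ k (Dmat ℓ k)) (D-ℤ.det-cong k λ i j → entry (toℕ i) (toℕ j) (Finₚ.toℕ<n i))
    where
    2k≡ : 2 ℕ.* k ≡ k ℕ.+ k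
    2k≡ = cong (k ℕ.+_) (ℕₚ.+-identityʳ k)
    entry : ∀ i j → i ℕ.< k → + (((2 ℕ.* k) ℕ.∸ suc i ℕ.∸ part ℓ (k ℕ.∸ i)) C ((2 ℕ.* k) ℕ.∸ (2 ℕ.* suc j))) ≡
            binomial (N (k ℕ.∸ suc i)) (double (k ℕ.∸ suc j))
    entry i j i<k = ≡.sym (≡.trans (binomial≡C (N (k ℕ.∸ suc i)) (double (k ℕ.∸ suc j))) (cong +_ (cong₂ _C_
      (cong₂ ℕ._∸_ (≡.sym (≡.trans (cong (ℕ._∸ suc i) 2k≡) (ℕₚ.+-∸-assoc k i<k)))
        (cong (part ℓ) (≡.sym (ℕₚ.+-∸-assoc 1 i<k))))
      (begin
        double (k ℕ.∸ suc j)                      ≡⟨ double≡ (k ℕ.∸ suc j) ⟩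
        (k ℕ.∸ suc j) ℕ.+ (k ℕ.∸ suc j)           ≡⟨ cong ((k ℕ.∸ suc j) ℕ.+_) (ℕₚ.+-identityʳ (k ℕ.∸ suc j)) ⟨
        2 ℕ.* (k ℕ.∸ suc j)                       ≡⟨ ℕₚ.*-distribˡ-∸ 2 k (suc j) ⟩
        2 ℕ.* k ℕ.∸ 2 ℕ.* suc j                   ∎))))

  -- The exponent λ_(i+1) + m - 1 - i minus the shift m - 1 - j equals (k + j) - N i, so the entries
  -- are values of `H` with M = k + j, and l(λ) no longer appears in them.
  series1≡Minor : series1 m k (staircase ℓ) ≡ Minor
  series1≡Minor = begin
    series1 m k (staircase ℓ)                   ≡⟨ series1-coefficient m k (staircase ℓ) ⟩
    D-ℤ.det m (λ i j → shiftⁿ (m ℕ.∸ suc (toℕ j)) (λ a → Γ a (k ℕ.+ toℕ j)) (lookup (staircase ℓ) i))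
      ≡⟨ D-ℤ.det-cong m (λ i j → ≡.trans (cong (shiftⁿ (m ℕ.∸ suc (toℕ j)) (λ a → Γ a (k ℕ.+ toℕ j))) (lookup-staircase ℓ i))
           (entry (toℕ i) (toℕ j) (Finₚ.toℕ<n i) (Finₚ.toℕ<n j))) ⟩
    detℕ m g                                    ≡⟨ truncate len≤k g zeros ones ⟨
    detℕ k g                                    ≡⟨ detℕ-reverse k g ⟨
    detℕ k (λ i p → H (N (k ℕ.∸ suc i)) (k ℕ.+ (k ℕ.∸ suc p)))
      ≡⟨ detℕ-cong k (λ i p _ p<k → cong (H (N (k ℕ.∸ suc i))) (ℕₚ.+-∸-assoc k p<k)) ⟨
    H-det k conj-ℓ                              ≡⟨ Minor≡H-det k conj-ℓ ⟨
    Minor                                       ∎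
    where
    g : ℕ → ℕ → ℤ
    g a q = H (N a) (k ℕ.+ q)
    N-beyond : ∀ a → m ℕ.≤ a → N a ≡ k ℕ.+ a
    N-beyond a m≤a = cong (k ℕ.+ a ℕ.∸_) (part-beyond ℓ a m≤a)
    zeros : ∀ i j → m ℕ.≤ i → j ℕ.< i → i ℕ.< k → g i j ≡ + 0
    zeros i j m≤i j<i _ = ≡.trans (cong (λ x → H x (k ℕ.+ j)) (N-beyond i m≤i))
      (shiftⁿ-below (k ℕ.+ i) (λ a → Γ a (k ℕ.+ j)) (k ℕ.+ j) (ℕₚ.+-monoʳ-< k j<i))
    ones : ∀ i → m ℕ.≤ i → i ℕ.< k → g i i ≡ + 1
    ones i m≤i _ = ≡.trans (cong (λ x → H x (k ℕ.+ i)) (N-beyond i m≤i)) (shiftⁿ-diagonal (k ℕ.+ i) (λ a → Γ a (k ℕ.+ i)))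
    entry : ∀ i j → i ℕ.< m → j ℕ.< m →
            shiftⁿ (m ℕ.∸ suc j) (λ a → Γ a (k ℕ.+ j)) (part ℓ (suc i) ℕ.+ (m ℕ.∸ suc i)) ≡ g i j
    entry i j i<m j<m = shiftⁿ-balance (m ℕ.∸ suc j) _ (N i) (k ℕ.+ j) (λ a → Γ a (k ℕ.+ j)) (ℕₚ.suc-injective (begin
      suc ((m ℕ.∸ suc j) ℕ.+ (k ℕ.+ j))     ≡⟨ total j j<m ⟩
      k ℕ.+ m                               ≡⟨ total i i<m ⟨
      suc (x ℕ.+ (k ℕ.+ i))                 ≡⟨ cong (λ y → suc (x ℕ.+ y)) (ℕₚ.m+[n∸m]≡n (ℕₚ.≤-trans (L≤k i) (ℕₚ.m≤m+n k i))) ⟨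
      suc (x ℕ.+ (part ℓ (suc i) ℕ.+ N i))  ≡⟨ cong suc (ℕₚ.+-assoc x (part ℓ (suc i)) (N i)) ⟨
      suc (x ℕ.+ part ℓ (suc i) ℕ.+ N i)    ≡⟨ cong (λ y → suc (y ℕ.+ N i)) (ℕₚ.+-comm x (part ℓ (suc i))) ⟩
      suc (part ℓ (suc i) ℕ.+ x ℕ.+ N i)    ∎))
      where
      x = m ℕ.∸ suc i
      total : ∀ j → j ℕ.< m → suc ((m ℕ.∸ suc j) ℕ.+ (k ℕ.+ j)) ≡ k ℕ.+ m
      total j j<m = begin
        suc ((m ℕ.∸ suc j) ℕ.+ (k ℕ.+ j))   ≡⟨ cong suc (ℕₚ.+-comm (m ℕ.∸ suc j) (k ℕ.+ j)) ⟩
        suc (k ℕ.+ j ℕ.+ (m ℕ.∸ suc j))     ≡⟨ cong suc (ℕₚ.+-assoc k j _) ⟩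
        suc (k ℕ.+ (j ℕ.+ (m ℕ.∸ suc j)))   ≡⟨ ℕₚ.+-suc k _ ⟨
        k ℕ.+ (suc j ℕ.+ (m ℕ.∸ suc j))     ≡⟨ cong (k ℕ.+_) (ℕₚ.m+[n∸m]≡n j<m) ⟩
        k ℕ.+ m                             ∎

  -- The offset k - n left behind by (1 + z)^(k-n) turns the exponent μ_(i+1) + n - 1 - i into
  -- `column i`, which refers to k instead of n.
  series2≡Minor : series2 n k (staircase (conj ℓ)) ≡ Minor
  series2≡Minor = begin
    series2 n k (staircase (conj ℓ))            ≡⟨ series2-coefficient n k (staircase (conj ℓ)) ⟩
    D-ℤ.det n (λ i j → E ((k ℕ.∸ n) ℕ.+ (n ℕ.∸ suc (toℕ j))) ((k ℕ.∸ n) ℕ.+ lookup (staircase (conj ℓ)) i))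
      ≡⟨ D-ℤ.det-cong n (λ i j → cong₂ E (padded (toℕ j) (Finₚ.toℕ<n j))
           (≡.trans (cong ((k ℕ.∸ n) ℕ.+_) (lookup-staircase (conj ℓ) i)) (column≡ (toℕ i) (Finₚ.toℕ<n i)))) ⟩
    detℕ n g                                    ≡⟨ truncate n≤k g zeros ones ⟨
    detℕ k g                                    ≡⟨ detℕ-reverse k g ⟨
    detℕ k (λ i p → g (k ℕ.∸ suc i) (k ℕ.∸ suc p))
      ≡⟨ detℕ-cong k (λ i p _ p<k → cong (λ c → E c (column (k ℕ.∸ suc i))) (reverse² p<k)) ⟩
    detℕ k (λ i p → E p (column (k ℕ.∸ suc i))) ≡⟨ detℕ-transpose k (λ i p → E i (column (k ℕ.∸ suc p))) ⟩
    Minor                                       ∎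
    where
    g : ℕ → ℕ → ℤ
    g a q = E (k ℕ.∸ suc q) (column a)
    padded : ∀ j → j ℕ.< n → (k ℕ.∸ n) ℕ.+ (n ℕ.∸ suc j) ≡ k ℕ.∸ suc j
    padded j j<n = ≡.trans (≡.sym (ℕₚ.+-∸-assoc (k ℕ.∸ n) j<n)) (cong (ℕ._∸ suc j) (ℕₚ.m∸n+n≡m n≤k))
    column≡ : ∀ i → i ℕ.< n → (k ℕ.∸ n) ℕ.+ (part (conj ℓ) (suc i) ℕ.+ (n ℕ.∸ suc i)) ≡ column i
    column≡ i i<n = begin
      (k ℕ.∸ n) ℕ.+ (part (conj ℓ) (suc i) ℕ.+ (n ℕ.∸ suc i))
        ≡⟨ cong ((k ℕ.∸ n) ℕ.+_) (ℕₚ.+-comm (part (conj ℓ) (suc i)) _) ⟩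
      (k ℕ.∸ n) ℕ.+ ((n ℕ.∸ suc i) ℕ.+ part (conj ℓ) (suc i))   ≡⟨ ℕₚ.+-assoc (k ℕ.∸ n) _ _ ⟨
      (k ℕ.∸ n) ℕ.+ (n ℕ.∸ suc i) ℕ.+ part (conj ℓ) (suc i)     ≡⟨ cong (ℕ._+ part (conj ℓ) (suc i)) (padded i i<n) ⟩
      column i                                                  ∎
    column-beyond : ∀ a → n ℕ.≤ a → column a ≡ k ℕ.∸ suc a
    column-beyond a n≤a = ≡.trans (cong ((k ℕ.∸ suc a) ℕ.+_) (part-beyond (conj ℓ) a n≤a)) (ℕₚ.+-identityʳ _)
    zeros : ∀ i j → n ℕ.≤ i → j ℕ.< i → i ℕ.< k → g i j ≡ + 0
    zeros i j n≤i j<i i<k = ≡.trans (cong (E (k ℕ.∸ suc j)) (column-beyond i n≤i))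
      (E-below (k ℕ.∸ suc j) (k ℕ.∸ suc i) (ℕₚ.∸-monoʳ-< {k} (ℕ.s≤s j<i) i<k))
    ones : ∀ i → n ℕ.≤ i → i ℕ.< k → g i i ≡ + 1
    ones i n≤i _ = ≡.trans (cong (E (k ℕ.∸ suc i)) (column-beyond i n≤i)) (E-diagonal (k ℕ.∸ suc i))

  Minor-D : Minor ℤ.* 2^ (k C 2) ≡ 2^ (size ℓ) ℤ.* D ℓ k
  Minor-D = begin
    Minor ℤ.* 2^ (k C 2)                          ≡⟨ cong (λ t → Minor ℤ.* 2^ t) (staircaseSize≡ k) ⟨
    Minor ℤ.* 2^ (Binomial.staircaseSize k)       ≡⟨ Binomial.Minor-binomialDet k conj-ℓ ⟩
    2^ (sum< k (λ a → part ℓ (suc a))) ℤ.* Binomial.binomialDet k conj-ℓ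
      ≡⟨ cong₂ (λ s d → 2^ s ℤ.* d) (sum<-part ℓ k len≤k) (≡.sym D≡binomialDet) ⟩
    2^ (size ℓ) ℤ.* D ℓ k                         ∎

-- Powers of two over the rationals

toℚ-* : ∀ a b → toℚ (a ℤ.* b) ≡ toℚ a ℚ.* toℚ b
toℚ-* a b = ℚₚ.toℚᵘ-injective (ℚᵘₚ.≃-trans (ℚₚ.toℚᵘ-fromℚᵘ (mkℚᵘ (a ℤ.* b) 0))
  (ℚᵘₚ.≃-sym (ℚᵘₚ.≃-trans (ℚₚ.toℚᵘ-homo-* (toℚ a) (toℚ b))
    (ℚᵘₚ.*-cong (ℚₚ.toℚᵘ-fromℚᵘ (mkℚᵘ a 0)) (ℚₚ.toℚᵘ-fromℚᵘ (mkℚᵘ b 0))))))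

pow2-negative : ∀ n → pow2 ℤ.-[1+ n ] ℚ.* toℚ (2^ (suc n)) ≡ ℚ.1ℚ
pow2-negative zero    = ≡.refl
pow2-negative (suc n) = begin
  ℚ.½ ℚ.* p ℚ.* toℚ (2^ (suc (suc n)))             ≡⟨ cong (ℚ.½ ℚ.* p ℚ.*_) (≡.trans (cong toℚ (2^-suc (suc n))) (toℚ-* (+ 2) (2^ (suc n)))) ⟩
  ℚ.½ ℚ.* p ℚ.* (toℚ (+ 2) ℚ.* toℚ (2^ (suc n)))   ≡⟨ interchange ℚ.½ p (toℚ (+ 2)) (toℚ (2^ (suc n))) ⟩
  ℚ.½ ℚ.* toℚ (+ 2) ℚ.* (p ℚ.* toℚ (2^ (suc n)))   ≡⟨ cong (ℚ.½ ℚ.* toℚ (+ 2) ℚ.*_) (pow2-negative n) ⟩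
  ℚ.½ ℚ.* toℚ (+ 2) ℚ.* ℚ.1ℚ                       ≡⟨⟩
  ℚ.1ℚ                                             ∎
  where
  p = pow2 ℤ.-[1+ n ]
  open import Algebra.Properties.CommutativeSemigroup (CommutativeMonoid.commutativeSemigroup ℚₚ.*-1-commutativeMonoid) using (interchange)

-- The integral identity has a power of 2 on each side. Either exponent can be the larger one, so
-- the surplus is moved to x as an integer factor or as a power of one half.
pow2-solve : ∀ a b x y → x ℤ.* 2^ a ≡ 2^ b ℤ.* y → toℚ y ≡ pow2 (+ a ℤ.- + b) ℚ.* toℚ x
pow2-solve a b x y eq with b ℕ.≤? a
... | yes b≤a = begin
  toℚ y                                ≡⟨ cong toℚ y≡ ⟩
  toℚ (2^ c ℤ.* x)                     ≡⟨ toℚ-* (2^ c) x ⟩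
  pow2 (+ c) ℚ.* toℚ x                 ≡⟨ cong (λ e → pow2 e ℚ.* toℚ x) (≡.trans (ℤₚ.m-n≡m⊖n a b) (ℤₚ.⊖-≥ b≤a)) ⟨
  pow2 (+ a ℤ.- + b) ℚ.* toℚ x         ∎
  where
  c = a ℕ.∸ b
  y≡ : y ≡ 2^ c ℤ.* x
  y≡ = *-cancelʳ y (2^ c ℤ.* x) (2^ b) (2^≢0 b) (begin
    y ℤ.* 2^ b              ≡⟨ ℤₚ.*-comm y (2^ b) ⟩
    2^ b ℤ.* y              ≡⟨ eq ⟨
    x ℤ.* 2^ a              ≡⟨ cong (λ a → x ℤ.* 2^ a) (ℕₚ.m∸n+n≡m b≤a) ⟨
    x ℤ.* 2^ (c ℕ.+ b)      ≡⟨ cong (x ℤ.*_) (2^-+ c b) ⟩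
    x ℤ.* (2^ c ℤ.* 2^ b)   ≡⟨ ℤₚ.*-assoc x (2^ c) (2^ b) ⟨
    x ℤ.* 2^ c ℤ.* 2^ b     ≡⟨ cong (ℤ._* 2^ b) (ℤₚ.*-comm x (2^ c)) ⟩
    2^ c ℤ.* x ℤ.* 2^ b     ∎)
... | no b≰a = begin
  toℚ y                                    ≡⟨ ℚₚ.*-identityˡ (toℚ y) ⟨
  ℚ.1ℚ ℚ.* toℚ y                           ≡⟨ cong (ℚ._* toℚ y) (pow2-negative c) ⟨
  p ℚ.* toℚ (2^ (suc c)) ℚ.* toℚ y         ≡⟨ ℚₚ.*-assoc p (toℚ (2^ (suc c))) (toℚ y) ⟩
  p ℚ.* (toℚ (2^ (suc c)) ℚ.* toℚ y)       ≡⟨ cong (p ℚ.*_) (toℚ-* (2^ (suc c)) y) ⟨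
  p ℚ.* toℚ (2^ (suc c) ℤ.* y)             ≡⟨ cong (λ z → p ℚ.* toℚ z) x≡ ⟨
  p ℚ.* toℚ x                              ≡⟨ cong (λ e → pow2 e ℚ.* toℚ x) exponent ⟨
  pow2 (+ a ℤ.- + b) ℚ.* toℚ x             ∎
  where
  a<b = ℕₚ.≰⇒> b≰a
  c = b ℕ.∸ suc a
  p = pow2 ℤ.-[1+ c ]
  b≡ : b ≡ suc c ℕ.+ a
  b≡ = ≡.sym (≡.trans (≡.sym (ℕₚ.+-suc c a)) (ℕₚ.m∸n+n≡m a<b))
  exponent : + a ℤ.- + b ≡ ℤ.-[1+ c ]
  exponent = begin
    + a ℤ.- + b          ≡⟨ ℤₚ.m-n≡m⊖n a b ⟩
    a ℤ.⊖ b              ≡⟨ ℤₚ.⊖-< a<b ⟩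
    ℤ.- + (b ℕ.∸ a)      ≡⟨ cong (λ b → ℤ.- + (b ℕ.∸ a)) b≡ ⟩
    ℤ.- + (suc c ℕ.+ a ℕ.∸ a)  ≡⟨ cong (λ d → ℤ.- + d) (ℕₚ.m+n∸n≡m (suc c) a) ⟩
    ℤ.-[1+ c ]           ∎
  x≡ : x ≡ 2^ (suc c) ℤ.* y
  x≡ = *-cancelʳ x (2^ (suc c) ℤ.* y) (2^ a) (2^≢0 a) (begin
    x ℤ.* 2^ a                        ≡⟨ eq ⟩
    2^ b ℤ.* y                        ≡⟨ cong (λ b → 2^ b ℤ.* y) b≡ ⟩
    2^ (suc c ℕ.+ a) ℤ.* y            ≡⟨ cong (ℤ._* y) (2^-+ (suc c) a) ⟩
    2^ (suc c) ℤ.* 2^ a ℤ.* y         ≡⟨ ℤₚ.*-assoc (2^ (suc c)) (2^ a) y ⟩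
    2^ (suc c) ℤ.* (2^ a ℤ.* y)       ≡⟨ cong (2^ (suc c) ℤ.*_) (ℤₚ.*-comm (2^ a) y) ⟩
    2^ (suc c) ℤ.* (y ℤ.* 2^ a)       ≡⟨ ℤₚ.*-assoc (2^ (suc c)) y (2^ a) ⟨
    2^ (suc c) ℤ.* y ℤ.* 2^ a         ∎)

open import Data.Nat using (_≤_)
open import Data.Rational using (_*_)

theorem1p2 : (ℓ : List ℕ) → IsPartition ℓ → (k : ℕ) → length ℓ ≤ k → part ℓ 1 ≤ k →
    (toℚ (D ℓ k) ≡ pow2 (expo ℓ k) * toℚ (series1 (length ℓ) k (staircase ℓ)))
    × (toℚ (D ℓ k) ≡ pow2 (expo ℓ k) * toℚ (series2 (length (conj ℓ)) k (staircase (conj ℓ))))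
theorem1p2 ℓ (_ , sorted) k len≤k λ₁≤k = solve series1≡Minor , solve series2≡Minor
  where
  open Evaluation ℓ k sorted len≤k λ₁≤k
  -- Both coefficients equal the same minor, so a single relation between it and `D ℓ k` settles
  -- both formulas.
  solve : ∀ {x} → x ≡ Complement.Minor conj-ℓ → toℚ (D ℓ k) ≡ pow2 (expo ℓ k) * toℚ x
  solve {x} eq = pow2-solve (k C 2) (size ℓ) x (D ℓ k) (≡.trans (cong (ℤ._* 2^ (k C 2)) eq) Minor-D)
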